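{- Let $n$ be a positive integer and let $\mathcal{G}$ be a dual equivalence graph of type $(n,n)$. Then every connected component of $\mathcal{G}$ is isomorphic to the standard dual equivalence graph $\mathcal{G}_\lambda$ for a unique partition $\lambda$ of $n$.
   Context: **Signed, colored graphs.** A signed, colored graph of type $(n,N)$, written $\mathcal{G}=(V,\sigma,E_2\cup\cdots\cup E_{n-1})$, consists of a finite vertex set $V$, a signature function $\sigma:V\to\{\pm1\}^{N-1}$ with coordinates $\sigma(v)_1,\dots,\sigma(v)_{N-1}$, and for each $1<i<n$ a collection $E_i$ of (unordered) pairs of distinct vertices, the edges of color $i$ (a pair may belong to several $E_i$). **Dual equivalence graphs.** A signed, colored graph of type $(n,N)$ is a dual equivalence graph of type $(n,N)$ if $n\le N$ and the following hold (conditions on coordinates of $\sigma$ being imposed only for indices in $\{1,\dots,N-1\}$). (ax1) For $w\in V$ and $1<i<n$, $\sigma(w)_{i-1}=-\sigma(w)_i$ if and only if there exists $x\in V$ with $\{w,x\}\in E_i$; moreover $x$ is unique when it exists. (ax2) For $\{w,x\}\in E_i$, $\sigma(w)_j=-\sigma(x)_j$ for $j=i-1,i$, and $\sigma(w)_h=\sigma(x)_h$ for $h<i-2$ and $h>i+1$. (ax3) For $\{w,x\}\in E_i$: if $\sigma(w)_{i-2}=-\sigma(x)_{i-2}$ then $\sigma(w)_{i-2}=-\sigma(w)_{i-1}$; and if $\sigma(w)_{i+1}=-\sigma(x)_{i+1}$ then $\sigma(w)_{i+1}=-\sigma(w)_i$. (ax4) For $2<i<n$, every connected component of $(V,\sigma,E_{i-1}\cup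 E_i)$ is, as an edge-colored graph, one of: a single vertex; a path on three vertices with one edge of color $i-1$ and one of color $i$; two vertices joined by both an edge of color $i-1$ and an edge of color $i$. For $3<i<n$, every connected component of $(V,\sigma,E_{i-2}\cup E_{i-1}\cup E_i)$ is one of: a single vertex; a path $v_1v_2v_3v_4$ with successive colors $i-2,i-1,i$; a graph on $v_1,\dots,v_5$ with $\{v_1,v_2\}\in E_{i-2}\cap E_{i-1}$, $\{v_2,v_3\}\in E_i$, $\{v_3,v_4\}\in E_{i-2}$, $\{v_4,v_5\}\in E_{i-1}\cap E_i$ and no other edges; a graph on six vertices $u,v,w,x,y,z$ with $\{u,v\}\in E_{i-1}$, $\{v,w\}\in E_{i-2}$, $\{v,x\}\in E_i$, $\{w,y\}\in E_i$, $\{x,y\}\in E_{i-2}$, $\{y,z\}\in E_{i-1}$ and no other edges. (ax5) If $\{w,x\}\in E_i$ and $\{x,y\}\in E_j$ with $|i-j|\ge3$, then $\{w,v\}\in E_j$ and $\{v,y\}\in E_i$ for some $v\in V$. (ax6) For each $1<i<n$, any two vertices of a connected component of $(V,\sigma,E_2\cup\cdots\cup E_i)$ may be connected by a path crossing at most one $E_i$ edge. **Standard graphs.** The diagram of a partition $\lambda$ is the set of cells $(i,j)$ with $1\le i\le\lambda_j$ ($i$ the column, $j$ the row, rows numbered from bottom to top). $\mathrm{SYT}(\lambda)$ is the set of standard Young tableaux of shape $\lambda$: bijective fillings by $1,\dots,n$ increasing along rows left to right and up columns. The content of $(i,j)$ is $i-j$. The content reading word $w_T$ lists the entries of $T$ in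 increasing order of content, reading each diagonal (constant content) southwest to northeast. The descent signature is $\sigma(T)\in\{\pm1\}^{n-1}$ with $\sigma(T)_i=+1$ if $i$ is to the left of $i+1$ in $w_T$, and $-1$ otherwise. An elementary dual equivalence for $i-1,i,i+1$ is defined on permutations in which $i$ does not lie between $i-1$ and $i+1$ in position: among the three letters $i-1,i,i+1$, it switches the two in the outermost positions. $\mathcal{G}_\lambda$ is the signed, colored graph of type $(n,n)$ on $\mathrm{SYT}(\lambda)$ with signature $\sigma(T)$ and $\{T,U\}\in E_i$ iff $w_T$ and $w_U$ differ by an elementary dual equivalence for $i-1,i,i+1$. **Isomorphism.** A morphism from $(V,\sigma,E)$ to $(W,\tau,F)$, both of type $(n,N)$, is a map $\phi:V\to W$ with $\sigma(v)_i=\tau(\phi(v))_i$ for all $v$ and $1\le i<N$, and $\{u,v\}\in E_i\Rightarrow\{\phi(u),\phi(v)\}\in F_i$ for all $1<i<n$. It is an isomorphism if it is a bijection on vertex sets. -}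

module Defs where

open import Level using (0ℓ)
open import Data.Nat using (ℕ; suc; _+_; _∸_; _≤_; _<_; _≥_; ∣_-_∣; _≟_; z≤n; s≤s)
open import Data.Nat.ListAction using (sum)
import Data.Nat.Properties as ℕₚ
open import Data.Integer using (ℤ; _⊖_)
import Data.Integer as ℤ
open import Data.Fin using (Fin; toℕ)
import Data.Fin as Fin
open import Data.Fin.Patterns using (0F; 1F; 2F; 3F; 4F; 5F)
open import Data.Sign using (Sign; opposite)
import Data.Sign as Sign
open import Data.Bool using (if_then_else_)
open import Data.List
  using (List; []; _∷_; _++_; map; concatMap; filter; length; lookup; allFin; upTo)
import Data.List.Properties as Listₚ
open import Data.List.Membership.Propositional using (_∈_)
open import Data.List.Relation.Unary.All using (All; []; _∷_)
open import Data.List.Relation.Unary.AllPairs using ([]; _∷_)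
open import Data.List.Relation.Unary.Linked using (Linked)
open import Data.List.Relation.Binary.Permutation.Propositional
  using (_↭_; ↭-sym; ↭-trans; ↭⇒↭ₛ)
open import Data.List.Relation.Binary.Permutation.Propositional.Properties
  using (↭-reverse)
import Data.List.Relation.Binary.Permutation.Setoid.Properties as ↭ₛ
open import Data.List.Relation.Binary.Sublist.DecPropositional _≟_ using (_⊆?_)
open import Data.Product using (Σ; ∃; ∃-syntax; _×_; _,_; proj₁; proj₂)
open import Data.Sum using (_⊎_)
open import Function.Bundles using (Func; Inverse; _⇔_)
open import Function.Definitions using (Bijective)
open import Relation.Nullary using (¬_; does)
open import Relation.Binary.Bundles using (Setoid)
open import Relation.Binary.Core using (Rel)
open import Relation.Binary.PropositionalEquality
  using (_≡_; _≢_; refl; sym; trans; cong; subst₂)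
import Relation.Binary.PropositionalEquality as ≡
import Relation.Binary.Construct.On as On

------------------------------------------------------------------------
-- Signed, colored graphs

-- Signature coordinates are numbered 1, …, N-1, while Fin starts at 0.
pos : ∀ {m} → Fin m → ℕ
pos c = suc (toℕ c)

-- The vertices form a setoid, so that the vertices of a component (a vertex
-- together with a path to it) and standard tableaux (fillings given as
-- functions) can be compared without their proof components.  Finiteness of
-- the vertex set is a field of IsDualEquivalenceGraph.
record SignedColoredGraph (n N : ℕ) : Set₁ where
  field
    vertices : Setoid 0ℓ 0ℓ

  open Setoid vertices public using (_≈_) renaming (Carrier to Vertex)

  field
    σ       : Vertex → Fin (N ∸ 1) → Sign
    E       : ℕ → Rel Vertex 0ℓ
    σ-cong  : ∀ {v w} → v ≈ w → ∀ c → σ v c ≡ σ w c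
    E-resp  : ∀ {i v v′ w w′} → v ≈ v′ → w ≈ w′ → E i v w → E i v′ w′
    E-sym   : ∀ {i v w} → E i v w → E i w v
    E-irr   : ∀ {i v w} → E i v w → ¬ v ≈ w
    E-color : ∀ {i v w} → E i v w → 1 < i × i < n

Finite : Setoid 0ℓ 0ℓ → Set
Finite S = ∃[ m ] Inverse S (≡.setoid (Fin m))

Between : ℕ → ℕ → ℕ → Set
Between a b c = a ≤ c × c ≤ b

module _ {n N} (𝒢 : SignedColoredGraph n N) where
  open SignedColoredGraph 𝒢

  -- Every step of a path follows an edge of one specified color in C: a pair
  -- lying in both E i and E j may be crossed as an edge of either color.
  data Path (C : ℕ → Set) : Rel Vertex 0ℓ where
    stop : ∀ {v w} → v ≈ w → Path C v w
    step : ∀ {u v w} i → C i → E i u v → Path C v w → Path C u w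

  crossings : ∀ {C v w} → ℕ → Path C v w → ℕ
  crossings k (stop _)       = 0
  crossings k (step i _ _ p) = (if does (i ≟ k) then 1 else 0) + crossings k p

  component : Vertex → SignedColoredGraph n N
  component v = record
    { vertices = On.setoid {B = ∃ (Path (Between 2 (n ∸ 1)) v)} vertices proj₁
    ; σ        = λ w → σ (proj₁ w)
    ; E        = λ i w x → E i (proj₁ w) (proj₁ x)
    ; σ-cong   = σ-cong
    ; E-resp   = E-resp
    ; E-sym    = E-sym
    ; E-irr    = E-irr
    ; E-color  = E-color
    }

------------------------------------------------------------------------
-- Dual equivalence graphs

-- A finite edge-colored graph on Fin k, given by its edges
-- (color , endpoint , endpoint).
Pattern : ℕ → Set
Pattern k = List (ℕ × Fin k × Fin k)

Adjacent : ∀ {k} → Pattern k → ℕ → Rel (Fin k) 0ℓ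
Adjacent P c a b = (c , a , b) ∈ P ⊎ (c , b , a) ∈ P

point : Pattern 1
point = []

threePath : ℕ → Pattern 3
threePath i = (i ∸ 1 , 0F , 1F) ∷ (i , 1F , 2F) ∷ []

doubleEdge : ℕ → Pattern 2
doubleEdge i = (i ∸ 1 , 0F , 1F) ∷ (i , 0F , 1F) ∷ []

fourPath : ℕ → Pattern 4
fourPath i = (i ∸ 2 , 0F , 1F) ∷ (i ∸ 1 , 1F , 2F) ∷ (i , 2F , 3F) ∷ []

fiveVertices : ℕ → Pattern 5
fiveVertices i =
  (i ∸ 2 , 0F , 1F) ∷ (i ∸ 1 , 0F , 1F) ∷ (i , 1F , 2F) ∷
  (i ∸ 2 , 2F , 3F) ∷ (i ∸ 1 , 3F , 4F) ∷ (i , 3F , 4F) ∷ []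

-- 0F, …, 5F stand for u, v, w, x, y, z, with u–v–w–y–z and v–x–y.
sixVertices : ℕ → Pattern 6
sixVertices i =
  (i ∸ 1 , 0F , 1F) ∷ (i ∸ 2 , 1F , 2F) ∷ (i , 1F , 3F) ∷
  (i , 2F , 4F) ∷ (i ∸ 2 , 3F , 4F) ∷ (i ∸ 1 , 4F , 5F) ∷ []

module _ {n N} (𝒢 : SignedColoredGraph n N) where
  open SignedColoredGraph 𝒢

  -- The component of v under the colors in C is, as an edge-colored graph,
  -- the pattern P.
  record ComponentIs (C : ℕ → Set) (v : Vertex) {k : ℕ} (P : Pattern k) : Set where
    field
      vertex    : Fin k → Vertex
      injective : ∀ {a b} → vertex a ≈ vertex b → a ≡ b
      image     : ∀ w → Path 𝒢 C v w ⇔ (∃[ a ] vertex a ≈ w)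
      edges     : ∀ {c} → C c → ∀ a b → E c (vertex a) (vertex b) ⇔ Adjacent P c a b

  -- The coordinates σ_j that occur are quantified as c : Fin (N ∸ 1) with
  -- pos c equal to j; this also discards the conditions with j outside
  -- {1, …, N-1}.
  record IsDualEquivalenceGraph : Set where
    field
      finite : Finite vertices
      n≤N    : n ≤ N

      ax1 : ∀ {i} → 1 < i → i < n → ∀ w {c d} → pos c ≡ i ∸ 1 → pos d ≡ i →
            (σ w c ≡ opposite (σ w d)) ⇔ (∃[ x ] E i w x)
      ax1-unique : ∀ {i w x y} → E i w x → E i w y → x ≈ y

      ax2-flip : ∀ {i w x} → E i w x → ∀ {c} → pos c ≡ i ∸ 1 ⊎ pos c ≡ i →
                 σ w c ≡ opposite (σ x c)
      ax2-fix  : ∀ {i w x} → E i w x → ∀ {c} → pos c + 2 < i ⊎ i + 1 < pos c →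
                 σ w c ≡ σ x c

      ax3-below : ∀ {i w x} → E i w x → ∀ {c d} → pos c + 2 ≡ i → pos d + 1 ≡ i →
                  σ w c ≡ opposite (σ x c) → σ w c ≡ opposite (σ w d)
      ax3-above : ∀ {i w x} → E i w x → ∀ {c d} → pos c ≡ i + 1 → pos d ≡ i →
                  σ w c ≡ opposite (σ x c) → σ w c ≡ opposite (σ w d)

      ax4-two   : ∀ {i} → 2 < i → i < n → ∀ v →
                  let Is : ∀ {k} → Pattern k → Set
                      Is = ComponentIs (Between (i ∸ 1) i) v
                  in Is point ⊎ Is (threePath i) ⊎ Is (doubleEdge i)
      ax4-three : ∀ {i} → 3 < i → i < n → ∀ v →
                  let Is : ∀ {k} → Pattern k → Set
                      Is = ComponentIs (Between (i ∸ 2) i) v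
                  in Is point ⊎ Is (fourPath i) ⊎ Is (fiveVertices i) ⊎ Is (sixVertices i)

      ax5 : ∀ {i j w x y} → E i w x → E j x y → 3 ≤ ∣ i - j ∣ →
            ∃[ v ] E j w v × E i v y

      ax6 : ∀ {i} → 1 < i → i < n → ∀ {v w} → Path 𝒢 (Between 2 i) v w →
            Σ (Path 𝒢 (Between 2 i) v w) λ p → crossings 𝒢 i p ≤ 1

------------------------------------------------------------------------
-- Partitions and standard Young tableaux

record Partition (n : ℕ) : Set where
  field
    parts      : List ℕ
    decreasing : Linked _≥_ parts
    positive   : All (0 <_) parts
    size       : sum parts ≡ n

open Partition using (parts)

_≈ₚ_ : ∀ {n} → Rel (Partition n) 0ℓ
lam ≈ₚ mu = parts lam ≡ parts mu

-- A cell is (row , column); both are numbered from 0, which does not change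
-- contents.
Cell : ∀ {n} → Partition n → Set
Cell lam = Σ (Fin (length (parts lam))) λ r → Fin (lookup (parts lam) r)

content : ∀ {n} (lam : Partition n) → Cell lam → ℤ
content lam (r , c) = toℕ c ⊖ toℕ r

-- The letters 1, …, n are represented by Fin n; see letter.
record SYT {n} (lam : Partition n) : Set where
  field
    entry     : Cell lam → Fin n
    bijective : Bijective _≡_ _≡_ entry
    rows      : ∀ {r c c′} → c Fin.< c′ → entry (r , c) Fin.< entry (r , c′)
    columns   : ∀ {r r′ c c′} → r Fin.< r′ → toℕ c ≡ toℕ c′ →
                entry (r , c) Fin.< entry (r′ , c′)

  letter : Cell lam → ℕ
  letter x = suc (toℕ (entry x))

open SYT using (entry; letter)

SYT-setoid : ∀ {n} → Partition n → Setoid 0ℓ 0ℓ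
SYT-setoid lam = record
  { Carrier       = SYT lam
  ; _≈_           = λ T U → ∀ x → entry T x ≡ entry U x
  ; isEquivalence = record
    { refl  = λ _ → refl
    ; sym   = λ p x → sym (p x)
    ; trans = λ p q x → trans (p x) (q x)
    }
  }

-- Listed row by row from the bottom, so that the cells of one diagonal appear
-- from southwest to northeast.
cells : ∀ {n} (lam : Partition n) → List (Cell lam)
cells lam = concatMap (λ r → map (r ,_) (allFin _)) (allFin _)

-- -n, …, n-1: all contents of cells in a diagram of size n.
contents : ℕ → List ℤ
contents n = map (_⊖ n) (upTo (n + n))

readingOrder : ∀ {n} (lam : Partition n) → List (Cell lam)
readingOrder {n} lam =
  concatMap (λ k → filter (λ x → content lam x ℤ.≟ k) (cells lam)) (contents n)

word : ∀ {n} {lam : Partition n} → SYT lam → List ℕ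
word {lam = lam} T = map (letter T) (readingOrder lam)

word-cong : ∀ {n} {lam : Partition n} {T U : SYT lam} →
            (∀ x → entry T x ≡ entry U x) → word T ≡ word U
word-cong {lam = lam} p = Listₚ.map-cong (λ x → cong pos (p x)) (readingOrder lam)

-- For a word w containing i and i+1 once each, i is to the left of i+1 exactly
-- when the two-letter word i, i+1 is a subsequence of w.
descentSign : List ℕ → ℕ → Sign
descentSign w i = if does ((i ∷ suc i ∷ []) ⊆? w) then Sign.+ else Sign.-

------------------------------------------------------------------------
-- Standard dual equivalence graphs

-- x, y, z are the letters i-1, i, i+1 in their order of position.
data ElementaryDualEquivalence (i : ℕ) : Rel (List ℕ) 0ℓ where
  switch : ∀ s t u v {x y z} →
           (x ∷ y ∷ z ∷ []) ↭ (i ∸ 1 ∷ i ∷ i + 1 ∷ []) → y ≢ i →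
           ElementaryDualEquivalence i
             (s ++ x ∷ t ++ y ∷ u ++ z ∷ v)
             (s ++ z ∷ t ++ y ∷ u ++ x ∷ v)

EDE-sym : ∀ {i w w′} → ElementaryDualEquivalence i w w′ →
          ElementaryDualEquivalence i w′ w
EDE-sym (switch s t u v p y≢i) =
  switch s t u v (↭-trans (↭-reverse (_ ∷ _ ∷ _ ∷ [])) p) y≢i

EDE-irr : ∀ {i w w′} → 1 < i → ElementaryDualEquivalence i w w′ → w ≢ w′
EDE-irr {suc i} _ (switch s t u v p _) eq
  with ↭ₛ.Unique-resp-↭ (≡.setoid ℕ) (↭⇒↭ₛ (↭-sym p)) distinct
  where
  distinct = (ℕₚ.<⇒≢ (ℕₚ.n<1+n i) ∷ ℕₚ.<⇒≢ (ℕₚ.≤-trans (ℕₚ.n<1+n i) (ℕₚ.m≤m+n (suc i) 1)) ∷ [])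
           ∷ (ℕₚ.<⇒≢ (ℕₚ.m<m+n (suc i) (s≤s z≤n)) ∷ [])
           ∷ []
           ∷ []
... | (_ ∷ x≢z ∷ []) ∷ _ = x≢z (Listₚ.∷-injectiveˡ (Listₚ.++-cancelˡ s _ _ eq))

standard : ∀ {n} → Partition n → SignedColoredGraph n n
standard {n} lam = record
  { vertices = SYT-setoid lam
  ; σ        = λ T c → descentSign (word T) (pos c)
  ; E        = λ i T U → 1 < i × i < n × ElementaryDualEquivalence i (word T) (word U)
  ; σ-cong   = λ {T} {U} p c →
      cong (λ w → descentSign w (pos c)) (word-cong {T = T} {U} p)
  ; E-resp   = λ { {i} {T} {T′} {U} {U′} p q (1<i , i<n , e) →
      1<i , i<n ,
      subst₂ (ElementaryDualEquivalence i)
             (word-cong {T = T} {T′} p) (word-cong {T = U} {U′} q) e }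
  ; E-sym    = λ { (1<i , i<n , e) → 1<i , i<n , EDE-sym e }
  ; E-irr    = λ { {i} {T} {U} (1<i , _ , e) p →
      EDE-irr 1<i e (word-cong {T = T} {U} p) }
  ; E-color  = λ { (1<i , i<n , _) → 1<i , i<n }
  }

------------------------------------------------------------------------
-- Isomorphisms

record Morphism {n N} (𝒢 ℋ : SignedColoredGraph n N) : Set where
  private
    module G = SignedColoredGraph 𝒢
    module H = SignedColoredGraph ℋ
  field
    func       : Func G.vertices H.vertices
  open Func func public using () renaming (to to φ)
  field
    signatures : ∀ v c → G.σ v c ≡ H.σ (φ v) c
    edges      : ∀ {i u v} → G.E i u v → H.E i (φ u) (φ v)

record _≅_ {n N} (𝒢 ℋ : SignedColoredGraph n N) : Set where
  field
    morphism  : Morphism 𝒢 ℋ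
    bijective : Bijective (SignedColoredGraph._≈_ 𝒢) (SignedColoredGraph._≈_ ℋ)
                          (Morphism.φ morphism)

{-# OPTIONS --safe #-}
-- A standard tableau is encoded by the diagonals of its letters 1, 2, … and a
-- shape by its boundary path.  By induction on k every vertex receives a
-- tableau with k letters, such that the edges of color less than k act as
-- elementary dual equivalences and, in each component for these colors, the
-- tableau determines the vertex.  By ax2 and ax3 the signature at k is a
-- monotone function of the corner occupied by the letter k, so that it singles
-- out one addable corner, where the letter k + 1 is placed.
--
-- An edge of color k then acts as an elementary dual equivalence too.  The edges
-- of color at most k - 3 commute with it by ax5 and are used to move the letters
-- up to k - 2 to suitable corners, where the components of ax4 leave only one
-- possibility.  If k + 1 lies between k - 1 and k, the edge joins vertices of
-- the same component for the colors less than k; hence, by ax6, the tableau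
-- with k + 1 letters determines the vertex.  Edges lift by ax1 and tableaux of
-- one shape are connected by elementary dual equivalences, so every tableau
-- of the shape occurs.
--
-- The construction is forced by the signature, which makes λ unique.

module Submission where

open import Defs
open import Data.Bool using (Bool; true; false; not; if_then_else_)
import Data.Bool.Properties as Boolₚ
open import Data.Empty using (⊥; ⊥-elim)
open import Data.Fin using (Fin; toℕ; fromℕ<)
import Data.Fin as Fin
import Data.Fin.Properties as Finₚ
open import Data.Integer using (_⊖_)
import Data.Integer as ℤ
import Data.Integer.Properties as ℤₚ
open import Data.List
  using (List; []; _∷_; _++_; length; drop; map; lookup; filter; allFin; upTo)
open import Data.List.Membership.Propositional using (_∈_)
open import Data.List.Membership.Propositional.Properties
  using (∈-map⁺; ∈-map⁻; ∈-concat⁺′; ∈-filter⁺; ∈-filter⁻; ∈-allFin; ∈-upTo⁺; ∈-∃++; ∈-++⁻;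
         ∈-++⁺ˡ; ∈-++⁺ʳ)
import Data.List.Properties as Listₚ
open import Data.List.Relation.Binary.Permutation.Propositional
  using (_↭_; ↭-refl; ↭-prep; ↭-swap; ↭-trans)
open import Data.List.Relation.Binary.Permutation.Propositional.Properties
  using (∈-resp-↭)
open import Data.List.Relation.Binary.Pointwise using (Pointwise; []; _∷_)
import Data.List.Relation.Binary.Pointwise as Pointwise
open import Data.List.Relation.Binary.Sublist.Propositional
  using (_⊆_; []; _∷_; _∷ʳ_; minimum)
import Data.List.Relation.Binary.Sublist.Propositional.Properties as Sublistₚ
open import Data.List.Relation.Unary.All using (All; []; _∷_)
import Data.List.Relation.Unary.All as All
import Data.List.Relation.Unary.All.Properties as Allₚ
open import Data.List.Relation.Unary.AllPairs using (AllPairs; []; _∷_)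
import Data.List.Relation.Unary.AllPairs as AllPairs
import Data.List.Relation.Unary.AllPairs.Properties as AllPairsₚ
open import Data.List.Relation.Unary.Any using (here; there)
open import Data.List.Relation.Unary.Linked using (Linked; []; [-]; _∷_)
open import Data.Nat
  using (ℕ; zero; suc; _+_; _∸_; _≤_; _<_; _≤ᵇ_; _<ᵇ_; _≟_; _<?_; _≤?_; z≤n; s≤s; ∣_-_∣;
         _≥_)
open import Data.Nat.Induction using (<-rec)
open import Data.Nat.ListAction using (sum)
import Data.Nat.Properties as ℕₚ
open import Data.Product using (∃; _×_; _,_; proj₁; proj₂; ∃₂; ∃!)
open import Data.Product.Properties using (≡-dec)
open import Data.Sign using (Sign; opposite)
import Data.Sign as Sign
open import Data.Sum using (_⊎_; inj₁; inj₂; [_,_]′)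
open import Data.Unit using (⊤; tt)
open import Function using (_∘_; id; case_of_)
open import Function.Bundles using (Equivalence; Func)
open import Relation.Binary using (tri<; tri≈; tri>)
open import Relation.Binary.Bundles using (Setoid)
open import Relation.Binary.Construct.Closure.ReflexiveTransitive
  using (Star; ε; _◅_; _◅◅_; gmap)
open import Relation.Binary.PropositionalEquality
  using (_≡_; _≢_; refl; sym; trans; cong; cong₂; subst; subst₂; module ≡-Reasoning)
open import Relation.Nullary using (¬_; Dec; yes; no; does; contradiction)
open import Relation.Nullary.Decidable
  using (dec-true; dec-false; from-yes; _→-dec_; _⊎-dec_; _×-dec_; ¬?)
open import Data.List.Relation.Binary.Sublist.DecPropositional _≟_ using (_⊆?_)

-- The obstacle is an edge of color k for which k - 1 lies between k and k + 1. It leaves the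
-- component for the colors less than k, so induction says nothing about the tableau at its other
-- end. For this reason tableaux are attached to all vertices at once, and the induction also
-- records (`t-fix`, from ax2 and ax5) that such an edge keeps the letters up to k - 2. Unknown at
-- the other end are the corners of k - 1 and k.
--
-- They are not constructed but recognized: since addable and removable corners alternate, an
-- addable corner is determined by which removable corners lie to its left. So the letter k - 2 is
-- put on each removable corner in turn and its side is read off from signs and missing edges: ax4
-- for two colors gives the corner of k - 1, ax4 for three colors the corner of k. The same
-- principle makes the place of a new letter unique, and finally the partition.
--
-- Monotonicity of the signature has a similar source: when k and k - 1 occupy two removable
-- corners, k - 2 can be placed between them, so the color k - 1 exchanges the two, and ax3 lets the
-- sign at k change in one direction only.

clash : ∀ {A : Set} {x : Bool} → x ≡ true → x ≡ false → A
clash refl ()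

<ᵇ-true : ∀ {a b} → a < b → (a <ᵇ b) ≡ true
<ᵇ-true {a} {b} p = dec-true (a <? b) p

<ᵇ-false : ∀ {a b} → b ≤ a → (a <ᵇ b) ≡ false
<ᵇ-false {a} {b} p = dec-false (a <? b) (ℕₚ.≤⇒≯ p)

<ᵇ-true⁻ : ∀ {a b} → (a <ᵇ b) ≡ true → a < b
<ᵇ-true⁻ {a} {b} p with a <? b
... | yes l = l
... | no ¬l = clash p (<ᵇ-false (ℕₚ.≮⇒≥ ¬l))

<ᵇ-false⁻ : ∀ {a b} → (a <ᵇ b) ≡ false → b ≤ a
<ᵇ-false⁻ {a} {b} p with a <? b
... | yes l = clash (<ᵇ-true l) p
... | no ¬l = ℕₚ.≮⇒≥ ¬l

-- Boundary paths

-- A partition is encoded by its boundary path, read from the top left: true is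
-- a vertical step and false a horizontal one.  Position j holds the step that
-- ends on the diagonal of content j - N, so a cell of position a can be added
-- when a vertical step at a is followed by a horizontal one at suc a.
Shape : Set
Shape = ℕ → Bool

record Addable (b : Shape) (a : ℕ) : Set where
  constructor _,_
  field
    before : b a ≡ true
    after  : b (suc a) ≡ false

record Removable (b : Shape) (a : ℕ) : Set where
  constructor _,_
  field
    before : b a ≡ false
    after  : b (suc a) ≡ true

infix 4 _≐_
_≐_ : Shape → Shape → Set
b ≐ b′ = ∀ j → b j ≡ b′ j

addable-resp : ∀ {b b′ a} → b ≐ b′ → Addable b a → Addable b′ a
addable-resp e (p , q) = trans (sym (e _)) p , trans (sym (e _)) q

removable-resp : ∀ {b b′ a} → b ≐ b′ → Removable b a → Removable b′ a
removable-resp e (p , q) = trans (sym (e _)) p , trans (sym (e _)) q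

-- The last conclusion, constancy up to the turn, later shows in `build` that no removable corner
-- lies between the start and the addable corner found.
firstFlip : ∀ (b : Shape) x d i {j} → d + i ≡ j → b i ≡ x → b j ≡ not x →
            ∃ λ u → i ≤ u × u < j × b u ≡ x × b (suc u) ≡ not x ×
                    (∀ m → i ≤ m → m ≤ u → b m ≡ x)
firstFlip b x zero    i refl p q = contradiction q (Boolₚ.not-¬ p)
firstFlip b x (suc d) i refl p q with b (suc i) Boolₚ.≟ x
... | no ¬r = i , ℕₚ.≤-refl , s≤s (ℕₚ.m≤n+m i d) , p , Boolₚ.¬-not ¬r ,
  λ m i≤m m≤i → trans (cong b (ℕₚ.≤-antisym m≤i i≤m)) p
... | yes r with u , l , u< , bu , bsu , all ← firstFlip b x d (suc i) (ℕₚ.+-suc d i) r q =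
  u , ℕₚ.≤-trans (ℕₚ.n≤1+n i) l , u< , bu , bsu , λ m i≤m m≤u → case m ≟ i of λ where
    (yes refl) → p
    (no m≢i)   → all m (ℕₚ.≤∧≢⇒< i≤m (m≢i ∘ sym)) m≤u

opaque
  removable-between : ∀ {b p q} → Addable b p → Addable b q → p < q →
                      ∃ λ u → (p < u × u < q) × Removable b u
  removable-between {b} {p} {q} (_ , bp) (bq , _) p<q
    with u , l , r , bu , bsu , _ ← firstFlip b false (q ∸ suc p) (suc p) (ℕₚ.m∸n+n≡m p<q) bp bq =
    u , (l , r) , (bu , bsu)

-- Addable and removable corners alternate along the boundary.
addable-unique : ∀ {b p q} → Addable b p → Addable b q →
                 (∀ u → Removable b u → (u <ᵇ p) ≡ (u <ᵇ q)) → p ≡ q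
addable-unique {b} {p} {q} P Q same with ℕₚ.<-cmp p q
... | tri≈ _ p≡q _ = p≡q
... | tri< p<q _ _ with u , (p<u , u<q) , R ← removable-between P Q p<q =
  contradiction (<ᵇ-true⁻ (trans (same u R) (<ᵇ-true u<q))) (ℕₚ.<⇒≯ p<u)
... | tri> _ _ q<p with u , (q<u , u<p) , R ← removable-between Q P q<p =
  contradiction (<ᵇ-true⁻ (trans (sym (same u R)) (<ᵇ-true u<p))) (ℕₚ.<⇒≯ q<u)

Mid : ℕ → ℕ → ℕ → Set
Mid m p q = (p < m × m < q) ⊎ (q < m × m < p)

mid-sym : ∀ {m p q} → Mid m p q → Mid m q p
mid-sym (inj₁ x) = inj₂ x
mid-sym (inj₂ x) = inj₁ x

Far : ℕ → ℕ → Set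
Far p q = suc p < q ⊎ suc q < p

far-sym : ∀ {p q} → Far p q → Far q p
far-sym (inj₁ x) = inj₂ x
far-sym (inj₂ x) = inj₁ x

mid⇒far : ∀ {m p q} → Mid m p q → Far p q
mid⇒far (inj₁ (p<m , m<q)) = inj₁ (ℕₚ.≤-trans (s≤s p<m) m<q)
mid⇒far (inj₂ (q<m , m<p)) = inj₂ (ℕₚ.≤-trans (s≤s q<m) m<p)

far⇒≢ : ∀ {p q} → Far p q → p ≢ q
far⇒≢ (inj₁ x) refl = ℕₚ.<-irrefl refl (ℕₚ.<-trans (ℕₚ.n<1+n _) x)
far⇒≢ (inj₂ x) refl = ℕₚ.<-irrefl refl (ℕₚ.<-trans (ℕₚ.n<1+n _) x)

far⇒≢suc : ∀ {p q} → Far p q → p ≢ suc q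
far⇒≢suc (inj₁ x) refl = ℕₚ.<-asym x (s≤s (ℕₚ.n≤1+n _))
far⇒≢suc (inj₂ x) refl = ℕₚ.<-irrefl refl x

-- Touching corners would share a boundary step, required to be vertical by one and horizontal by
-- the other.
removable-far : ∀ {b p q} → Removable b p → Removable b q → p ≢ q → Far p q
removable-far {b} {p} {q} (bp , bsp) (bq , bsq) p≢q with ℕₚ.<-cmp p q
... | tri< p<q _ _ = inj₁ (ℕₚ.≤∧≢⇒< p<q λ { refl → clash bsp bq })
... | tri≈ _ p≡q _ = contradiction p≡q p≢q
... | tri> _ _ q<p = inj₂ (ℕₚ.≤∧≢⇒< q<p λ { refl → clash bsq bp })

opaque
  removable-mid : ∀ {b p q} → Addable b p → Addable b q → p ≢ q →
                  ∃ λ u → Mid u p q × Removable b u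
  removable-mid {b} {p} {q} P Q p≢q with ℕₚ.<-cmp p q
  ... | tri< p<q _ _ with u , m , R ← removable-between P Q p<q = u , inj₁ m , R
  ... | tri≈ _ p≡q _ = contradiction p≡q p≢q
  ... | tri> _ _ q<p with u , m , R ← removable-between Q P q<p = u , inj₂ m , R

opaque
  -- The two new values are constants rather than a swap of `b a` and `b (suc a)`, so that the
  -- corner at `a` is removable whatever `b` is.
  add : ℕ → Shape → Shape
  add a b j = if does (j ≟ a) then false else if does (j ≟ suc a) then true else b j

  add-here : ∀ a b → add a b a ≡ false
  add-here a b rewrite dec-true (a ≟ a) refl = refl

  add-next : ∀ a b → add a b (suc a) ≡ true
  add-next a b rewrite dec-false (suc a ≟ a) (ℕₚ.1+n≢n) | dec-true (suc a ≟ suc a) refl = refl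

  add-other : ∀ a b {j} → j ≢ a → j ≢ suc a → add a b j ≡ b j
  add-other a b {j} p q rewrite dec-false (j ≟ a) p | dec-false (j ≟ suc a) q = refl

add-removable : ∀ a b → Removable (add a b) a
add-removable a b = add-here a b , add-next a b

add-cases : ∀ a b (P : ℕ → Bool → Set) → P a false → P (suc a) true →
            (∀ j → j ≢ a → j ≢ suc a → P j (b j)) → ∀ j → P j (add a b j)
add-cases a b P x y z j with j ≟ a
... | yes refl = subst (P a) (sym (add-here a b)) x
... | no j≢a with j ≟ suc a
...   | yes refl = subst (P (suc a)) (sym (add-next a b)) y
...   | no j≢sa = subst (P j) (sym (add-other a b j≢a j≢sa)) (z j j≢a j≢sa)

add-cong : ∀ a {b b′} → b ≐ b′ → add a b ≐ add a b′
add-cong a {b} {b′} e = add-cases a b (λ j x → x ≡ add a b′ j)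
  (sym (add-here a b′)) (sym (add-next a b′))
  (λ j p q → trans (e j) (sym (add-other a b′ p q)))

add-cancel : ∀ a {b b′} → Addable b a → Addable b′ a → add a b ≐ add a b′ → b ≐ b′
add-cancel a {b} {b′} (p , q) (p′ , q′) e j with j ≟ a
... | yes refl = trans p (sym p′)
... | no j≢a with j ≟ suc a
...   | yes refl = trans q (sym q′)
...   | no j≢sa = trans (sym (add-other a b j≢a j≢sa)) (trans (e j) (add-other a b′ j≢a j≢sa))

add-far : ∀ {a c b} → Far a c → add c b a ≡ b a × add c b (suc a) ≡ b (suc a)
add-far {a} {c} {b} f =
  add-other c b (far⇒≢ f) (far⇒≢suc f) ,
  add-other c b (far⇒≢suc (far-sym f) ∘ sym) (far⇒≢ f ∘ ℕₚ.suc-injective)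

add-comm : ∀ {a c} b → Far a c → add a (add c b) ≐ add c (add a b)
add-comm {a} {c} b f j with j ≟ a
... | yes refl = trans (add-here a _) (sym (trans (proj₁ (add-far f)) (add-here a b)))
... | no j≢a with j ≟ suc a
...   | yes refl = trans (add-next a _) (sym (trans (proj₂ (add-far f)) (add-next a b)))
...   | no j≢sa = trans (add-other a _ j≢a j≢sa)
    (add-cases c b (λ j x → j ≢ a → j ≢ suc a → x ≡ add c (add a b) j)
      (λ _ _ → sym (add-here c _)) (λ _ _ → sym (add-next c _))
      (λ j p q r s → sym (trans (add-other c _ p q) (add-other a b r s))) j j≢a j≢sa)

addable-weaken : ∀ {a c b} → Far a c → Addable b a → Addable (add c b) a
addable-weaken f (p , q) = trans (proj₁ (add-far f)) p , trans (proj₂ (add-far f)) q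

addable-strengthen : ∀ {a c b} → Far a c → Addable (add c b) a → Addable b a
addable-strengthen f (p , q) = trans (sym (proj₁ (add-far f))) p , trans (sym (proj₂ (add-far f))) q

removable-strengthen : ∀ {a c b} → Far a c → Removable (add c b) a → Removable b a
removable-strengthen f (p , q) = trans (sym (proj₁ (add-far f))) p , trans (sym (proj₂ (add-far f))) q

addable≢removable : ∀ {b a o} → Addable b a → Removable b o → o ≢ a
addable≢removable (p , _) (q , _) refl = clash p q

-- Between two cells of one diagonal a standard filling must place both the cell to the right of the
-- first and the cell above it; a single letter `q` is too few.
addable≢twice : ∀ {b p q} → Addable (add q (add p b)) p → ⊥
addable≢twice {b} {p} {q} (x , y) with p ≟ suc q
... | yes refl = clash (trans (add-other q _ {suc (suc q)} (λ ()) (λ ())) (add-next p b)) y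
... | no p≢sq with p ≟ q
...   | yes refl = clash x (add-here q _)
...   | no p≢q = clash x (trans (add-other q _ p≢q p≢sq) (add-here p b))

-- Codes of tableaux and the moves between them

listing : (ℕ → ℕ) → ℕ → List ℕ
listing f zero    = []
listing f (suc k) = f k ∷ listing f k

module Maya (N : ℕ) where

  -- The tableau with positions a₁, …, aₖ of the letters 1, …, k is the list
  -- aₖ ∷ … ∷ a₁ ∷ [].
  shape : List ℕ → Shape
  -- The boundary of the empty diagram turns only at position `N`, that is, at content 0.
  shape []      j = j ≤ᵇ N
  shape (a ∷ s)   = add a (shape s)

  data Valid : List ℕ → Set where
    []  : Valid []
    _∷_ : ∀ {a s} → Addable (shape s) a → Valid s → Valid (a ∷ s)

  ≤ᵇ-true : ∀ {j} → j ≤ N → (j ≤ᵇ N) ≡ true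
  ≤ᵇ-true p = dec-true (_ ≤? _) p

  ≤ᵇ-false : ∀ {j} → ¬ j ≤ N → (j ≤ᵇ N) ≡ false
  ≤ᵇ-false p = dec-false (_ ≤? _) p

  empty-not-removable : ∀ {u} → ¬ Removable (shape []) u
  empty-not-removable {u} (p , q) with suc u ≤? N
  ... | yes l = clash (≤ᵇ-true (ℕₚ.≤-trans (ℕₚ.n≤1+n u) l)) p
  ... | no l = clash q (≤ᵇ-false l)

  -- Each letter extends the altered part of the boundary by at most one position to the left. At
  -- `j = 0` this says that a diagram of at most `N` cells still starts with a vertical step.
  shape-left : ∀ {s} → Valid s → ∀ j → j + length s ≤ N → shape s j ≡ true
  shape-left [] j p = ≤ᵇ-true (subst (_≤ N) (ℕₚ.+-identityʳ j) p)
  shape-left (_∷_ {a} {s} (x , y) v) = add-cases a (shape s) (λ j b → j + suc (length s) ≤ N → b ≡ true)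
    (λ p → clash (shape-left v (suc a) (subst (_≤ N) (ℕₚ.+-suc a _) p)) y)
    (λ _ → refl)
    λ j _ _ p → shape-left v j (ℕₚ.≤-trans (ℕₚ.+-monoʳ-≤ j (ℕₚ.n≤1+n _)) p)

  shape-right : ∀ {s} → Valid s → ∀ j → N + length s < j → shape s j ≡ false
  shape-right [] j p = ≤ᵇ-false (ℕₚ.<⇒≱ (subst (_< j) (ℕₚ.+-identityʳ N) p))
  shape-right (_∷_ {a} {s} (x , y) v) = add-cases a (shape s) (λ j b → N + suc (length s) < j → b ≡ false)
    (λ _ → refl)
    (λ p → clash x (shape-right v a (ℕₚ.≤-pred (subst (_< suc a) (ℕₚ.+-suc N _) p))))
    λ j _ _ p → shape-right v j (ℕₚ.≤-trans (s≤s (ℕₚ.+-monoʳ-≤ N (ℕₚ.n≤1+n _))) p)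

  valid-swap : ∀ {a c s} → Far a c → Valid (a ∷ c ∷ s) → Valid (c ∷ a ∷ s)
  valid-swap f (x ∷ y ∷ v) = addable-weaken (far-sym f) y ∷ addable-strengthen f x ∷ v

  opaque
    -- The letter at `u` is moved to the front of the code. A later letter `a` at another corner is
    -- removable together with `u`, hence far from it, so the two letters may be placed in either
    -- order.
    remove : ∀ {s u} → Valid s → Removable (shape s) u →
             ∃ λ s′ → Valid (u ∷ s′) × shape (u ∷ s′) ≐ shape s × suc (length s′) ≡ length s
    remove [] R = contradiction R empty-not-removable
    remove {u = u} (_∷_ {a} {s} x v) R with u ≟ a
    ... | yes refl = s , x ∷ v , (λ _ → refl) , refl
    ... | no u≢a
      with f ← removable-far R (add-removable a (shape s)) u≢a
      with s′ , V , e , l ← remove v (removable-strengthen f R) =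
      a ∷ s′ , valid-swap (far-sym f) (addable-resp (sym ∘ e) x ∷ V) ,
      (λ j → trans (add-comm (shape s′) f j) (add-cong a e j)) , cong suc l

  -- In the two base cases x, y, z are the positions of the letters i - 1, i, i + 1.
  data Step : ℕ → List ℕ → List ℕ → Set where
    swapLow : ∀ {x y z r} → Mid z x y → Step (2 + length r) (z ∷ y ∷ x ∷ r) (z ∷ x ∷ y ∷ r)
    swapTop : ∀ {x y z r} → Mid x y z → Step (2 + length r) (z ∷ y ∷ x ∷ r) (y ∷ z ∷ x ∷ r)
    later   : ∀ {i a s s′} → Step i s s′ → Step i (a ∷ s) (a ∷ s′)

  step-< : ∀ {i s s′} → Step i s s′ → i < length s
  step-< (swapLow _) = ℕₚ.≤-refl
  step-< (swapTop _) = ℕₚ.≤-refl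
  step-< (later p)   = ℕₚ.≤-trans (step-< p) (ℕₚ.n≤1+n _)

  step-> : ∀ {i s s′} → Step i s s′ → 1 < i
  step-> (swapLow _) = s≤s (s≤s z≤n)
  step-> (swapTop _) = s≤s (s≤s z≤n)
  step-> (later p)   = step-> p

  step-shape : ∀ {i s s′} → Step i s s′ → shape s ≐ shape s′
  step-shape (swapLow {z = z} m) = add-cong z (add-comm _ (mid⇒far (mid-sym m)))
  step-shape (swapTop m) = add-comm _ (mid⇒far (mid-sym m))
  step-shape (later {a = a} p) = add-cong a (step-shape p)

  Move : ℕ → List ℕ → List ℕ → Set
  Move m s s′ = ∃ λ i → i < m × Step i s s′

  opaque
    -- If the last letters sit at different corners `a` and `c`, then after removing both corners
    -- the shape has a removable corner `u` between them. Induction leads from either side to a code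
    -- whose last three letters are at `u`, `c`, `a` or at `u`, `a`, `c`, and these two differ by
    -- one `swapTop`. The bound `m` on the colors keeps all letters after the first `m` in place.
    connect : ∀ m {s s′} → Valid s → Valid s′ → shape s ≐ shape s′ →
              length s ≡ m → length s′ ≡ m → Star (Move m) s s′
    connect _ [] [] _ _ _ = ε
    connect _ [] (x ∷ v) _ refl ()
    connect (suc m) (_∷_ {a} {s} x v) (_∷_ {c} {s′} y v′) e l l′ with a ≟ c
    ... | yes refl = gmap (a ∷_) (λ { (i , i<m , p) → i , ℕₚ.m≤n⇒m≤1+n i<m , later p })
                       (connect m v v′ (add-cancel a x y e) (ℕₚ.suc-injective l) (ℕₚ.suc-injective l′))
    ... | no a≢c
      with R ← removable-resp e (add-removable a (shape s))
      with f ← removable-far R (add-removable c (shape s′)) a≢c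
      with s₂ , (a₂ ∷ v₂) , e₂ , l₂ ← remove v′ (removable-strengthen f R)
      with c₂ ← addable-strengthen (far-sym f) (addable-resp (sym ∘ e₂) y)
      with u , mid , U ← removable-mid a₂ c₂ a≢c
      with s₃ , v₃ , e₃ , l₃ ← remove v₂ U
      with a₃ ← addable-resp (sym ∘ e₃) a₂
      with c₃ ← addable-resp (sym ∘ e₃) c₂ =
      gmap (a ∷_) (λ { (i , i<m , p) → i , ℕₚ.m≤n⇒m≤1+n i<m , later p })
        (connect m v (c₃ ∷ v₃)
          (add-cancel a x (addable-weaken f a₃)
            λ j → trans (e j) (trans (add-cong c (sym ∘ e₂) j)
              (trans (sym (add-comm (shape s₂) f j))
                (add-cong a (add-cong c (sym ∘ e₃)) j))))
          (ℕₚ.suc-injective l) len)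
      ◅◅ (2 + length s₃ , subst (3 + length s₃ ≤_) (cong suc len) ℕₚ.≤-refl , swapTop (mid-sym mid))
      ◅ gmap (c ∷_) (λ { (i , i<m , p) → i , ℕₚ.m≤n⇒m≤1+n i<m , later p })
        (connect m (a₃ ∷ v₃) v′ (λ j → trans (add-cong a e₃ j) (e₂ j)) len (ℕₚ.suc-injective l′))
      where
      len : suc (suc (length s₃)) ≡ m
      len = trans (cong suc l₃) (trans l₂ (ℕₚ.suc-injective l′))

-- Consequences of the axioms

plus : Sign → Bool
plus Sign.+ = true
plus Sign.- = false

plus-opposite : ∀ s → plus (opposite s) ≡ not (plus s)
plus-opposite Sign.+ = refl
plus-opposite Sign.- = refl

plus-injective : ∀ {s s′} → plus s ≡ plus s′ → s ≡ s′
plus-injective {Sign.+} {Sign.+} _ = refl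
plus-injective {Sign.-} {Sign.-} _ = refl

not-swap : ∀ {x y} → x ≡ not y → y ≡ not x
not-swap {x} {y} refl = sym (Boolₚ.not-involutive y)

-- The properties of the patterns that are needed are decided by computation at
-- the smallest colors and then shifted.
shift : ∀ {k} → ℕ → Pattern k → Pattern k
shift j = map λ (c , e) → c + j , e

shift-adjacent⁻ : ∀ {k} (P : Pattern k) j {c a b} →
                  Adjacent (shift j P) (c + j) a b → Adjacent P c a b
shift-adjacent⁻ P j = [ inj₁ ∘ un , inj₂ ∘ un ]′
  where
  un : ∀ {c a b} → (c + j , a , b) ∈ shift j P → (c , a , b) ∈ P
  un {c} p with (c′ , a′ , b′) , q , eq ← ∈-map⁻ _ p
    with refl ← ℕₚ.+-cancelʳ-≡ j c c′ (cong proj₁ eq)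
    with refl ← cong proj₂ eq = q

shift-adjacent⁺ : ∀ {k} (P : Pattern k) j {c a b} →
                  Adjacent P c a b → Adjacent (shift j P) (c + j) a b
shift-adjacent⁺ P j = [ inj₁ ∘ ∈-map⁺ _ , inj₂ ∘ ∈-map⁺ _ ]′

adjacent? : ∀ {k} (P : Pattern k) c a b → Dec (Adjacent P c a b)
adjacent? P c a b = ((c , a , b) ∈? P) ⊎-dec ((c , b , a) ∈? P)
  where open import Data.List.Membership.DecPropositional (≡-dec _≟_ (≡-dec Finₚ._≟_ Finₚ._≟_)) using (_∈?_)

Double : ∀ {k} → Pattern k → Set
Double P = ∀ a b c d → Adjacent P 1 a b → Adjacent P 2 a c → Adjacent P 2 b d → b ≡ c

Exclusive : ∀ {k} → Pattern k → Set
Exclusive P = ∀ a b → Adjacent P 2 a b →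
  Adjacent P 1 a b ⊎
  (∃ (λ c → Adjacent P 1 a c)) × (∀ c → ¬ Adjacent P 1 b c) ⊎
  (∀ c → ¬ Adjacent P 1 a c) × (∃ (λ c → Adjacent P 1 b c))

-- In the graphs of ax4 the first two alternatives arise only from the one on five vertices; the
-- third is the four-cycle of the one on six vertices.
Square : ∀ {k} → Pattern k → Set
Square P = ∀ a b → Adjacent P 1 a b → ∀ c → Adjacent P 3 a c → ∀ d → Adjacent P 2 b d →
  ∃ (Adjacent P 2 a) ⊎ ∃ (Adjacent P 3 d) ⊎ ∃ λ e → Adjacent P 3 b e × Adjacent P 1 c e

double? : ∀ {k} (P : Pattern k) → Dec (Double P)
double? P = Finₚ.all? λ a → Finₚ.all? λ b → Finₚ.all? λ c → Finₚ.all? λ d →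
  adjacent? P 1 a b →-dec adjacent? P 2 a c →-dec adjacent? P 2 b d →-dec (b Finₚ.≟ c)

exclusive? : ∀ {k} (P : Pattern k) → Dec (Exclusive P)
exclusive? P = Finₚ.all? λ a → Finₚ.all? λ b → adjacent? P 2 a b →-dec
  (adjacent? P 1 a b ⊎-dec
   ((Finₚ.any? (adjacent? P 1 a)) ×-dec Finₚ.all? (λ c → ¬? (adjacent? P 1 b c))) ⊎-dec
   (Finₚ.all? (λ c → ¬? (adjacent? P 1 a c)) ×-dec (Finₚ.any? (adjacent? P 1 b))))

square? : ∀ {k} (P : Pattern k) → Dec (Square P)
square? P = Finₚ.all? λ a → Finₚ.all? λ b → adjacent? P 1 a b →-dec Finₚ.all? λ c → adjacent? P 3 a c →-dec
  Finₚ.all? λ d → adjacent? P 2 b d →-dec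
  (Finₚ.any? (adjacent? P 2 a) ⊎-dec Finₚ.any? (adjacent? P 3 d) ⊎-dec
   Finₚ.any? λ e → adjacent? P 3 b e ×-dec adjacent? P 1 c e)

module _ {n N} (𝒢 : SignedColoredGraph n N) where
  open SignedColoredGraph 𝒢
  private module V = Setoid vertices

  path-resp : ∀ {C u v w} → u ≈ v → Path 𝒢 C v w → Path 𝒢 C u w
  path-resp e (stop f)       = stop (V.trans e f)
  path-resp e (step i c f p) = step i c (E-resp (V.sym e) V.refl f) p

  path-trans : ∀ {C u v w} → Path 𝒢 C u v → Path 𝒢 C v w → Path 𝒢 C u w
  path-trans (stop e)       q = path-resp e q
  path-trans (step i c e p) q = step i c e (path-trans p q)

  path-edge : ∀ {C : ℕ → Set} {i u v} → C i → E i u v → Path 𝒢 C u v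
  path-edge c e = step _ c e (stop V.refl)

  path-sym : ∀ {C u v} → Path 𝒢 C u v → Path 𝒢 C v u
  path-sym (stop e)       = stop (V.sym e)
  path-sym (step i c e p) = path-trans (path-sym p) (path-edge c (E-sym e))

  path-map : ∀ {C D : ℕ → Set} {u v} → (∀ {i} → 1 < i → i < n → C i → D i) → Path 𝒢 C u v → Path 𝒢 D u v
  path-map f (stop e)       = stop e
  path-map f (step i c e p) = step i (f (proj₁ (E-color e)) (proj₂ (E-color e)) c) e (path-map f p)

  module Local {j m v k} (P : Pattern k)
               (is : ComponentIs 𝒢 (Between (suc j) (m + j)) v (shift j P)) where
    open ComponentIs is

    Here : Vertex → Set
    Here = Path 𝒢 (Between (suc j) (m + j)) v

    at : ∀ {w} → Here w → Fin k
    at {w} p = proj₁ (Equivalence.to (image w) p)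

    at-≈ : ∀ {w} (p : Here w) → vertex (at p) ≈ w
    at-≈ {w} p = proj₂ (Equivalence.to (image w) p)

    adjacent : ∀ {c w x} → 1 ≤ c → c ≤ m → (p : Here w) (q : Here x) → E (c + j) w x → Adjacent P c (at p) (at q)
    adjacent l r p q e = shift-adjacent⁻ P j
      (Equivalence.to (edges (ℕₚ.+-monoˡ-≤ j l , ℕₚ.+-monoˡ-≤ j r) _ _)
        (E-resp (V.sym (at-≈ p)) (V.sym (at-≈ q)) e))

    edge : ∀ {c a b w x} → 1 ≤ c → c ≤ m → vertex a ≈ w → vertex b ≈ x → Adjacent P c a b → E (c + j) w x
    edge l r p q e = E-resp p q
      (Equivalence.from (edges (ℕₚ.+-monoˡ-≤ j l , ℕₚ.+-monoˡ-≤ j r) _ _) (shift-adjacent⁺ P j e))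

module Axioms {n} (𝒢 : SignedColoredGraph n n) (deg : IsDualEquivalenceGraph 𝒢) where
  open SignedColoredGraph 𝒢
  open IsDualEquivalenceGraph deg public
  module V = Setoid vertices

  -- The value true stands for +1; it is also taken outside of 1, …, n-1.
  sg : ℕ → Vertex → Bool
  sg zero    v = true
  sg (suc j) v with j <? n ∸ 1
  ... | yes l = plus (σ v (fromℕ< l))
  ... | no _  = true

  sg-σ : ∀ {j} {c : Fin (n ∸ 1)} → pos c ≡ j → ∀ v → sg j v ≡ plus (σ v c)
  sg-σ {c = c} refl v with toℕ c <? n ∸ 1
  ... | yes l = cong (plus ∘ σ v) (Finₚ.fromℕ<-toℕ c l)
  ... | no ¬l = contradiction (Finₚ.toℕ<n c) ¬l

  -- Lets the axioms be restated for `sg` without a bound on `j`: out of range `sg` is constant and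
  -- the statements are trivial.
  coordinate : ∀ j → (∃ λ c → pos {n ∸ 1} c ≡ j) ⊎ (∀ v → sg j v ≡ true)
  coordinate zero = inj₂ λ _ → refl
  coordinate (suc j) with j <? n ∸ 1
  ... | yes l = inj₁ (fromℕ< l , cong suc (Finₚ.toℕ-fromℕ< l))
  ... | no ¬l = inj₂ λ v → refl

  coordinate< : ∀ {j} → 0 < j → j < n → ∃ λ c → pos {n ∸ 1} c ≡ j
  coordinate< {suc j} _ l = fromℕ< (ℕₚ.∸-monoˡ-≤ 1 l) , cong suc (Finₚ.toℕ-fromℕ< (ℕₚ.∸-monoˡ-≤ 1 l))

  sg-cong : ∀ j {v w} → v ≈ w → sg j v ≡ sg j w
  sg-cong j e with coordinate j
  ... | inj₁ (c , p) = trans (sg-σ p _) (trans (cong plus (σ-cong e c)) (sym (sg-σ p _)))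
  ... | inj₂ p = trans (p _) (sym (p _))

  sg-opposite : ∀ {j j′ c d v w} → pos c ≡ j → pos d ≡ j′ → σ v c ≡ opposite (σ w d) → sg j v ≡ not (sg j′ w)
  sg-opposite {v = v} {w} p q e =
    trans (sg-σ p v) (trans (cong plus e) (trans (plus-opposite _) (cong not (sym (sg-σ q w)))))

  sg-opposite⁻ : ∀ {j j′ c d v w} → pos c ≡ j → pos d ≡ j′ → sg j v ≡ not (sg j′ w) → σ v c ≡ opposite (σ w d)
  sg-opposite⁻ {v = v} {w} p q e =
    plus-injective (trans (sym (sg-σ p v)) (trans e (trans (cong not (sg-σ q w)) (sym (plus-opposite _)))))

  edge⇒sg : ∀ {j w x} → E (suc j) w x → sg (suc j) w ≡ not (sg j w)
  edge⇒sg {j} e with 1<i , i<n ← E-color e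
    with c , p ← coordinate< {j} (ℕₚ.≤-pred 1<i) (ℕₚ.<-trans (ℕₚ.n<1+n j) i<n)
    with d , q ← coordinate< {suc j} (s≤s z≤n) i<n =
    not-swap (sg-opposite p q (Equivalence.from (ax1 1<i i<n _ p q) (_ , e)))

  opaque
    sg⇒edge : ∀ {j w} → 1 < suc j → suc j < n → sg (suc j) w ≡ not (sg j w) → ∃ (E (suc j) w)
    sg⇒edge {j} 1<i i<n e
      with c , p ← coordinate< {j} (ℕₚ.≤-pred 1<i) (ℕₚ.<-trans (ℕₚ.n<1+n j) i<n)
      with d , q ← coordinate< {suc j} (s≤s z≤n) i<n =
      Equivalence.to (ax1 1<i i<n _ p q) (sg-opposite⁻ p q (not-swap e))

  sg-flip′ : ∀ {j w x} → E (suc j) w x → sg j x ≡ not (sg j w)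
  sg-flip′ {j} e with 1<i , i<n ← E-color e
    with c , p ← coordinate< {j} (ℕₚ.≤-pred 1<i) (ℕₚ.<-trans (ℕₚ.n<1+n j) i<n) =
    not-swap (sg-opposite p p (ax2-flip e (inj₁ p)))

  sg-fix : ∀ {i w x} h → E i w x → 2 + h < i ⊎ suc i < h → sg h w ≡ sg h x
  sg-fix {i} h e far with coordinate h
  ... | inj₂ p = trans (p _) (sym (p _))
  ... | inj₁ (c , refl) = trans (sg-σ refl _) (trans (cong plus (ax2-fix e (shape far))) (sym (sg-σ refl _)))
    where
    shape : 2 + pos c < i ⊎ suc i < pos c → pos c + 2 < i ⊎ i + 1 < pos c
    shape (inj₁ x) = inj₁ (subst (_< i) (ℕₚ.+-comm 2 (pos c)) x)
    shape (inj₂ x) = inj₂ (subst (_< pos c) (ℕₚ.+-comm 1 i) x)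

  sg-above : ∀ {i w x} → E i w x → sg (suc i) w ≡ sg (suc i) x ⊎ sg (suc i) w ≡ not (sg i w)
  sg-above {i} {w} {x} e with coordinate (suc i)
  ... | inj₂ p = inj₁ (trans (p _) (sym (p _)))
  ... | inj₁ (c , p) with sg (suc i) w Boolₚ.≟ sg (suc i) x
  ...   | yes q = inj₁ q
  ...   | no ¬q with 1<i , i<n ← E-color e
    with d , q ← coordinate< {i} (ℕₚ.<-trans (s≤s z≤n) 1<i) i<n =
    inj₂ (sg-opposite p q (ax3-above e (trans p (ℕₚ.+-comm 1 i)) q
      (sg-opposite⁻ p p (Boolₚ.¬-not ¬q))))

  opaque
    double-edge : ∀ {i v w x y} → 1 ≤ i → E i v w → E (suc i) v x → E (suc i) w y → w ≈ x
    double-edge {suc j} {v} {w} {x} {y} _ e f g =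
      [ by point (from-yes (double? point))
      , [ by (threePath 2) (from-yes (double? (threePath 2)))
        , by (doubleEdge 2) (from-yes (double? (doubleEdge 2))) ]′ ]′
      (ax4-two (s≤s (proj₁ (E-color e))) (proj₂ (E-color f)) v)
      where
      by : ∀ {k} (P : Pattern k) → Double P → ComponentIs 𝒢 (Between (suc j) (2 + j)) v (shift j P) → w ≈ x
      by P D is = V.trans (V.sym (at-≈ pw)) (V.trans (V.reflexive (cong vertex
          (D (at pv) (at pw) (at px) (at py)
            (adjacent ℕₚ.≤-refl (s≤s z≤n) pv pw e) (adjacent (s≤s z≤n) ℕₚ.≤-refl pv px f)
            (adjacent (s≤s z≤n) ℕₚ.≤-refl pw py g)))) (at-≈ px))
        where
        open ComponentIs is using (vertex)
        open Local 𝒢 {m = 2} P is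
        pv : Here v
        pv = stop V.refl
        pw : Here w
        pw = path-edge 𝒢 (ℕₚ.≤-refl , ℕₚ.n≤1+n _) e
        px : Here x
        px = path-edge 𝒢 (ℕₚ.n≤1+n _ , ℕₚ.≤-refl) f
        py : Here y
        py = path-trans 𝒢 pw (path-edge 𝒢 (ℕₚ.n≤1+n _ , ℕₚ.≤-refl) g)

  opaque
    exclusive : ∀ {i v w} → 2 < suc i → E (suc i) v w →
                E i v w ⊎ (∃ (E i v) × ¬ ∃ (E i w)) ⊎ (¬ ∃ (E i v) × ∃ (E i w))
    exclusive {zero} l e = contradiction (proj₁ (E-color e)) λ { (s≤s ()) }
    exclusive {suc j} {v} {w} l e =
      [ by point (from-yes (exclusive? point))
      , [ by (threePath 2) (from-yes (exclusive? (threePath 2)))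
        , by (doubleEdge 2) (from-yes (exclusive? (doubleEdge 2))) ]′ ]′
      (ax4-two l (proj₂ (E-color e)) v)
      where
      by : ∀ {k} (P : Pattern k) → Exclusive P → ComponentIs 𝒢 (Between (suc j) (2 + j)) v (shift j P) →
           E (suc j) v w ⊎ (∃ (E (suc j) v) × ¬ ∃ (E (suc j) w)) ⊎ (¬ ∃ (E (suc j) v) × ∃ (E (suc j) w))
      by P X is = conclude (X _ _ (adjacent (s≤s z≤n) ℕₚ.≤-refl pv pw e))
        where
        open ComponentIs is using (vertex)
        open Local 𝒢 {m = 2} P is
        pv : Here v
        pv = stop V.refl
        pw : Here w
        pw = path-edge 𝒢 (ℕₚ.n≤1+n _ , ℕₚ.≤-refl) e
        none : ∀ {u} (p : Here u) → (∀ c → ¬ Adjacent P 1 (at p) c) → ¬ ∃ (E (suc j) u)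
        none p ¬a (y , f) = ¬a (at q) (adjacent ℕₚ.≤-refl (s≤s z≤n) p q f)
          where
          q : Here y
          q = path-trans 𝒢 p (path-edge 𝒢 (ℕₚ.≤-refl , ℕₚ.n≤1+n _) f)
        some : ∀ {u} (p : Here u) → ∃ (Adjacent P 1 (at p)) → ∃ (E (suc j) u)
        some p (c , a) = vertex c , edge ℕₚ.≤-refl (s≤s z≤n) (at-≈ p) V.refl a
        conclude : Adjacent P 1 (at pv) (at pw) ⊎
          ∃ (Adjacent P 1 (at pv)) × (∀ c → ¬ Adjacent P 1 (at pw) c) ⊎
          (∀ c → ¬ Adjacent P 1 (at pv) c) × ∃ (Adjacent P 1 (at pw)) →
          E (suc j) v w ⊎ (∃ (E (suc j) v) × ¬ ∃ (E (suc j) w)) ⊎ (¬ ∃ (E (suc j) v) × ∃ (E (suc j) w))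
        conclude (inj₁ a) = inj₁ (edge ℕₚ.≤-refl (s≤s z≤n) (at-≈ pv) (at-≈ pw) a)
        conclude (inj₂ (inj₁ (a , ¬b))) = inj₂ (inj₁ (some pv a , none pw ¬b))
        conclude (inj₂ (inj₂ (¬a , b))) = inj₂ (inj₂ (none pv ¬a , some pw b))

  opaque
    square : ∀ {i w x y z} → E i w x → E (2 + i) w y → E (suc i) x z →
             ∃ (E (suc i) w) ⊎ ∃ (E (2 + i) z) ⊎ ∃ λ u → E (2 + i) x u × E i y u
    square {zero} e _ _ = contradiction (proj₁ (E-color e)) λ ()
    square {suc j} {w} {x} {y} {z} e f g =
      [ by point (from-yes (square? point))
      , [ by (fourPath 3) (from-yes (square? (fourPath 3)))
        , [ by (fiveVertices 3) (from-yes (square? (fiveVertices 3)))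
          , by (sixVertices 3) (from-yes (square? (sixVertices 3))) ]′ ]′ ]′
      (ax4-three (s≤s (s≤s (proj₁ (E-color e)))) (proj₂ (E-color f)) w)
      where
      by : ∀ {k} (P : Pattern k) → Square P → ComponentIs 𝒢 (Between (suc j) (3 + j)) w (shift j P) →
           ∃ (E (2 + j) w) ⊎ ∃ (E (3 + j) z) ⊎ ∃ λ u → E (3 + j) x u × E (suc j) y u
      by P S is = conclude (S _ _ (adjacent ℕₚ.≤-refl (s≤s z≤n) pw px e)
                              _ (adjacent (s≤s z≤n) ℕₚ.≤-refl pw py f)
                              _ (adjacent (s≤s z≤n) (s≤s (s≤s z≤n)) px pz g))
        where
        open ComponentIs is using (vertex)
        open Local 𝒢 {m = 3} P is
        pw : Here w
        pw = stop V.refl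
        px : Here x
        px = path-edge 𝒢 (ℕₚ.≤-refl , ℕₚ.m≤n+m _ 2) e
        py : Here y
        py = path-edge 𝒢 (ℕₚ.m≤n+m _ 2 , ℕₚ.≤-refl) f
        pz : Here z
        pz = path-trans 𝒢 px (path-edge 𝒢 (ℕₚ.n≤1+n _ , ℕₚ.n≤1+n _) g)
        conclude : ∃ (Adjacent P 2 (at pw)) ⊎ ∃ (Adjacent P 3 (at pz)) ⊎
          (∃ λ e → Adjacent P 3 (at px) e × Adjacent P 1 (at py) e) →
          ∃ (E (2 + j) w) ⊎ ∃ (E (3 + j) z) ⊎ ∃ λ u → E (3 + j) x u × E (suc j) y u
        conclude (inj₁ (c , a)) = inj₁ (vertex c , edge (s≤s z≤n) (s≤s (s≤s z≤n)) (at-≈ pw) V.refl a)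
        conclude (inj₂ (inj₁ (c , a))) = inj₂ (inj₁ (vertex c , edge (s≤s z≤n) ℕₚ.≤-refl (at-≈ pz) V.refl a))
        conclude (inj₂ (inj₂ (c , a , b))) = inj₂ (inj₂ (vertex c ,
          edge (s≤s z≤n) ℕₚ.≤-refl (at-≈ px) V.refl a , edge ℕₚ.≤-refl (s≤s z≤n) (at-≈ py) V.refl b))

  distance : ∀ {i j} → 3 + j ≤ i → 3 ≤ ∣ i - j ∣
  distance {i} {j} p = subst (3 ≤_) (sym (ℕₚ.m≤n⇒∣n-m∣≡n∸m (ℕₚ.≤-trans (ℕₚ.m≤n+m j 3) p)))
    (ℕₚ.m+n≤o⇒m≤o∸n 3 p)

  opaque
    -- ax5 carries the edge of color `i` along the path one step at a time, since all colors of the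
    -- path are at most `i - 3`; the other ends trace a parallel path.
    shadow : ∀ {i m v w v′} → 2 + m ≤ i → E i v w → Path 𝒢 (_< m) v v′ →
             ∃ λ w′ → E i v′ w′ × Path 𝒢 (_< m) w w′
    shadow l e (stop f) = _ , E-resp f V.refl e , stop V.refl
    shadow {i} {m} l e (step j j<m f p)
      with u , g , h ← ax5 (E-sym e) f (distance (ℕₚ.≤-trans (s≤s (s≤s j<m)) l))
      with w′ , e′ , q ← shadow l (E-sym h) p = w′ , e′ , step j j<m g q

-- Tableaux attached to the vertices

last : ∀ {P : ℕ → Set} → (∀ j → Dec (P j)) → ∀ M → (∀ j → M ≤ j → ¬ P j) →
       (∃ λ o → P o × ∀ j → o < j → ¬ P j) ⊎ (∀ j → ¬ P j)
last P? zero above = inj₂ λ j → above j z≤n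
last {P} P? (suc M) above with P? M
... | yes p = inj₁ (M , p , above)
... | no ¬p = last P? M λ j M≤j → case M ≟ j of λ where
  (yes refl) → ¬p
  (no M≢j)   → above j (ℕₚ.≤∧≢⇒< M≤j M≢j)

-- Betweenness of three positions

mid-excl : ∀ {p q r} → Mid r p q → ¬ Mid p q r
mid-excl (inj₁ (a , b)) (inj₁ (c , d)) = ℕₚ.<-asym b (ℕₚ.<-trans c d)
mid-excl (inj₁ (a , b)) (inj₂ (c , d)) = ℕₚ.<-asym a c
mid-excl (inj₂ (a , b)) (inj₁ (c , d)) = ℕₚ.<-asym b d
mid-excl (inj₂ (a , b)) (inj₂ (c , d)) = ℕₚ.<-asym a (ℕₚ.<-trans c d)

-- For three consecutive letters at `p`, `q`, `r` the two descent signs differ when the middle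
-- letter is not between its neighbors; what remains are the configurations of `swapLow` and
-- `swapTop`.
mid-cases : ∀ {p q r} → p ≢ q → q ≢ r → p ≢ r → (q <ᵇ r) ≡ not (p <ᵇ q) → Mid r p q ⊎ Mid p q r
mid-cases {p} {q} {r} p≢q q≢r p≢r e with ℕₚ.<-cmp p q | ℕₚ.<-cmp p r
... | tri≈ _ x _ | _ = contradiction x p≢q
... | _ | tri≈ _ x _ = contradiction x p≢r
... | tri< a _ _ | tri< b _ _ =
  inj₁ (inj₁ (b , ℕₚ.≤∧≢⇒< (<ᵇ-false⁻ (trans e (cong not (<ᵇ-true a)))) (q≢r ∘ sym)))
... | tri< a _ _ | tri> _ _ c = inj₂ (inj₂ (c , a))
... | tri> _ _ a | tri< b _ _ = inj₂ (inj₁ (a , b))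
... | tri> _ _ a | tri> _ _ c =
  inj₁ (inj₂ (<ᵇ-true⁻ (trans e (cong not (<ᵇ-false (ℕₚ.<⇒≤ a)))) , c))

mid⇒same : ∀ {m p q} → Mid m p q → (p <ᵇ m) ≡ (m <ᵇ q)
mid⇒same (inj₁ (a , b)) = trans (<ᵇ-true a) (sym (<ᵇ-true b))
mid⇒same (inj₂ (a , b)) = trans (<ᵇ-false (ℕₚ.<⇒≤ b)) (sym (<ᵇ-false (ℕₚ.<⇒≤ a)))

mid⇒sameˡ : ∀ {m p q} → Mid m p q → (p <ᵇ q) ≡ (p <ᵇ m)
mid⇒sameˡ (inj₁ (a , b)) = trans (<ᵇ-true (ℕₚ.<-trans a b)) (sym (<ᵇ-true a))
mid⇒sameˡ (inj₂ (a , b)) = trans (<ᵇ-false (ℕₚ.<⇒≤ (ℕₚ.<-trans a b))) (sym (<ᵇ-false (ℕₚ.<⇒≤ b)))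

mid⇒sameʳ : ∀ {m p q} → Mid m p q → (p <ᵇ q) ≡ (m <ᵇ q)
mid⇒sameʳ m = trans (mid⇒sameˡ m) (mid⇒same m)

<ᵇ-asym : ∀ {p q} → p ≢ q → (q <ᵇ p) ≡ not (p <ᵇ q)
<ᵇ-asym {p} {q} p≢q with ℕₚ.<-cmp p q
... | tri< a _ _ = trans (<ᵇ-false (ℕₚ.<⇒≤ a)) (cong not (sym (<ᵇ-true a)))
... | tri≈ _ a _ = contradiction a p≢q
... | tri> _ _ a = trans (<ᵇ-true a) (cong not (sym (<ᵇ-false (ℕₚ.<⇒≤ a))))

mid-≢ : ∀ {m p q} → Mid m p q → p ≢ m × m ≢ q × p ≢ q
mid-≢ (inj₁ (a , b)) = ℕₚ.<⇒≢ a , ℕₚ.<⇒≢ b , ℕₚ.<⇒≢ (ℕₚ.<-trans a b)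
mid-≢ (inj₂ (a , b)) = ℕₚ.<⇒≢ b ∘ sym , ℕₚ.<⇒≢ a ∘ sym , ℕₚ.<⇒≢ (ℕₚ.<-trans a b) ∘ sym

mid⇒differ : ∀ {p q r} → Mid r p q ⊎ Mid p q r → (q <ᵇ r) ≡ not (p <ᵇ q)
mid⇒differ (inj₁ m) = trans (<ᵇ-asym (proj₁ (proj₂ (mid-≢ m)))) (cong not (sym (mid⇒sameʳ m)))
mid⇒differ (inj₂ m) = trans (mid⇒sameˡ m) (<ᵇ-asym (proj₁ (mid-≢ m) ∘ sym))

module Steps (n : ℕ) where
  open Maya n

  step-length : ∀ {i s s′} → Step i s s′ → length s ≡ length s′
  step-length (swapLow _) = refl
  step-length (swapTop _) = refl
  step-length (later p)   = cong suc (step-length p)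

  step-det : ∀ {i s s₁ s₂} → Step i s s₁ → Step i s s₂ → s₁ ≡ s₂
  step-det (swapLow _) (swapLow _) = refl
  step-det (swapLow a) (swapTop b) = contradiction b (mid-excl a)
  step-det (swapLow _) (later q)   = contradiction (step-< q) (ℕₚ.<-irrefl refl)
  step-det (swapTop a) (swapLow b) = contradiction a (mid-excl b)
  step-det (swapTop _) (swapTop _) = refl
  step-det (swapTop _) (later q)   = contradiction (step-< q) (ℕₚ.<-irrefl refl)
  step-det (later p)   (swapLow _) = contradiction (step-< p) (ℕₚ.<-irrefl refl)
  step-det (later p)   (swapTop _) = contradiction (step-< p) (ℕₚ.<-irrefl refl)
  step-det (later p)   (later q)   = cong (_ ∷_) (step-det p q)

  step-cons : ∀ {i a s s″} → Step i (a ∷ s) s″ → i < length s → ∃ λ s′ → s″ ≡ a ∷ s′ × Step i s s′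
  step-cons (swapLow _) l = contradiction l (ℕₚ.<-irrefl refl)
  step-cons (swapTop _) l = contradiction l (ℕₚ.<-irrefl refl)
  step-cons (later p)   _ = _ , refl , p

  step-prefix : ∀ pre {i s s″} → Step i (pre ++ s) s″ → i < length s → ∃ λ s′ → s″ ≡ pre ++ s′ × Step i s s′
  step-prefix []        p l = _ , refl , p
  step-prefix (a ∷ pre) {s = s} p l
    with _ , refl , p′ ← step-cons p (ℕₚ.<-≤-trans l (ℕₚ.≤-trans (ℕₚ.m≤n+m _ (length pre)) (ℕₚ.≤-reflexive (sym (Listₚ.length-++ pre)))))
    with _ , refl , p″ ← step-prefix pre p′ l = _ , refl , p″

  step-≡ : ∀ {i j s s′} → i ≡ j → Step i s s′ → Step j s s′
  step-≡ refl p = p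

  valid-tail : ∀ pre {s} → Valid (pre ++ s) → Valid s
  valid-tail []        v       = v
  valid-tail (_ ∷ pre) (_ ∷ v) = valid-tail pre v

module Levels {n} (𝒢 : SignedColoredGraph n n) (deg : IsDualEquivalenceGraph 𝒢) where
  open SignedColoredGraph 𝒢
  open Axioms 𝒢 deg
  open Maya n
  open Steps n

  Reach : ℕ → Vertex → Vertex → Set
  Reach k = Path 𝒢 (_< k)

  reach-≤ : ∀ {k k′ v w} → k ≤ k′ → Reach k v w → Reach k′ v w
  reach-≤ l = path-map 𝒢 λ _ _ c → ℕₚ.<-≤-trans c l

  Signs : Vertex → List ℕ → Set
  Signs v []          = ⊤
  Signs v (_ ∷ [])    = ⊤
  Signs v (b ∷ a ∷ s) = (sg (suc (length s)) v ≡ (a <ᵇ b)) × Signs v (a ∷ s)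

  signs-tail : ∀ {v a s} → Signs v (a ∷ s) → Signs v s
  signs-tail {s = []}    _ = tt
  signs-tail {s = _ ∷ _} p = proj₂ p

  step-signs : ∀ {i v s s′} → Step (suc i) s s′ → Signs v s → sg (suc i) v ≡ not (sg i v)
  step-signs (swapLow m) (p , q , _) = trans p (trans (mid⇒differ (inj₁ m)) (cong not (sym q)))
  step-signs (swapTop m) (p , q , _) = trans p (trans (mid⇒differ (inj₂ m)) (cong not (sym q)))
  step-signs (later p) s = step-signs p (signs-tail s)

  -- `t` is defined on all vertices rather than on one component, because the next level compares
  -- the tableaux at the two ends of an edge of color `k`.
  record Level (k : ℕ) : Set where
    field
      t      : Vertex → List ℕ
      len    : ∀ v → length (t v) ≡ k
      valid  : ∀ v → Valid (t v)
      t-cong : ∀ {v w} → v ≈ w → t v ≡ t w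
      signs  : ∀ v → Signs v (t v)
      t-step : ∀ {i v w} → E i v w → i < k → Step i (t v) (t w)
      -- An edge of color i keeps the letters 1, …, i - 2.
      t-fix  : ∀ {i v w} → E i v w → drop (2 + k ∸ i) (t v) ≡ drop (2 + k ∸ i) (t w)
      t-inj  : ∀ {v w} → Reach k v w → t v ≡ t w → v ≈ w

  module Lift {k} (L : Level k) (k≤n : k ≤ n) where
    open Level L

    reach-shape : ∀ {v w} → Reach k v w → shape (t v) ≐ shape (t w)
    reach-shape (stop e)         j = cong (λ s → shape s j) (t-cong e)
    reach-shape (step i i<k e p) j = trans (step-shape (t-step e i<k) j) (reach-shape p j)

    opaque
      -- ax1 only supplies some neighbor; that its tableau is `s′` follows because a color allows at
      -- most one move of a given code.
      lift-step : ∀ {i v s s′} → t v ≡ s → Step i s s′ → ∃ λ w → E i v w × t w ≡ s′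
      lift-step {suc i} {v} refl p
        with i<k ← subst (suc i <_) (len v) (step-< p)
        with w , e ← sg⇒edge (step-> p) (ℕₚ.<-≤-trans i<k k≤n) (step-signs p (signs v)) =
        w , e , step-det (t-step e i<k) p
      lift-step {zero} _ p = contradiction (step-> p) λ ()

    lift : ∀ {m v s s′} → t v ≡ s → Star (Move m) s s′ → ∃ λ w → Reach m v w × t w ≡ s′
    lift eq ε = _ , stop V.refl , eq
    lift eq ((i , i<m , p) ◅ ps)
      with w , e , eq₁ ← lift-step eq p
      with x , q , eq₂ ← lift eq₁ ps = x , step i i<m e q , eq₂

    opaque
      -- Realizes by vertices any rearrangement of the first letters, with the later letters `pre`
      -- untouched. The bound on the colors is what allows such a path to be carried along an edge
      -- of high color afterwards.
      move : ∀ pre {v s s′} → t v ≡ pre ++ s → Valid s′ → shape s ≐ shape s′ → length s ≡ length s′ →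
             ∃ λ w → Reach (length s) v w × t w ≡ pre ++ s′
      move pre {v} {s} {s′} eq v′ e l = lift eq (prefix pre
        (connect (length s) (valid-tail pre (subst Valid eq (valid v))) v′ e refl (sym l)))
        where
        prefix : ∀ pre {m s s′} → Star (Move m) s s′ → Star (Move m) (pre ++ s) (pre ++ s′)
        prefix []        p = p
        prefix (a ∷ pre) p = gmap (a ∷_) (λ (i , l , q) → i , l , later q) (prefix pre p)

    opaque
      stable : ∀ pre {m v w s} → t v ≡ pre ++ s → m ≤ length s → m ≤ k → Reach m v w →
               ∃ λ s′ → t w ≡ pre ++ s′
      stable pre eq l l′ (stop e) = _ , trans (sym (t-cong e)) eq
      stable pre {s = s} eq l l′ (step i i<m e p)
        with s′ , eq′ , q ← step-prefix pre (subst (λ s → Step i s _) eq (t-step e (ℕₚ.<-≤-trans i<m l′)))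
                              (ℕₚ.<-≤-trans i<m l) =
        stable pre eq′ (subst (_ ≤_) (step-length q) l) l′ p

    reach-sg : ∀ {v w} m h → m < h → Reach m v w → sg h v ≡ sg h w
    reach-sg m h l (stop e)         = sg-cong h e
    reach-sg m h l (step i i<m e p) = trans (sg-fix h e (inj₂ (ℕₚ.<-≤-trans (s≤s i<m) l))) (reach-sg m h l p)

    opaque
      reach-top : ∀ {v o} → Removable (shape (t v)) o → ∃₂ λ w s → Reach k v w × t w ≡ o ∷ s
      reach-top {v} {o} R
        with s , V , e , l ← remove (valid v) R
        with w , p , eq ← move [] {v} refl V (sym ∘ e) (sym l) = w , s , subst (λ m → Reach m v w) (len v) p , eq

    top-removable : ∀ {v w o s} → Reach k v w → t w ≡ o ∷ s → Removable (shape (t v)) o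
    top-removable {o = o} {s} p eq = removable-resp (λ j → sym (reach-shape p j))
      (subst (λ s → Removable (shape s) o) (sym eq) (add-removable o (shape s)))

    -- a is the position of the letter k + 1, as far as the signature at k tells.
    record Next (v : Vertex) (a : ℕ) : Set where
      field
        addable : Addable (shape (t v)) a
        sign    : ∀ {w o s} → Reach k v w → t w ≡ o ∷ s → sg k w ≡ (o <ᵇ a)

    open Next

    next-unique : ∀ {v a a′} → Next v a → Next v a′ → a ≡ a′
    next-unique A A′ = addable-unique (addable A) (addable A′) λ u R →
      case reach-top R of λ { (w , s , p , eq) → trans (sym (sign A p eq)) (sign A′ p eq) }

    next-reach : ∀ {v w a} → Reach k v w → Next v a → Next w a
    next-reach p A = record
      { addable = addable-resp (reach-shape p) (addable A)
      ; sign    = λ q → sign A (path-trans 𝒢 p q)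
      }

    cons-len : ∀ {v a s} → t v ≡ a ∷ s → suc (length s) ≡ k
    cons-len {v} eq = trans (cong length (sym eq)) (len v)

    -- Colors below `k - 1` rearrange the first `k - 1` letters of `w` into those of `w′` without
    -- affecting the sign at `k`; by `t-inj` the path then ends at `w′` itself.
    sign-determined : ∀ {v w w′ o s s′} → Reach k v w → Reach k v w′ → t w ≡ o ∷ s → t w′ ≡ o ∷ s′ →
                      sg k w ≡ sg k w′
    sign-determined {v} {w} {w′} {o} {s} {s′} p p′ eq eq′
      with (x ∷ V) ← subst Valid eq (valid w)
      with (x′ ∷ V′) ← subst Valid eq′ (valid w′)
      with q ← path-trans 𝒢 (path-sym 𝒢 p) p′
      with w″ , r , eq″ ← move (o ∷ []) eq V′
        (add-cancel o x x′ λ j → subst₂ (λ s s′ → shape s j ≡ shape s′ j) eq eq′ (reach-shape q j))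
        (ℕₚ.suc-injective (trans (cons-len eq) (sym (cons-len eq′)))) =
      trans (reach-sg _ k (ℕₚ.≤-reflexive (cons-len eq)) r)
        (sg-cong k (t-inj (path-trans 𝒢 (path-sym 𝒢 (reach-≤ (ℕₚ.≤-trans (ℕₚ.n≤1+n _) (ℕₚ.≤-reflexive (cons-len eq))) r)) q)
          (trans eq″ (sym eq′))))

    -- At `w₁` the letters k, k - 1, k - 2 occupy `o`, `o′` and a corner between them, so an edge of
    -- color k - 1 leads to `w₂`, where k is at `o′`. By ax3 the sign at k is unchanged along it or
    -- opposite to the sign at k - 1 at `w₁`, which is negative because `o < o′`.
    sign-monotone : ∀ {v w w′ o o′ s s′} → Reach k v w → Reach k v w′ → t w ≡ o ∷ s → t w′ ≡ o′ ∷ s′ →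
                    o < o′ → sg k w′ ≡ true → sg k w ≡ true
    sign-monotone {v} {w} {w′} {o} {o′} {s} {s′} p p′ eq eq′ o<o′ plus
      with (x ∷ V) ← subst Valid eq (valid w)
      with R′ ← subst (λ s → Removable (shape s) o′) eq
                  (top-removable (path-trans 𝒢 (path-sym 𝒢 p) p′) eq′)
      with f ← removable-far R′ (add-removable o (shape s)) (ℕₚ.<⇒≢ o<o′ ∘ sym)
      with s₁ , V₁@(x₁ ∷ v₁) , e₁ , l₁ ← remove V (removable-strengthen f R′)
      with y ← addable-strengthen (far-sym f) (addable-resp (sym ∘ e₁) x)
      with u , m , U ← removable-between y x₁ o<o′
      with s₂ , v₂ , e₂ , l₂ ← remove v₁ U
      with w₁ , q , eq₁ ← move [] eq
             (addable-resp (λ j → trans (sym (e₁ j)) (add-cong o′ (λ j → sym (e₂ j)) j)) x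
               ∷ addable-resp (sym ∘ e₂) x₁ ∷ v₂)
             (add-cong o λ j → trans (sym (e₁ j)) (add-cong o′ (sym ∘ e₂) j))
             (cong suc (trans (sym l₁) (cong suc (sym l₂))))
      with w₂ , e , eq₂ ← lift-step eq₁ (swapTop (inj₂ m))
      with k₁ ← cons-len eq₁
      with q₁ ← path-trans 𝒢 p (subst (λ m → Reach m w w₁) (cons-len eq) q)
      with q₂ ← path-trans 𝒢 q₁ (path-edge 𝒢 (ℕₚ.≤-reflexive k₁) e)
      with d₁ ← sign-determined p q₁ eq eq₁
      with d₂ ← sign-determined p′ q₂ eq′ eq₂
      with subst (λ m → sg m w₁ ≡ sg m w₂ ⊎ sg m w₁ ≡ not (sg (2 + length s₂) w₁)) k₁ (sg-above e)
    ... | inj₁ same = trans d₁ (trans same (trans (sym d₂) plus))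
    ... | inj₂ differ = trans d₁ (trans differ (cong not
          (trans (proj₁ (subst (Signs w₁) eq₁ (signs w₁))) (<ᵇ-false (ℕₚ.<⇒≤ o<o′)))))

    module _ (v : Vertex) where

      private
        Plus : ℕ → Set
        Plus o = ∃ λ w → (∃ λ s → Reach k v w × t w ≡ o ∷ s) × sg k w ≡ true

        removable? : ∀ o → Dec (Removable (shape (t v)) o)
        removable? o with shape (t v) o Boolₚ.≟ false | shape (t v) (suc o) Boolₚ.≟ true
        ... | yes p | yes q = yes (p , q)
        ... | no ¬p | _     = no λ { (p , _) → ¬p p }
        ... | _     | no ¬q = no λ { (_ , q) → ¬q q }

        plus? : ∀ o → Dec (Plus o)
        plus? o with removable? o
        ... | no ¬R = no λ { (w , (s , p , eq) , _) → ¬R (top-removable p eq) }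
        ... | yes R with w , s , p , eq ← reach-top R with sg k w in h
        ...   | true  = yes (w , (s , p , eq) , h)
        ...   | false = no λ { (w′ , (s′ , p′ , eq′) , h′) → clash h′ (trans (sign-determined p′ p eq′ eq) h) }

        bound : ∀ {j} → n + k < j → shape (t v) j ≡ false
        bound l = shape-right (valid v) _ (subst (λ k → n + k < _) (sym (len v)) l)

        -- `j` is a threshold: removable corners left of it have sign +, the others sign -. The
        -- first addable corner from `j` on works, as the boundary is vertical from `j` up to it and
        -- so has no removable corner there.
        build : ∀ j → j ≤ suc (n + k) → shape (t v) j ≡ true →
                (∀ {w o s} → Reach k v w → t w ≡ o ∷ s → o < j → sg k w ≡ true) →
                (∀ {w o s} → Reach k v w → t w ≡ o ∷ s → j ≤ o → sg k w ≡ false) →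
                ∃ (Next v)
        build j l b left right
          with a , j≤a , _ , ba , bsa , all ← firstFlip (shape (t v)) true (suc (n + k) ∸ j) j
                 (ℕₚ.m∸n+n≡m l) b (bound ℕₚ.≤-refl) =
          a , record { addable = ba , bsa ; sign = λ {w} {o} p eq → sgn p eq }
          where
          sgn : ∀ {w o s} → Reach k v w → t w ≡ o ∷ s → sg k w ≡ (o <ᵇ a)
          sgn {o = o} p eq with o <? j
          ... | yes o<j = trans (left p eq o<j) (sym (<ᵇ-true (ℕₚ.<-≤-trans o<j j≤a)))
          ... | no o≮j = trans (right p eq (ℕₚ.≮⇒≥ o≮j)) (sym (<ᵇ-false (ℕₚ.≮⇒≥ λ o<a →
                clash (all o (ℕₚ.≮⇒≥ o≮j) (ℕₚ.<⇒≤ o<a)) (Removable.before (top-removable p eq)))))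

      opaque
        next : ∃ (Next v)
        -- The search starts at `n + k` because a removable corner that far right would need a
        -- vertical step beyond the diagram.
        next with last plus? (n + k) (λ { j l (w , (s , p , eq) , _) →
                    clash (Removable.after (top-removable p eq)) (bound (s≤s l)) })
        -- With no positive corner the threshold is 0, where the step is vertical because `k ≤ n`;
        -- otherwise it is the vertical step just after the last positive corner.
        ... | inj₂ none = build 0 z≤n
                (shape-left (valid v) 0 (subst (_≤ n) (sym (len v)) k≤n))
                (λ _ _ ()) (λ p eq _ → Boolₚ.¬-not λ h → none _ (_ , (_ , p , eq) , h))
        ... | inj₁ (o , (w , (s , p , eq) , h) , above) = build (suc o)
                (ℕₚ.≮⇒≥ λ l → clash (Removable.after (top-removable p eq)) (bound (ℕₚ.<-trans (ℕₚ.n<1+n _) l)))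
                (Removable.after (top-removable p eq))
                (λ {w′} {o′} p′ eq′ l → case o′ ≟ o of λ where
                  (yes refl) → trans (sign-determined p′ p eq′ eq) h
                  (no o′≢o)  → sign-monotone p′ p eq′ eq (ℕₚ.≤∧≢⇒< (ℕₚ.≤-pred l) o′≢o) h)
                (λ p′ eq′ l → Boolₚ.¬-not λ h′ → above _ l (_ , (_ , p′ , eq′) , h′))

-- Edges of the highest color

≢-not : ∀ {x y} → x ≢ not y → x ≡ y
≢-not {y = y} p = trans (Boolₚ.¬-not p) (Boolₚ.not-involutive y)

-- Here and below `p`, `q`, `r` are the positions of the letters k - 1, k, k + 1 at one end of an
-- edge of color k and `p`, `q′`, `r′` those at the other. The first hypothesis puts `q` and `q′` on
-- opposite sides of `p`, hence `q′` on the side of `r`.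
mid-transfer : ∀ {o p q r q′ r′} → (p <ᵇ q′) ≡ not (p <ᵇ q) → Mid p q r → Mid o p r →
                Mid p q′ r′ → Mid o q′ r′ → Mid o p q′
mid-transfer f (inj₁ (a , b)) (inj₂ (c , d)) _ _ = contradiction b (ℕₚ.<⇒≯ (ℕₚ.<-trans c d))
mid-transfer f (inj₂ (a , b)) (inj₁ (c , d)) _ _ = contradiction a (ℕₚ.<⇒≯ (ℕₚ.<-trans c d))
mid-transfer f (inj₁ (a , b)) (inj₁ (c , d)) (inj₁ (x , y)) _ =
  clash (trans f (cong not (<ᵇ-false (ℕₚ.<⇒≤ a)))) (<ᵇ-false (ℕₚ.<⇒≤ x))
mid-transfer f (inj₁ (a , b)) (inj₁ (c , d)) (inj₂ (x , y)) (inj₁ (z , w)) =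
  contradiction (ℕₚ.<-trans c (ℕₚ.<-trans w x)) (ℕₚ.<-irrefl refl)
mid-transfer f (inj₁ (a , b)) (inj₁ (c , d)) (inj₂ (x , y)) (inj₂ (z , w)) = inj₁ (c , w)
mid-transfer f (inj₂ (a , b)) (inj₂ (c , d)) (inj₂ (x , y)) _ =
  clash (<ᵇ-true y) (trans f (cong not (<ᵇ-true b)))
mid-transfer f (inj₂ (a , b)) (inj₂ (c , d)) (inj₁ (x , y)) (inj₂ (z , w)) =
  contradiction (ℕₚ.<-trans d (ℕₚ.<-trans y z)) (ℕₚ.<-irrefl refl)
mid-transfer f (inj₂ (a , b)) (inj₂ (c , d)) (inj₁ (x , y)) (inj₁ (z , w)) = inj₂ (z , d)

mid-first : ∀ {o p q r} → Mid p q r → Mid o p r → Mid p q o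
mid-first (inj₁ (a , b)) (inj₁ (c , d)) = inj₁ (a , c)
mid-first (inj₁ (a , b)) (inj₂ (c , d)) = contradiction (ℕₚ.<-trans c d) (ℕₚ.<⇒≯ b)
mid-first (inj₂ (a , b)) (inj₁ (c , d)) = contradiction (ℕₚ.<-trans c d) (ℕₚ.<⇒≯ a)
mid-first (inj₂ (a , b)) (inj₂ (c , d)) = inj₂ (d , b)

mid-second : ∀ {o p q r} → Mid p q r → Mid o p r → Mid o q r
mid-second (inj₁ (a , b)) (inj₁ (c , d)) = inj₁ (ℕₚ.<-trans a c , d)
mid-second (inj₁ (a , b)) (inj₂ (c , d)) = contradiction (ℕₚ.<-trans c d) (ℕₚ.<⇒≯ b)
mid-second (inj₂ (a , b)) (inj₁ (c , d)) = contradiction (ℕₚ.<-trans c d) (ℕₚ.<⇒≯ a)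
mid-second (inj₂ (a , b)) (inj₂ (c , d)) = inj₂ (c , ℕₚ.<-trans d b)

-- `q′` and `r` lie on the same side of `p`. A corner `o` on the other side cannot separate them; on
-- this side `to` and `from` exclude it.
separate : ∀ {o p q r q′ r′} → (p <ᵇ q′) ≡ not (p <ᵇ q) → Mid p q r → Mid p q′ r′ →
           (Mid o p r → Mid o p q′) → (Mid o p q′ → Mid o p r) → o ≢ q′ → o ≢ r →
           (o <ᵇ q′) ≡ (o <ᵇ r)
separate {o} {p} f (inj₁ (a , b)) (inj₁ (x , y)) to from _ _ =
  clash (trans f (cong not (<ᵇ-false (ℕₚ.<⇒≤ a)))) (<ᵇ-false (ℕₚ.<⇒≤ x))
separate {o} {p} f (inj₂ (a , b)) (inj₂ (x , y)) to from _ _ =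
  clash (<ᵇ-true y) (trans f (cong not (<ᵇ-true b)))
separate {o} {p} {r = r} {q′} f (inj₁ (a , b)) (inj₂ (x , y)) to from o≢q′ o≢r with ℕₚ.<-cmp o p
... | tri< o<p _ _ = trans (<ᵇ-true (ℕₚ.<-trans o<p y)) (sym (<ᵇ-true (ℕₚ.<-trans o<p b)))
... | tri≈ _ refl _ = trans (<ᵇ-true y) (sym (<ᵇ-true b))
... | tri> _ _ p<o with o <? r | o <? q′
...   | yes l | yes l′ = trans (<ᵇ-true l′) (sym (<ᵇ-true l))
...   | no l  | no l′  = trans (<ᵇ-false (ℕₚ.≮⇒≥ l′)) (sym (<ᵇ-false (ℕₚ.≮⇒≥ l)))
...   | yes l | no l′  = case to (inj₁ (p<o , l)) of λ where
          (inj₁ (_ , z)) → contradiction z l′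
          (inj₂ (_ , z)) → contradiction z (ℕₚ.<⇒≯ p<o)
...   | no l  | yes l′ = case from (inj₁ (p<o , l′)) of λ where
          (inj₁ (_ , z)) → contradiction z l
          (inj₂ (_ , z)) → contradiction z (ℕₚ.<⇒≯ p<o)
separate {o} {p} {r = r} {q′} f (inj₂ (a , b)) (inj₁ (x , y)) to from o≢q′ o≢r with ℕₚ.<-cmp o p
... | tri> _ _ p<o = trans (<ᵇ-false (ℕₚ.<⇒≤ (ℕₚ.<-trans x p<o))) (sym (<ᵇ-false (ℕₚ.<⇒≤ (ℕₚ.<-trans a p<o))))
... | tri≈ _ refl _ = trans (<ᵇ-false (ℕₚ.<⇒≤ x)) (sym (<ᵇ-false (ℕₚ.<⇒≤ a)))
... | tri< o<p _ _ with r <? o | q′ <? o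
...   | yes l | yes l′ = trans (<ᵇ-false (ℕₚ.<⇒≤ l′)) (sym (<ᵇ-false (ℕₚ.<⇒≤ l)))
...   | no l  | no l′  = trans (<ᵇ-true (ℕₚ.≤∧≢⇒< (ℕₚ.≮⇒≥ l′) o≢q′)) (sym (<ᵇ-true (ℕₚ.≤∧≢⇒< (ℕₚ.≮⇒≥ l) o≢r)))
...   | yes l | no l′  = case to (inj₂ (l , o<p)) of λ where
          (inj₂ (z , _)) → contradiction z l′
          (inj₁ (z , _)) → contradiction z (ℕₚ.<⇒≯ o<p)
...   | no l  | yes l′ = case from (inj₂ (l′ , o<p)) of λ where
          (inj₂ (z , _)) → contradiction z l
          (inj₁ (z , _)) → contradiction z (ℕₚ.<⇒≯ o<p)

module Extend {n} (𝒢 : SignedColoredGraph n n) (deg : IsDualEquivalenceGraph 𝒢) where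
  open SignedColoredGraph 𝒢
  open Axioms 𝒢 deg
  open Maya n
  open Steps n
  open Levels 𝒢 deg

  module Letter {k} (L : Level k) (k<n : k < n) where
    open Level L public
    open Lift L (ℕₚ.<⇒≤ k<n) public

    a : Vertex → ℕ
    a v = proj₁ (next v)

    a-next : ∀ v → Next v (a v)
    a-next v = proj₂ (next v)

    a-reach : ∀ {v w} → Reach k v w → a v ≡ a w
    a-reach p = next-unique (next-reach p (a-next _)) (a-next _)

    a-cong : ∀ {v w} → v ≈ w → a v ≡ a w
    a-cong e = a-reach (stop e)

    a-sg : ∀ {v o s} → t v ≡ o ∷ s → sg k v ≡ (o <ᵇ a v)
    a-sg {v} = Next.sign (a-next v) (stop V.refl)

    a-valid : ∀ v → Valid (a v ∷ t v)
    a-valid v = Next.addable (a-next v) ∷ valid v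

  module Top {m} (L : Level (2 + m)) (k<n : 2 + m < n) where
    open Letter L k<n

    private
      k = 2 + m

    tops : ∀ {v} → ∃ λ s → ∃₂ λ q p → t v ≡ q ∷ p ∷ s × length s ≡ m
    tops {v} with t v | len v
    ... | q ∷ p ∷ s | refl = s , q , p , refl , refl

    cons₂-len : ∀ {v q p s} → t v ≡ q ∷ p ∷ s → length s ≡ m
    cons₂-len eq = ℕₚ.suc-injective (ℕₚ.suc-injective (trans (sym (cong length eq)) (len _)))

    -- By `t-fix` only the corners of k - 1 and k are unknown at `w`.
    partner : ∀ {v w q p s} → E k v w → t v ≡ q ∷ p ∷ s → ∃₂ λ q′ p′ → t w ≡ q′ ∷ p′ ∷ s
    partner {v} {w} {s = s} e eq with s′ , q′ , p′ , eq′ , _ ← tops {w} =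
      q′ , p′ , trans eq′ (cong (λ s → q′ ∷ p′ ∷ s) (sym
        (subst₂ (λ x y → drop 2 x ≡ drop 2 y) eq eq′
          (subst (λ i → drop i (t v) ≡ drop i (t w)) (ℕₚ.m+n∸n≡m 2 k) (t-fix e)))))

    sg-last : ∀ {v q p s} → t v ≡ q ∷ p ∷ s → sg (suc m) v ≡ (p <ᵇ q)
    sg-last {v} {q} {p} {s} eq = subst (λ m → sg (suc m) v ≡ (p <ᵇ q)) (cons₂-len eq)
      (proj₁ (subst (Signs v) eq (signs v)))

    sg-second : ∀ {v q p u s} → t v ≡ q ∷ p ∷ u ∷ s → sg m v ≡ (u <ᵇ p)
    sg-second {v} {q} {p} {u} {s} eq = subst (λ m → sg m v ≡ (u <ᵇ p)) (cons₂-len eq)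
      (proj₁ (proj₂ (subst (Signs v) eq (signs v))))

    lift-last : ∀ {v q p u s s′} → t v ≡ q ∷ p ∷ u ∷ s → Step (2 + length s) (q ∷ p ∷ u ∷ s) s′ →
                ∃ λ w → E (suc m) v w × t w ≡ s′
    lift-last eq p = lift-step eq (step-≡ (cong suc (cons₂-len eq)) p)

    distinct : ∀ {v q p s} → t v ≡ q ∷ p ∷ s → p ≢ q × q ≢ a v × p ≢ a v
    distinct {v} {q} {p} {s} eq with A ∷ Q ∷ _ ← subst (λ s → Valid (a v ∷ s)) eq (a-valid v) =
      addable≢removable Q (add-removable p (shape s)) ,
      addable≢removable A (add-removable q (shape (p ∷ s))) ,
      λ { refl → addable≢twice A }

    cases : ∀ {v w q p s} → E k v w → t v ≡ q ∷ p ∷ s → Mid (a v) p q ⊎ Mid p q (a v)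
    cases e eq with p≢q , q≢r , p≢r ← distinct eq =
      mid-cases p≢q q≢r p≢r (trans (sym (a-sg eq)) (trans (edge⇒sg e) (cong not (sg-last eq))))

    edge : ∀ {v q p s} → t v ≡ q ∷ p ∷ s → Mid (a v) p q ⊎ Mid p q (a v) → ∃ (E k v)
    edge eq m = sg⇒edge (s≤s (s≤s z≤n)) k<n
      (trans (a-sg eq) (trans (mid⇒differ m) (cong not (sym (sg-last eq)))))

    no-edge : ∀ {v q p s} → t v ≡ q ∷ p ∷ s → Mid q p (a v) → ¬ ∃ (E k v)
    no-edge {v} eq mid (_ , e) = Boolₚ.not-¬ {sg (suc m) v} refl
      (trans (trans (sg-last eq) (trans (mid⇒same mid) (sym (a-sg eq)))) (edge⇒sg e))

    no-edge′ : ∀ {v q p u s} → t v ≡ q ∷ p ∷ u ∷ s → Mid p u q → ¬ ∃ (E (suc m) v)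
    no-edge′ {v} eq mid (_ , e) = Boolₚ.not-¬ {sg m v} refl
      (trans (trans (sg-second eq) (trans (mid⇒same mid) (sym (sg-last eq)))) (edge⇒sg e))

    -- Moving the letter k - 2 to a corner u between p and q turns the edge at v
    -- into a double edge.
    case-inner : ∀ {v w q p s} → E k v w → t v ≡ q ∷ p ∷ s → Mid (a v) p q →
                 Reach k v w × t w ≡ p ∷ q ∷ s
    case-inner {v} {w} {q} {p} {s} e eq mid
      with V@(Q ∷ (P ∷ vs)) ← subst Valid eq (valid v)
      with Q₀ ← addable-strengthen (far-sym (mid⇒far mid)) Q
      with u , mid-u , U ← removable-mid P Q₀ (proj₂ (proj₂ (mid-≢ mid)))
      with s′ , V′ , e′ , l′ ← remove vs U
      with v₁ , r₁ , eq₁ ← move (q ∷ p ∷ []) eq V′ (sym ∘ e′) (sym l′)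
      with r₁ ← subst (λ m → Reach m v v₁) (cons₂-len eq) r₁
      with w₁ , f , r₂ ← shadow ℕₚ.≤-refl e r₁
      -- With k - 2 at `u`, the color k - 1 exchanges `p` and `q` and leads to `y`. There k + 1 is
      -- still in the middle, so `y` has an edge of color k, and ax4 forces `y` to be the neighbor
      -- `w₁` of `v₁` of color k.
      with y , g , eq₂ ← lift-last eq₁ (swapTop mid-u)
      with r₃ ← path-trans 𝒢 (reach-≤ (ℕₚ.m≤n+m _ 2) r₁) (path-edge 𝒢 ℕₚ.≤-refl g)
      with z , h ← edge eq₂ (subst (λ r → Mid r q p ⊎ Mid q p r) (a-reach r₃) (inj₁ (mid-sym mid)))
      with y≈w₁ ← double-edge (s≤s z≤n) g f h
      with r₄ ← path-sym 𝒢 r₂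
      with q′ , p′ , eq₃ ← partner e eq
      -- The way back to `w` uses only colors below k - 2 and so keeps the letters k - 1 and k.
      with _ , eq₄ ← stable (p ∷ q ∷ []) (trans (sym (t-cong y≈w₁)) eq₂)
             (subst (m ≤_) (sym (trans l′ (cons₂-len eq))) ℕₚ.≤-refl) (ℕₚ.m≤n+m _ 2) r₄
      with refl , refl ← Listₚ.∷-injective (trans (sym eq₃) eq₄) =
      path-trans 𝒢 r₃ (path-resp 𝒢 y≈w₁ (reach-≤ (ℕₚ.m≤n+m _ 2) r₄)) , eq₃

    -- If k + 1 were in the middle at `w`, then `case-inner` from `w` would give `v` the same
    -- position of k + 1 and exchange k - 1 and k, so k + 1 would be in the middle at `v` too.
    case-outer : ∀ {v w q p q′ p′ s} → E k v w → t v ≡ q ∷ p ∷ s → t w ≡ q′ ∷ p′ ∷ s → Mid p q (a v) →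
                 Mid p′ q′ (a w)
    case-outer e eq eq′ mid with cases (E-sym e) eq′
    ... | inj₂ mid′ = mid′
    ... | inj₁ mid′ with r , eq″ ← case-inner (E-sym e) eq′ mid′
      with refl ← trans (sym eq) eq″ =
      contradiction mid (mid-excl (subst (λ r → Mid r _ _) (a-reach r) (mid-sym mid′)))

    -- A double edge would act as a move of color k - 1 keeping k - 2 at `u`. It would either
    -- exchange `p` and `q`, so that each lies between the other and `r`, or change neither, against
    -- the flip of the sign.
    not-double : ∀ {i q p u q′ p′ s r} → i ≡ 2 + length s → Step i (q ∷ p ∷ u ∷ s) (q′ ∷ p′ ∷ u ∷ s) →
                 (p′ <ᵇ q′) ≡ not (p <ᵇ q) → Mid p q r → Mid p′ q′ r → ⊥
    not-double _ (swapLow _) f _ _ = Boolₚ.not-¬ refl f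
    not-double _ (swapTop _) _ m m′ = mid-excl m′ (mid-sym m)
    not-double eq (later p) _ _ _ = ℕₚ.<-irrefl eq (step-< p)

    -- By ax4 at k exactly one endpoint of the edge has a neighbour of color
    -- k - 1, whichever corner u is occupied by the letter k - 2.
    second-fixed : ∀ {v w q p q′ p′ s} → E k v w → t v ≡ q ∷ p ∷ s → t w ≡ q′ ∷ p′ ∷ s → Mid p q (a v) →
                   p ≡ p′
    second-fixed {v} {w} {q} {p} {q′} {p′} {s} e eq eq′ mid
      with _ ∷ V@(P ∷ vs) ← subst Valid eq (valid v)
      -- `p` and `p′` are addable to the same shape, that of `s`, so comparing both with every
      -- removable corner of `s` is enough.
      with _ ∷ (P′ ∷ _) ← subst Valid eq′ (valid w) = addable-unique P P′ same
      where
      same : ∀ u → Removable (shape s) u → (u <ᵇ p) ≡ (u <ᵇ p′)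
      same u U
        with s′ , V′ , e′ , l′ ← remove vs U
        with v₁ , r₁ , eq₁ ← move (q ∷ p ∷ []) eq V′ (sym ∘ e′) (sym l′)
        with r₁ ← subst (λ m → Reach m v v₁) (cons₂-len eq) r₁
        with w₁ , f , r₂ ← shadow ℕₚ.≤-refl e r₁
        with q″ , p″ , eq₂ ← partner f eq₁
        with _ , eq₃ ← stable (q′ ∷ p′ ∷ []) eq′ (ℕₚ.≤-reflexive (sym (cons₂-len eq′))) (ℕₚ.m≤n+m _ 2) r₂
        with refl ← trans (sym eq₂) eq₃
        with m≡ ← trans (sym (cons₂-len eq)) (sym l′)
        -- A removable corner makes `s` nonempty, hence k - 1 is large enough to be a color.
        with 1<m ← s≤s (subst (1 ≤_) (sym m≡) (s≤s z≤n))
        with exclusive (s≤s 1<m) f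
      ... | inj₁ g = ⊥-elim (not-double (cong suc m≡)
              (subst₂ (Step _) eq₁ eq₂ (t-step g ℕₚ.≤-refl))
              (subst₂ (λ x y → x ≡ not y) (sg-last eq₂) (sg-last eq₁) (sg-flip′ f)) mid
              (subst (Mid p′ q′) (trans (a-reach (reach-≤ (ℕₚ.m≤n+m _ 2) r₂))
                (trans (sym (a-reach (path-edge 𝒢 ℕₚ.≤-refl g)))
                  (sym (a-reach (reach-≤ (ℕₚ.m≤n+m _ 2) r₁))))) (case-outer e eq eq′ mid)))
      ... | inj₂ (inj₁ ((_ , g) , none)) = begin
            (u <ᵇ p)       ≡⟨ not-swap (subst₂ (λ x y → x ≡ not y) (sg-last eq₁) (sg-second eq₁) (edge⇒sg g)) ⟩
            not (p <ᵇ q)   ≡⟨ sym (subst₂ (λ x y → x ≡ not y) (sg-last eq₂) (sg-last eq₁) (sg-flip′ f)) ⟩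
            (p′ <ᵇ q′)     ≡⟨ subst₂ _≡_ (sg-last eq₂) (sg-second eq₂) (≢-not λ h → none (sg⇒edge 1<m (ℕₚ.<⇒≤ k<n) h)) ⟩
            (u <ᵇ p′)      ∎
        where open ≡-Reasoning
      ... | inj₂ (inj₂ (none , (_ , g))) = begin
            (u <ᵇ p)       ≡⟨ subst₂ _≡_ (sg-second eq₁) (sg-last eq₁) (sym (≢-not λ h → none (sg⇒edge 1<m (ℕₚ.<⇒≤ k<n) h))) ⟩
            (p <ᵇ q)       ≡⟨ not-swap (subst₂ (λ x y → x ≡ not y) (sg-last eq₂) (sg-last eq₁) (sg-flip′ f)) ⟩
            not (p′ <ᵇ q′) ≡⟨ sym (not-swap (subst₂ (λ x y → x ≡ not y) (sg-last eq₂) (sg-second eq₂) (edge⇒sg g))) ⟩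
            (u <ᵇ p′)      ∎
        where open ≡-Reasoning

    outer-partner : ∀ {v w q p s} → E k v w → t v ≡ q ∷ p ∷ s → Mid p q (a v) →
                    ∃ λ q′ → t w ≡ q′ ∷ p ∷ s × Mid p q′ (a w)
    outer-partner e eq mid with q′ , p′ , eq′ ← partner e eq
      with refl ← second-fixed e eq eq′ mid = q′ , eq′ , case-outer e eq eq′ mid

    module Outer {v w q p q′ s} (e : E k v w) (eq : t v ≡ q ∷ p ∷ s) (eq′ : t w ≡ q′ ∷ p ∷ s)
                 (mid : Mid p q (a v)) (mid′ : Mid p q′ (a w)) where

      flip : (p <ᵇ q′) ≡ not (p <ᵇ q)
      flip = subst₂ (λ x y → x ≡ not y) (sg-last eq′) (sg-last eq) (sg-flip′ e)

      opaque
        -- Puts k - 2 at `o` and k - 3 at a corner `u` between `p` and `o`, at both ends of the edge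
        -- simultaneously by `shadow`. The color k - 2 then exchanges `p` and `o`.
        setup : ∀ {o} → Removable (shape (p ∷ s)) o → o ≢ p →
                ∃₂ λ u s₂ → ∃₂ λ v₁ w₁ → Mid u p o × a v₁ ≡ a v × a w₁ ≡ a w × E k v₁ w₁ ×
                t v₁ ≡ q ∷ p ∷ o ∷ u ∷ s₂ × t w₁ ≡ q′ ∷ p ∷ o ∷ u ∷ s₂
        setup {o} R o≢p
          with _ ∷ (P ∷ vs) ← subst Valid eq (valid v)
          with f ← removable-far R (add-removable p (shape s)) o≢p
          with s₁ , x₁ ∷ v₁ , e₁ , l₁ ← remove vs (removable-strengthen f R)
          with P₁ ← addable-strengthen (far-sym f) (addable-resp (sym ∘ e₁) P)
          with u , m-u , U ← removable-mid P₁ x₁ (o≢p ∘ sym)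
          with s₂ , v₂ , e₂ , l₂ ← remove v₁ U
          with v′ , r₁ , eq₁ ← move (q ∷ p ∷ []) eq (addable-resp (sym ∘ e₂) x₁ ∷ v₂)
                 (λ j → sym (trans (add-cong o e₂ j) (e₁ j))) (sym (trans (cong suc l₂) l₁))
          with r₁ ← subst (λ m → Reach m v v′) (cons₂-len eq) r₁
          with w′ , g , r₂ ← shadow ℕₚ.≤-refl e r₁
          with q″ , p″ , eq₂ ← partner g eq₁
          with _ , eq₃ ← stable (q′ ∷ p ∷ []) eq′ (ℕₚ.≤-reflexive (sym (cons₂-len eq′))) (ℕₚ.m≤n+m _ 2) r₂
          with refl ← trans (sym eq₂) eq₃ =
          u , s₂ , v′ , w′ , m-u , sym (a-reach (reach-≤ (ℕₚ.m≤n+m _ 2) r₁)) ,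
          sym (a-reach (reach-≤ (ℕₚ.m≤n+m _ 2) r₂)) , g , eq₁ , eq₂

      swap-third : ∀ {x q p o u s} → t x ≡ q ∷ p ∷ o ∷ u ∷ s → Mid u p o →
                   ∃ λ y → E m x y × t y ≡ q ∷ o ∷ p ∷ u ∷ s
      swap-third eq mid = lift-step eq (step-≡ (cons₂-len eq) (later (swapTop (mid-sym mid))))

      head-fixed : ∀ {x y q q′ p s s′} → E m x y → t x ≡ q ∷ p ∷ s → t y ≡ q′ ∷ s′ → q′ ≡ q
      head-fixed e eq eq′ with _ , eq″ ← stable (_ ∷ []) eq (ℕₚ.≤-reflexive (cong suc (sym (cons₂-len eq))))
                                 (ℕₚ.n≤1+n _) (path-edge 𝒢 ℕₚ.≤-refl e) =
        Listₚ.∷-injectiveˡ (trans (sym eq′) eq″)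

      module _ {o} (R : Removable (shape (p ∷ s)) o) where

        -- In these two lemmas the square of ax4 for the colors k - 2 and k
        -- exchanges o and p at both ends of the edge.
        opaque
          separates : Mid o p (a v) → Mid o p q′
          separates mid-o
            with u , s₂ , v₁ , w₁ , m-u , av , aw , f , eq₁ , eq₂ ← setup R (proj₁ (mid-≢ mid-o) ∘ sym)
            with v₂ , g , eq₃ ← swap-third eq₁ m-u
            with y , h , eq₄ ← lift-last eq₃ (swapTop (mid-sym (mid-first mid mid-o)))
            with av₂ ← trans (sym (a-reach (path-edge 𝒢 (ℕₚ.n≤1+n _) g))) av
            with ay ← trans (sym (a-reach (path-edge 𝒢 ℕₚ.≤-refl h))) av₂
            with mid-v₂ ← mid-second mid mid-o
            -- The first alternative fails as k - 1 lies between k - 2 and k at `v₁`, the second as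
            -- k lies between k - 1 and k + 1 at `y`. In the third, `v₂` and `z` carry k - 1 at `o`,
            -- so `outer-partner` puts `o` between k and k + 1 at `z`; these are where they are at
            -- `w`.
            with square g f h
          ... | inj₁ f′ = contradiction f′ (no-edge′ eq₁ (mid-sym (mid-first mid mid-o)))
          ... | inj₂ (inj₁ f′) = contradiction f′ (no-edge eq₄ (subst (Mid o q) (sym ay) mid-v₂))
          ... | inj₂ (inj₂ (z , f′ , g′))
            with q″ , eq₅ , mid-z ← outer-partner f′ eq₃ (subst (Mid o q) (sym av₂) mid-v₂)
            with refl ← head-fixed g′ eq₂ eq₅ =
            mid-transfer flip mid mid-o mid′
              (subst (Mid o q′) (trans (sym (a-reach (path-edge 𝒢 (ℕₚ.n≤1+n _) g′))) aw) mid-z)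

          separates⁻ : Mid o p q′ → Mid o p (a v)
          separates⁻ mid-o
            with u , s₂ , v₁ , w₁ , m-u , av , aw , f , eq₁ , eq₂ ← setup R (proj₁ (mid-≢ mid-o) ∘ sym)
            with w₂ , g , eq₃ ← swap-third eq₂ m-u
            with w₃ , h , eq₄ ← lift-last eq₂ (swapTop mid-o)
            with aw₂ ← trans (sym (a-reach (path-edge 𝒢 (ℕₚ.n≤1+n _) g))) aw
            with aw₃ ← trans (sym (a-reach (path-edge 𝒢 ℕₚ.≤-refl h))) aw
            with mid-w₂ ← subst (Mid o q′) (sym aw₂) (mid-sym (mid-second (mid-sym mid′) mid-o))
            with z , f′ ← edge eq₃ (inj₂ mid-w₂)
            with square (E-sym g) f′ h
          ... | inj₁ g′ = contradiction g′ (no-edge′ eq₃ mid-o)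
          ... | inj₂ (inj₁ g′) = contradiction g′ (no-edge eq₄ (subst (Mid p q′) (sym aw₃) mid′))
          ... | inj₂ (inj₂ (z′ , f″ , g′))
            -- The fourth vertex of the square is the neighbor of `w₁` of color k, which is `v₁`.
            with g″ ← E-resp (ax1-unique f″ (E-sym f)) V.refl (E-sym g′)
            with q″ , eq₅ , mid-z ← outer-partner f′ eq₃ mid-w₂
            with refl ← head-fixed g″ eq₁ eq₅ =
            mid-transfer flip′ (mid-sym mid′) mid-o (mid-sym mid)
              (mid-sym (subst (Mid o q) (trans (sym (a-reach (path-edge 𝒢 (ℕₚ.n≤1+n _) g″))) av) mid-z))
            where
            flip′ : (p <ᵇ a v) ≡ not (p <ᵇ a w)
            flip′ = begin
              (p <ᵇ a v)        ≡⟨ sym (mid⇒same mid) ⟩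
              (q <ᵇ p)          ≡⟨ <ᵇ-asym (proj₁ (mid-≢ mid) ∘ sym) ⟩
              not (p <ᵇ q)      ≡⟨ sym flip ⟩
              (p <ᵇ q′)         ≡⟨ <ᵇ-asym (proj₁ (mid-≢ mid′)) ⟩
              not (q′ <ᵇ p)     ≡⟨ cong not (mid⇒same mid′) ⟩
              not (p <ᵇ a w)    ∎
              where open ≡-Reasoning

      -- Both are addable to the shape of `p ∷ s`: `q′` as the next letter at `w`, and `a v` because
      -- it is far from `q`. No removable corner of that shape separates them.
      exchange : q′ ≡ a v
      exchange
        with Q′ ∷ _ ← subst Valid eq′ (valid w)
        with A ∷ _ ← subst (λ s → Valid (a v ∷ s)) eq (a-valid v)
        with A ← addable-strengthen (far-sym (mid⇒far mid)) A =
        addable-unique Q′ A λ o R →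
          separate flip mid mid′ (separates R) (separates⁻ R) (addable≢removable Q′ R) (addable≢removable A R)

    -- The alternative in the first component prepares the use of ax6: an edge of color k stays
    -- within the component for smaller colors or moves the letter k + 1.
    top-edge : ∀ {v w} → E k v w → (Reach k v w ⊎ a v ≢ a w) × Step k (a v ∷ t v) (a w ∷ t w)
    top-edge {v} {w} e with s , q , p , eq , l ← tops {v} with cases e eq
    ... | inj₁ mid with r , eq′ ← case-inner e eq mid =
      inj₁ r , subst₂ (Step k) (cong (a v ∷_) (sym eq)) (cong₂ _∷_ (a-reach r) (sym eq′))
        (step-≡ (cong (2 +_) l) (swapLow mid))
    ... | inj₂ mid with q′ , eq′ , mid′ ← outer-partner e eq mid
      with refl ← Outer.exchange e eq eq′ mid mid′
      with q≡ ← Outer.exchange (E-sym e) eq′ eq mid′ mid =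
      inj₂ (λ h → proj₂ (proj₂ (mid-≢ mid)) (trans q≡ (sym h))) ,
      subst₂ (Step k) (cong (a v ∷_) (sym eq)) (cong₂ _∷_ q≡ (sym eq′))
        (step-≡ (cong (2 +_) l) (swapTop mid))

-- Passing from k to k + 1 letters

module _ {n N} (𝒢 : SignedColoredGraph n N) where
  open SignedColoredGraph 𝒢
  private module V = Setoid vertices

  uncrossed : ∀ {k v w} (p : Path 𝒢 (Between 2 k) v w) → crossings 𝒢 k p ≤ 0 → Path 𝒢 (_< k) v w
  uncrossed (stop e) _ = stop e
  uncrossed {k} (step i (_ , i≤k) e p) c with i ≟ k
  ... | yes refl = contradiction (subst (_≤ 0) (cong (λ b → (if b then 1 else 0) + crossings 𝒢 k p) (dec-true (k ≟ k) refl)) c) λ ()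
  ... | no i≢k = step i (ℕₚ.≤∧≢⇒< i≤k i≢k) e (uncrossed p
    (subst (_≤ 0) (cong (λ b → (if b then 1 else 0) + crossings 𝒢 k p) (dec-false (i ≟ k) i≢k)) c))

  crossed-once : ∀ {k v w} (p : Path 𝒢 (Between 2 k) v w) → crossings 𝒢 k p ≤ 1 →
                 Path 𝒢 (_< k) v w ⊎
                 ∃₂ λ x y → Path 𝒢 (_< k) v x × E k x y × Path 𝒢 (_< k) y w
  crossed-once (stop e) _ = inj₁ (stop e)
  crossed-once {k} (step i (_ , i≤k) e p) c with i ≟ k
  ... | yes refl = inj₂ (_ , _ , stop V.refl , e , uncrossed p
    (ℕₚ.≤-pred (subst (_≤ 1) (cong (λ b → (if b then 1 else 0) + crossings 𝒢 k p) (dec-true (k ≟ k) refl)) c)))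
  ... | no i≢k with crossed-once p
    (subst (_≤ 1) (cong (λ b → (if b then 1 else 0) + crossings 𝒢 k p) (dec-false (i ≟ k) i≢k)) c)
  ...   | inj₁ q = inj₁ (step i (ℕₚ.≤∧≢⇒< i≤k i≢k) e q)
  ...   | inj₂ (x , y , q , f , r) = inj₂ (x , y , step i (ℕₚ.≤∧≢⇒< i≤k i≢k) e q , f , r)

module Tower {n} (𝒢 : SignedColoredGraph n n) (deg : IsDualEquivalenceGraph 𝒢) where
  open SignedColoredGraph 𝒢
  open Axioms 𝒢 deg
  open Maya n
  open Steps n
  open Levels 𝒢 deg
  open Extend 𝒢 deg

  base : Level 0
  base = record
    { t      = λ _ → []
    ; len    = λ _ → refl
    ; valid  = λ _ → []
    ; t-cong = λ _ → refl
    ; signs  = λ _ → tt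
    ; t-step = λ _ ()
    ; t-fix  = λ _ → refl
    ; t-inj  = λ { (stop e) _ → e ; (step _ () _ _) _ }
    }

  top-edge : ∀ {k} (L : Level k) (k<n : k < n) → ∀ {v w} → E k v w →
             (Reach k v w ⊎ Letter.a L k<n v ≢ Letter.a L k<n w) ×
             Step k (Letter.a L k<n v ∷ Level.t L v) (Letter.a L k<n w ∷ Level.t L w)
  top-edge {zero} L k<n e = contradiction (proj₁ (E-color e)) λ ()
  top-edge {suc zero} L k<n e = contradiction (proj₁ (E-color e)) λ { (s≤s ()) }
  top-edge {suc (suc m)} L k<n e = Top.top-edge L k<n e

  module _ {k} (L : Level k) (k<n : k < n) where
    open Letter L k<n

    private
      a-signs : ∀ {v s} → t v ≡ s → Signs v (a v ∷ s)
      a-signs {s = []} _ = tt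
      a-signs {v} {o ∷ s} eq =
        subst (λ k → sg k v ≡ (o <ᵇ a v)) (sym (cons-len eq)) (a-sg eq) , subst (Signs v) eq (signs v)

      a-step : ∀ {i v w} → E i v w → i < suc k → Step i (a v ∷ t v) (a w ∷ t w)
      a-step {i} e l with i ≟ k
      ... | yes refl = proj₂ (top-edge L k<n e)
      ... | no i≢k with i<k ← ℕₚ.≤∧≢⇒< (ℕₚ.≤-pred l) i≢k =
        subst (λ x → Step i _ (x ∷ _)) (a-reach (path-edge 𝒢 i<k e)) (later (t-step e i<k))

      t-fixed : ∀ {i v w} → 3 + k ≤ i → E i v w → t v ≡ t w
      t-fixed {i} {v} {w} l e = subst (λ d → drop d (t v) ≡ drop d (t w))
        (ℕₚ.m≤n⇒m∸n≡0 (ℕₚ.≤-trans (ℕₚ.n≤1+n _) l)) (t-fix e)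

      -- An edge of color at least k + 3 can be carried to every vertex reachable by colors less
      -- than k and leaves the sign at k there unchanged, so both ends see the same signs at all
      -- removable corners.
      a-fixed : ∀ {i v w} → 3 + k ≤ i → E i v w → a v ≡ a w
      a-fixed {i} {v} {w} l e = addable-unique (Next.addable (a-next v))
        (subst (λ s → Addable (shape s) (a w)) (sym (t-fixed l e)) (Next.addable (a-next w)))
        λ u R → same (reach-top R)
        where
        same : ∀ {u} → ∃₂ (λ v′ s → Reach k v v′ × t v′ ≡ u ∷ s) → (u <ᵇ a v) ≡ (u <ᵇ a w)
        same (v′ , s , p , eq) with w′ , f , q ← shadow (ℕₚ.≤-trans (ℕₚ.n≤1+n _) l) e p =
          trans (sym (Next.sign (a-next v) p eq)) (trans (sg-fix k f (inj₁ l))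
            (Next.sign (a-next w) q (trans (sym (t-fixed l f)) eq)))

      a-fix : ∀ {i v w} → E i v w → drop (3 + k ∸ i) (a v ∷ t v) ≡ drop (3 + k ∸ i) (a w ∷ t w)
      a-fix {i} {v} {w} e with 3 + k ≤? i
      ... | yes l = cong (drop (3 + k ∸ i)) (cong₂ _∷_ (a-fixed l e) (t-fixed l e))
      -- Here `3 + k ∸ i` is a successor, so the new letter is dropped.
      ... | no ¬l rewrite ℕₚ.+-∸-assoc 1 (ℕₚ.≤-pred (ℕₚ.≰⇒> ¬l)) = t-fix e

      -- By ax6 color k is crossed at most once. A crossing that moves k + 1 is impossible: `a` is
      -- constant before and after it, and equal at `v` and `w`.
      a-inj : ∀ {v w} → Reach (suc k) v w → a v ∷ t v ≡ a w ∷ t w → v ≈ w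
      a-inj {v} {w} p eq with 1 <? k
      ... | no k≤1 = t-inj (path-map 𝒢 (λ 1<i _ i≤k → contradiction (ℕₚ.<-≤-trans 1<i (ℕₚ.≤-pred i≤k)) k≤1) p)
                       (Listₚ.∷-injectiveʳ eq)
      ... | yes 1<k with q , c ← ax6 1<k k<n (path-map 𝒢 (λ 1<i _ i≤k → 1<i , ℕₚ.≤-pred i≤k) p)
        with crossed-once 𝒢 q c
      ...   | inj₁ r = t-inj r (Listₚ.∷-injectiveʳ eq)
      ...   | inj₂ (x , y , r , e , r′) with proj₁ (top-edge L k<n e)
      ...     | inj₁ r″ = t-inj (path-trans 𝒢 r (path-trans 𝒢 r″ r′)) (Listₚ.∷-injectiveʳ eq)
      ...     | inj₂ a≢a = contradiction
                  (trans (sym (a-reach r)) (trans (Listₚ.∷-injectiveˡ eq) (sym (a-reach r′)))) a≢a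

    extend : Level (suc k)
    extend = record
      { t      = λ v → a v ∷ t v
      ; len    = λ v → cong suc (len v)
      ; valid  = a-valid
      ; t-cong = λ e → cong₂ _∷_ (a-cong e) (t-cong e)
      ; signs  = λ v → a-signs refl
      ; t-step = a-step
      ; t-fix  = a-fix
      ; t-inj  = a-inj
      }

  level : ∀ k → k ≤ n → Level k
  level zero    _ = base
  level (suc k) l = extend (level k (ℕₚ.<⇒≤ l)) l

  -- `f w p k` is the position of the letter k + 1 in a rival labelling of the component. The
  -- hypotheses hold for the labelling induced by any isomorphism; by induction on k they turn
  -- `f w p k` into a solution of `Next`, which has only one.
  module Uniqueness (v₀ : Vertex) (f : ∀ w → Reach n v₀ w → ℕ → ℕ) where

    prefix : ∀ {w} → Reach n v₀ w → ℕ → List ℕ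
    prefix p = listing (f _ p)

    module _ (f-valid : ∀ {w} (p : Reach n v₀ w) → Valid (prefix p n))
             (f-sg : ∀ {w} (p : Reach n v₀ w) {k} → suc k < n → sg (suc k) w ≡ (f w p k <ᵇ f w p (suc k)))
             (f-cong : ∀ {w x} (p : Reach n v₀ w) (q : Reach n v₀ x) → w ≈ x → ∀ {k} → k < n → f w p k ≡ f x q k)
             (f-fix : ∀ {i w x} (p : Reach n v₀ w) (q : Reach n v₀ x) {k} → k < n → i < k → E i w x →
                      f w p k ≡ f x q k)
             where

      prefix-valid : ∀ {w} (p : Reach n v₀ w) d k → d + k ≡ n → Valid (prefix p k)
      prefix-valid p zero    k refl = f-valid p
      prefix-valid p (suc d) k eq with _ ∷ V ← prefix-valid p d (suc k) (trans (ℕₚ.+-suc d k) eq) = V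

      f-reach : ∀ {w x} (p : Reach n v₀ w) (q : Reach n v₀ x) {k} → k < n → Reach k w x → f w p k ≡ f x q k
      f-reach p q l (stop e) = f-cong p q e l
      f-reach p q l (step i i<k e r) = trans (f-fix p p′ l i<k e) (f-reach p′ q l r)
        where p′ = path-trans 𝒢 p (path-edge 𝒢 (ℕₚ.<-trans i<k l) e)

      unique : ∀ k (l : k ≤ n) {w} (p : Reach n v₀ w) → Level.t (level k l) w ≡ prefix p k
      unique zero l p = refl
      unique (suc k) l {w} p = cong₂ _∷_ (next-unique (a-next w) next′) (unique k _ p)
        where
        open Letter (level k (ℕₚ.<⇒≤ l)) l

        sign′ : ∀ {x} (q : Reach n v₀ x) {o s} → Reach k w x → prefix q k ≡ o ∷ s →
                ∀ k′ → k ≡ suc k′ → sg k x ≡ (o <ᵇ f w p k)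
        sign′ q r refl k′ refl = trans (f-sg q l) (cong (f _ q k′ <ᵇ_) (sym (f-reach p q l r)))

        next′ : Next w (f w p k)
        next′ = record
          { addable = subst (λ s → Addable (shape s) (f w p k)) (sym (unique k _ p))
              (case prefix-valid p (n ∸ suc k) (suc k) (ℕₚ.m∸n+n≡m l) of λ { (A ∷ _) → A })
          ; sign    = λ r eq →
              let q = path-trans 𝒢 p (reach-≤ (ℕₚ.<⇒≤ l) r)
              in sign′ q r (trans (sym (unique k _ q)) eq) _ (sym (cons-len eq))
          }

open Partition

-- Standard tableaux and their codes

row : List ℕ → ℕ → ℕ
row []      _       = 0
row (x ∷ l) zero    = x
row (x ∷ l) (suc r) = row l r

row-lookup : ∀ l (r : Fin (length l)) → row l (toℕ r) ≡ lookup l r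
row-lookup (x ∷ l) Fin.zero    = refl
row-lookup (x ∷ l) (Fin.suc r) = row-lookup l r

row-< : ∀ l {r c} → c < row l r → r < length l
row-< []      ()
row-< (x ∷ l) {zero}  p = s≤s z≤n
row-< (x ∷ l) {suc r} p = s≤s (row-< l p)

row-zero : ∀ l {r} → length l ≤ r → row l r ≡ 0
row-zero []      _       = refl
row-zero (x ∷ l) (s≤s p) = row-zero l p

row-injective : ∀ {l l′} → All (0 <_) l → All (0 <_) l′ → (∀ r → row l r ≡ row l′ r) → l ≡ l′
row-injective []      []       e = refl
row-injective []      (p ∷ _)  e = contradiction (e 0) (ℕₚ.<⇒≢ p)
row-injective (p ∷ _) []       e = contradiction (sym (e 0)) (ℕₚ.<⇒≢ p)
row-injective (_ ∷ P) (_ ∷ P′) e = cong₂ _∷_ (e 0) (row-injective P P′ (e ∘ suc))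

length≤sum : ∀ {l} → All (0 <_) l → length l ≤ sum l
length≤sum []      = z≤n
length≤sum (p ∷ P) = ℕₚ.+-mono-≤ p (length≤sum P)

Decreasing : (ℕ → ℕ) → Set
Decreasing ρ = ∀ {r r′} → r ≤ r′ → ρ r′ ≤ ρ r

linked⇒decreasing : ∀ {l} → Linked _≥_ l → Decreasing (row l)
linked⇒decreasing []  _ = z≤n
linked⇒decreasing [-] {zero}  {zero}   _ = ℕₚ.≤-refl
linked⇒decreasing [-] {zero}  {suc _}  _ = z≤n
linked⇒decreasing [-] {suc _} {suc _}  _ = z≤n
linked⇒decreasing (x ∷ L) {zero}  {zero}   _ = ℕₚ.≤-refl
linked⇒decreasing (x ∷ L) {zero}  {suc r′} _ = ℕₚ.≤-trans (linked⇒decreasing L {0} {r′} z≤n) x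
linked⇒decreasing (x ∷ L) {suc r} {suc r′} (s≤s p) = linked⇒decreasing L p

decreasing⇒linked : ∀ {l} → Decreasing (row l) → Linked _≥_ l
decreasing⇒linked {[]}        d = []
decreasing⇒linked {x ∷ []}    d = [-]
decreasing⇒linked {x ∷ y ∷ l} d = d {0} {1} z≤n ∷ decreasing⇒linked (d ∘ s≤s)

-- Row lengths and boundary paths

module Outline (n : ℕ) where
  open Maya n

  -- The row r, of length ρ r, ends with the vertical step at ρ r + n ∸ r.
  record Outlines (ρ : ℕ → ℕ) (b : Shape) : Set where
    field
      rowOf : ∀ {j} → b j ≡ true → ∃ λ r → ρ r + n ≡ j + r
      endOf : ∀ {j r} → ρ r + n ≡ j + r → b j ≡ true

  open Outlines

  empty-outline : ∀ {ρ} → (∀ r → ρ r ≡ 0) → Outlines ρ (shape [])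
  empty-outline {ρ} z = record
    { rowOf = λ {j} e → n ∸ j , trans (cong (_+ n) (z _)) (sym (ℕₚ.m+[n∸m]≡n (le {j} e)))
    ; endOf = λ {j} {r} e → ≤ᵇ-true (ℕₚ.≤-trans (ℕₚ.m≤m+n j r) (ℕₚ.≤-reflexive (sym (trans (cong (_+ n) (sym (z r))) e))))
    }
    where
    le : ∀ {j} → (j ≤ᵇ n) ≡ true → j ≤ n
    le {j} e with j ≤? n
    ... | yes l = l
    ... | no ¬l = clash e (≤ᵇ-false ¬l)

  module _ {ρ} (dec : Decreasing ρ) where

    end-< : ∀ {j j′ r r′} → ρ r + n ≡ j + r → ρ r′ + n ≡ j′ + r′ → r < r′ → j′ < j
    end-< {j} {j′} {r} {r′} e e′ l = ℕₚ.+-cancelʳ-< r j′ j (begin-strict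
      j′ + r   <⟨ ℕₚ.+-monoʳ-< j′ l ⟩
      j′ + r′  ≡⟨ sym e′ ⟩
      ρ r′ + n ≤⟨ ℕₚ.+-monoˡ-≤ n (dec (ℕₚ.<⇒≤ l)) ⟩
      ρ r + n  ≡⟨ e ⟩
      j + r    ∎)
      where open ℕₚ.≤-Reasoning

    end-injective : ∀ {j r r′} → ρ r + n ≡ j + r → ρ r′ + n ≡ j + r′ → r ≡ r′
    end-injective {r = r} {r′} e e′ with ℕₚ.<-cmp r r′
    ... | tri< l _ _ = contradiction (end-< e e′ l) (ℕₚ.<-irrefl refl)
    ... | tri≈ _ p _ = p
    ... | tri> _ _ l = contradiction (end-< e′ e l) (ℕₚ.<-irrefl refl)

  Corner : (ℕ → ℕ) → ℕ → Set
  Corner ρ r = ∀ {r′} → r′ < r → ρ r < ρ r′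

  corner⇒addable : ∀ {ρ b a r} → Decreasing ρ → Outlines ρ b → ρ r + n ≡ a + r → Corner ρ r → Addable b a
  corner⇒addable {ρ} {b} {a} {r} dec O e corner = endOf O e , Boolₚ.¬-not after
    where
    after : b (suc a) ≢ true
    after t with r′ , e′ ← rowOf O t with ℕₚ.<-cmp r r′
    ... | tri< l _ _ = ℕₚ.<-asym (end-< dec e e′ l) (ℕₚ.n<1+n a)
    ... | tri≈ _ refl _ = ℕₚ.1+n≢n (ℕₚ.+-cancelʳ-≡ r (suc a) a (trans (sym e′) e))
    ... | tri> _ _ l = ℕₚ.<-irrefl refl (ℕₚ.<-≤-trans l (ℕₚ.≤-pred (ℕₚ.+-cancelˡ-< a r (suc r′)
      (subst₂ _<_ e (trans e′ (sym (ℕₚ.+-suc a r′))) (ℕₚ.+-monoˡ-< n (corner l))))))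

  addable⇒corner : ∀ {ρ b a} → Decreasing ρ → Outlines ρ b → Addable b a →
                   ∃ λ r → ρ r + n ≡ a + r × Corner ρ r
  addable⇒corner {ρ} {b} {a} dec O (t , f) with r , e ← rowOf O t = r , e , corner r e
    where
    corner : ∀ r → ρ r + n ≡ a + r → Corner ρ r
    corner (suc r) e {r′} (s≤s l) with ρ (suc r) ≟ ρ r
    ... | yes eq = clash (endOf O {r = r} (trans (cong (_+ n) (sym eq)) (trans e (ℕₚ.+-suc a r)))) f
    ... | no neq = ℕₚ.<-≤-trans (ℕₚ.≤∧≢⇒< (dec (ℕₚ.n≤1+n r)) neq) (dec l)

  grow-outline : ∀ {ρ ρ′ b a r} → Decreasing ρ → Outlines ρ b → ρ r + n ≡ a + r →
                 ρ′ r ≡ suc (ρ r) → (∀ {r′} → r′ ≢ r → ρ′ r′ ≡ ρ r′) → Outlines ρ′ (add a b)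
  grow-outline {ρ} {ρ′} {b} {a} {r} dec O e new old = record { rowOf = rowOf′ _ ; endOf = endOf′ }
    where
    end : ρ′ r + n ≡ suc a + r
    end = trans (cong (_+ n) new) (cong suc e)

    rowOf′ : ∀ j → add a b j ≡ true → ∃ λ r → ρ′ r + n ≡ j + r
    rowOf′ = add-cases a b (λ j x → x ≡ true → ∃ λ r → ρ′ r + n ≡ j + r) (λ ()) (λ _ → r , end)
      λ j j≢a j≢sa t → case rowOf O t of λ { (r′ , e′) → r′ ,
        trans (cong (_+ n) (old λ { refl → j≢a (ℕₚ.+-cancelʳ-≡ r j a (trans (sym e′) e)) })) e′ }

    endOf′ : ∀ {j r′} → ρ′ r′ + n ≡ j + r′ → add a b j ≡ true
    endOf′ {j} {r′} e′ with r′ ≟ r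
    ... | yes refl with refl ← ℕₚ.+-cancelʳ-≡ r (suc a) j (trans (sym end) e′) = add-next a b
    ... | no r′≢r with e″ ← trans (cong (_+ n) (sym (old r′≢r))) e′ =
      add-cases a b (λ j x → ρ r′ + n ≡ j + r′ → x ≡ true)
        (λ e″ → contradiction (end-injective dec e″ e) r′≢r) (λ _ → refl)
        (λ _ _ _ → endOf O) j e″

  -- At the first row where the lengths differ, the end of the longer row would have to end a row of
  -- the other diagram. Lower rows agree and end elsewhere; this row and the higher ones end too far
  -- left. The bound `r ≤ n` keeps the end at a natural position.
  outline-unique : ∀ {ρ ρ′ b b′} → Decreasing ρ → Decreasing ρ′ → Outlines ρ b → Outlines ρ′ b′ →
                   b ≐ b′ → ∀ r → r ≤ n → ρ r ≡ ρ′ r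
  outline-unique {ρ} {ρ′} dec dec′ O O′ b≐b′ = <-rec (λ r → r ≤ n → ρ r ≡ ρ′ r) λ r IH r≤n →
    ℕₚ.≤-antisym
      (ℕₚ.≮⇒≥ (no-gap dec dec′ O O′ b≐b′ r r≤n (λ l → sym (IH l (ℕₚ.≤-trans (ℕₚ.<⇒≤ l) r≤n)))))
      (ℕₚ.≮⇒≥ (no-gap dec′ dec O′ O (sym ∘ b≐b′) r r≤n (λ l → IH l (ℕₚ.≤-trans (ℕₚ.<⇒≤ l) r≤n))))
    where
    no-gap : ∀ {ρ ρ′ b b′} → Decreasing ρ → Decreasing ρ′ → Outlines ρ b → Outlines ρ′ b′ → b ≐ b′ →
             ∀ r → r ≤ n → (∀ {r′} → r′ < r → ρ′ r′ ≡ ρ r′) → ¬ ρ′ r < ρ r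
    no-gap {ρ} {ρ′} dec dec′ O O′ e r r≤n same l
      with eq ← sym (ℕₚ.m∸n+n≡m (ℕₚ.≤-trans r≤n (ℕₚ.m≤n+m n (ρ r))))
      with r″ , eq″ ← rowOf O′ (trans (sym (e _)) (endOf O eq)) with r″ <? r
    ... | yes r″<r = ℕₚ.<⇒≢ r″<r (end-injective dec (trans (cong (_+ n) (sym (same r″<r))) eq″) eq)
    ... | no r″≮r = ℕₚ.<-irrefl eq″ (begin-strict
        ρ′ r″ + n ≤⟨ ℕₚ.+-monoˡ-≤ n (dec′ (ℕₚ.≮⇒≥ r″≮r)) ⟩
        ρ′ r + n  <⟨ ℕₚ.+-monoˡ-< n l ⟩
        ρ r + n   ≡⟨ eq ⟩
        _ + r     ≤⟨ ℕₚ.+-monoʳ-≤ (ρ r + n ∸ r) (ℕₚ.≮⇒≥ r″≮r) ⟩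
        _ + r″    ∎)
      where open ℕₚ.≤-Reasoning

  parts-unique : ∀ {lam mu : Partition n} {b b′} → Outlines (row (parts lam)) b → Outlines (row (parts mu)) b′ →
                 b ≐ b′ → parts lam ≡ parts mu
  parts-unique {lam} {mu} O O′ e = row-injective (positive lam) (positive mu) same
    where
    above : ∀ (mu : Partition n) r → ¬ r ≤ n → row (parts mu) r ≡ 0
    above mu r l = row-zero (parts mu) (ℕₚ.≤-trans
      (subst (length (parts mu) ≤_) (size mu) (length≤sum (positive mu))) (ℕₚ.<⇒≤ (ℕₚ.≰⇒> l)))
    same : ∀ r → row (parts lam) r ≡ row (parts mu) r
    same r with r ≤? n
    ... | yes l = outline-unique (linked⇒decreasing (decreasing lam)) (linked⇒decreasing (decreasing mu)) O O′ e r l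
    ... | no l = trans (above lam r l) (sym (above mu r l))

-- At s k a : the letter k + 1 has position a.
data At : List ℕ → ℕ → ℕ → Set where
  here  : ∀ {a s} → At (a ∷ s) (length s) a
  there : ∀ {a b s k} → At s k a → At (b ∷ s) k a

at-< : ∀ {s k a} → At s k a → k < length s
at-< here      = ℕₚ.≤-refl
at-< (there p) = ℕₚ.≤-trans (at-< p) (ℕₚ.n≤1+n _)

at-top : ∀ {a s k b} → At (a ∷ s) k b → k ≡ length s → b ≡ a
at-top here      _    = refl
at-top (there p) refl = contradiction (at-< p) (ℕₚ.<-irrefl refl)

at-unique : ∀ {s k a b} → At s k a → At s k b → a ≡ b
at-unique here      q         = sym (at-top q refl)
at-unique (there p) here      = contradiction (at-< p) (ℕₚ.<-irrefl refl)
at-unique (there p) (there q) = at-unique p q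

at-injective : ∀ {s s′} → length s ≡ length s′ → (∀ {k a} → At s k a → At s′ k a) → s ≡ s′
at-injective {[]}    {[]}     _ _ = refl
at-injective {a ∷ s} {b ∷ s′} l f =
  cong₂ _∷_ (at-top (f here) l′) (at-injective l′ λ p → drop-there p (f (there p)))
  where
  l′ = ℕₚ.suc-injective l
  drop-there : ∀ {k c} → At s k c → At (b ∷ s′) k c → At s′ k c
  drop-there p here      = contradiction (at-< p) (ℕₚ.<-irrefl (sym l′))
  drop-there p (there q) = q

module _ {n} (lam : Partition n) where

  rowIndex columnIndex : Cell lam → ℕ
  rowIndex (r , _)    = toℕ r
  columnIndex (_ , c) = toℕ c

  cell-≡ : ∀ {x y : Cell lam} → rowIndex x ≡ rowIndex y → columnIndex x ≡ columnIndex y → x ≡ y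
  cell-≡ {r , c} {r′ , c′} e e′ with refl ← Finₚ.toℕ-injective {i = r} {r′} e = cong (r ,_) (Finₚ.toℕ-injective e′)

  cell-< : ∀ x → columnIndex x < row (parts lam) (rowIndex x)
  cell-< (r , c) = subst (toℕ c <_) (sym (row-lookup (parts lam) r)) (Finₚ.toℕ<n c)

  opaque
    cell : ∀ {r c} → c < row (parts lam) r → ∃ λ x → rowIndex x ≡ r × columnIndex x ≡ c
    cell {r} {c} l = (r′ , fromℕ< l′) , Finₚ.toℕ-fromℕ< (row-< (parts lam) l) , Finₚ.toℕ-fromℕ< l′
      where
      r′ : Fin (length (parts lam))
      r′ = fromℕ< (row-< (parts lam) l)
      l′ : c < lookup (parts lam) r′
      l′ = subst (c <_) (trans (cong (row (parts lam)) (sym (Finₚ.toℕ-fromℕ< (row-< (parts lam) l)))) (row-lookup (parts lam) r′)) l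

  -- The content, with n added.
  diag : Cell lam → ℕ
  diag x = columnIndex x + n ∸ rowIndex x

  rowIndex-< : ∀ x → rowIndex x < n
  rowIndex-< (r , _) = ℕₚ.<-≤-trans (Finₚ.toℕ<n r) (subst (length (parts lam) ≤_) (size lam) (length≤sum (positive lam)))

  columnIndex-< : ∀ x → columnIndex x < n
  columnIndex-< x = ℕₚ.<-≤-trans (cell-< x) (subst (row (parts lam) (rowIndex x) ≤_) (size lam) (row≤sum (parts lam) _))
    where
    row≤sum : ∀ l r → row l r ≤ sum l
    row≤sum []      r       = z≤n
    row≤sum (x ∷ l) zero    = ℕₚ.m≤m+n x _
    row≤sum (x ∷ l) (suc r) = ℕₚ.≤-trans (row≤sum l r) (ℕₚ.m≤n+m _ x)

  diag-spec : ∀ x → columnIndex x + n ≡ diag x + rowIndex x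
  diag-spec x = sym (ℕₚ.m∸n+n≡m (ℕₚ.≤-trans (ℕₚ.<⇒≤ (rowIndex-< x)) (ℕₚ.m≤n+m n (columnIndex x))))

  diag-unique : ∀ x {a} → columnIndex x + n ≡ a + rowIndex x → diag x ≡ a
  diag-unique x {a} e = ℕₚ.+-cancelʳ-≡ (rowIndex x) (diag x) a (trans (sym (diag-spec x)) e)

  module _ (T : SYT lam) where
    open SYT T

    value : Cell lam → ℕ
    value x = toℕ (entry x)

    value-< : ∀ x → value x < n
    value-< x = Finₚ.toℕ<n (entry x)

    value-injective : ∀ {x y} → value x ≡ value y → x ≡ y
    value-injective e = proj₁ bijective (Finₚ.toℕ-injective e)

    opaque
      cellOf : ∀ {k} → k < n → ∃ λ x → value x ≡ k
      cellOf l with x , p ← proj₂ bijective (fromℕ< l) = x , trans (cong toℕ (p refl)) (Finₚ.toℕ-fromℕ< l)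

    value-row : ∀ {x y} → rowIndex x ≡ rowIndex y → columnIndex x < columnIndex y → value x < value y
    value-row {r , c} {r′ , c′} e l with refl ← Finₚ.toℕ-injective {i = r} {r′} e = rows l

    value-column : ∀ {x y} → rowIndex x < rowIndex y → columnIndex x ≡ columnIndex y → value x < value y
    value-column l e = columns l e

    -- Compare both with the cell in the row of `x` and the column of `y`.
    value-diag : ∀ {x y} → diag x ≡ diag y → rowIndex x < rowIndex y → value x < value y
    value-diag {x} {y} e l
      with z , e₁ , e₂ ← cell {rowIndex x} {columnIndex y} (ℕₚ.<-≤-trans (cell-< y) (linked⇒decreasing (decreasing lam) (ℕₚ.<⇒≤ l))) =
      ℕₚ.<-trans (value-row (sym e₁) (subst (columnIndex x <_) (sym e₂) (ℕₚ.+-cancelʳ-< n _ _ (begin-strict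
        columnIndex x + n   ≡⟨ diag-spec x ⟩
        diag x + rowIndex x <⟨ ℕₚ.+-monoʳ-< (diag x) l ⟩
        diag x + rowIndex y ≡⟨ cong (_+ rowIndex y) e ⟩
        diag y + rowIndex y ≡⟨ sym (diag-spec y) ⟩
        columnIndex y + n   ∎))))
        (value-column (subst (_< rowIndex y) (sym e₁) l) e₂)
      where open ℕₚ.≤-Reasoning

  diag-row-≡ : ∀ {x y} → diag x ≡ diag y → rowIndex x ≡ rowIndex y → x ≡ y
  diag-row-≡ {x} {y} e e′ = cell-≡ e′ (ℕₚ.+-cancelʳ-≡ n _ _ (trans (diag-spec x)
    (trans (cong₂ _+_ e e′) (sym (diag-spec y)))))

  Encodes : List ℕ → SYT lam → Set
  Encodes s T = ∀ x → At s (value T x) (diag x)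

-- From a standard tableau to its code

update : ℕ → (ℕ → ℕ) → ℕ → ℕ
update r₀ ρ r = if does (r ≟ r₀) then suc (ρ r) else ρ r

update-same : ∀ r ρ → update r ρ r ≡ suc (ρ r)
update-same r ρ rewrite dec-true (r ≟ r) refl = refl

update-other : ∀ {r r₀} ρ → r ≢ r₀ → update r₀ ρ r ≡ ρ r
update-other {r} {r₀} ρ p rewrite dec-false (r ≟ r₀) p = refl

module FromSYT {n} (lam : Partition n) (T : SYT lam) where
  open Maya n
  open Outline n

  position : ℕ → ℕ
  position k with k <? n
  ... | yes l = diag lam (proj₁ (cellOf lam T l))
  ... | no _  = 0

  position-value : ∀ {k x} → value lam T x ≡ k → position k ≡ diag lam x
  position-value {k} {x} e with k <? n
  ... | yes l with y , p ← cellOf lam T l = cong (diag lam) (value-injective lam T (trans p (sym e)))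
  ... | no ¬l = contradiction (subst (_< n) e (value-< lam T x)) ¬l

  listing-length : ∀ k → length (listing position k) ≡ k
  listing-length zero    = refl
  listing-length (suc k) = cong suc (listing-length k)

  listing-at : ∀ {j} k → j < k → At (listing position k) j (position j)
  listing-at {j} (suc k) l with j ≟ k
  ... | yes refl = subst (λ j → At (listing position (suc k)) j (position k)) (listing-length k) here
  ... | no j≢k = there (listing-at k (ℕₚ.≤∧≢⇒< (ℕₚ.≤-pred l) j≢k))

  private
    R C : Cell lam → ℕ
    R = rowIndex lam
    C = columnIndex lam

  -- The diagram of the letters 1, …, k.
  record Initial (k : ℕ) : Set where
    field
      ρ       : ℕ → ℕ
      inside  : ∀ r → ρ r ≤ row (parts lam) r
      filled  : ∀ {x} → C x < ρ (R x) → value lam T x < k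
      covered : ∀ {x} → value lam T x < k → C x < ρ (R x)
      outline : Outlines ρ (shape (listing position k))
      valid   : Valid (listing position k)

    dec : Decreasing ρ
    dec {r} {r′} r≤r′ = ℕₚ.≮⇒≥ λ l → case r ≟ r′ of λ where
      (yes refl) → ℕₚ.<-irrefl refl l
      (no r≢r′) →
        let y , yr , yc = cell lam {r′} {ρ r} (ℕₚ.<-≤-trans l (inside r′))
            x , xr , xc = cell lam {r} {ρ r} (ℕₚ.<-≤-trans l (ℕₚ.≤-trans (inside r′)
                            (linked⇒decreasing (decreasing lam) r≤r′)))
            y-filled = filled {y} (subst₂ (λ c r → c < ρ r) (sym yc) (sym yr) l)
            x<y = value-column lam T {x} {y} (subst₂ _<_ (sym xr) (sym yr) (ℕₚ.≤∧≢⇒< r≤r′ r≢r′)) (trans xc (sym yc))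
        in ℕₚ.<-irrefl refl (subst₂ (λ c r → c < ρ r) xc xr (covered (ℕₚ.<-trans x<y y-filled)))

  initial : ∀ k → k ≤ n → Initial k
  initial zero _ = record
    { ρ = λ _ → 0 ; inside = λ _ → z≤n ; filled = λ () ; covered = λ ()
    ; outline = empty-outline λ _ → refl ; valid = [] }
  initial (suc k) l with I ← initial k (ℕₚ.<⇒≤ l) with x₀ , v₀ ← cellOf lam T l = record
    { ρ       = update r₀ ρ
    ; inside  = inside′
    ; filled  = filled′
    ; covered = covered′
    ; outline = grow-outline dec outline end (update-same r₀ ρ) (update-other ρ)
    ; valid   = corner⇒addable dec outline end corner ∷ valid
    }
    where
    open Initial I
    r₀ = R x₀

    column : C x₀ ≡ ρ r₀
    column with ℕₚ.<-cmp (C x₀) (ρ r₀)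
    ... | tri< p _ _ = contradiction (filled p) (ℕₚ.<-irrefl v₀)
    ... | tri≈ _ p _ = p
    ... | tri> _ _ p with y , yr , yc ← cell lam {r₀} {ρ r₀} (ℕₚ.<-trans p (cell-< lam x₀)) =
      contradiction (subst₂ (λ c r → c < ρ r) yc yr (covered {y} (subst (value lam T y <_) v₀
        (value-row lam T yr (subst (_< C x₀) (sym yc) p))))) (ℕₚ.<-irrefl refl)

    end : ρ r₀ + n ≡ position k + r₀
    end = trans (cong (_+ n) (sym column)) (trans (diag-spec lam x₀) (cong (_+ r₀) (sym (position-value v₀))))

    corner : Corner ρ r₀
    corner {r} p with y , yr , yc ← cell lam {r} {C x₀}
                        (ℕₚ.<-≤-trans (cell-< lam x₀) (linked⇒decreasing (decreasing lam) (ℕₚ.<⇒≤ p))) =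
      subst₂ (λ c r → c < ρ r) (trans yc column) yr
        (covered {y} (subst (value lam T y <_) v₀ (value-column lam T (subst (_< r₀) (sym yr) p) yc)))

    inside′ : ∀ r → update r₀ ρ r ≤ row (parts lam) r
    inside′ r with r ≟ r₀
    ... | yes refl = subst (_≤ row (parts lam) r) (trans (cong suc column) (sym (update-same r ρ))) (cell-< lam x₀)
    ... | no p = subst (_≤ row (parts lam) r) (sym (update-other ρ p)) (inside r)

    filled′ : ∀ {x} → C x < update r₀ ρ (R x) → value lam T x < suc k
    filled′ {x} p with R x ≟ r₀
    ... | no q = ℕₚ.m≤n⇒m≤1+n (filled (subst (C x <_) (update-other ρ q) p))
    ... | yes q with C x ≟ ρ r₀
    ...   | yes e = ℕₚ.≤-reflexive (cong suc (trans (cong (value lam T) (cell-≡ lam q (trans e (sym column)))) v₀))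
    ...   | no e = ℕₚ.m≤n⇒m≤1+n (filled (ℕₚ.≤∧≢⇒<
              (ℕₚ.≤-pred (subst (C x <_) (trans (cong (update r₀ ρ) q) (trans (update-same r₀ ρ) (cong (suc ∘ ρ) (sym q)))) p))
              (e ∘ λ h → trans h (cong ρ q))))

    grows : ∀ r → ρ r ≤ update r₀ ρ r
    grows r with r ≟ r₀
    ... | yes refl = subst (ρ r ≤_) (sym (update-same r ρ)) (ℕₚ.n≤1+n _)
    ... | no p = ℕₚ.≤-reflexive (sym (update-other ρ p))

    covered′ : ∀ {x} → value lam T x < suc k → C x < update r₀ ρ (R x)
    covered′ {x} p with value lam T x ≟ k
    ... | no q = ℕₚ.<-≤-trans (covered (ℕₚ.≤∧≢⇒< (ℕₚ.≤-pred p) q)) (grows (R x))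
    ... | yes q with refl ← value-injective lam T (trans q (sym v₀)) =
      ℕₚ.≤-reflexive (trans (cong suc column) (sym (update-same r₀ ρ)))

  code : List ℕ
  code = listing position n

  code-valid : Valid code
  code-valid = Initial.valid (initial n ℕₚ.≤-refl)

  code-encodes : Encodes lam code T
  code-encodes x = subst (At code (value lam T x)) (position-value refl) (listing-at n (value-< lam T x))

  code-outline : Outlines (row (parts lam)) (shape code)
  code-outline = record
    { rowOf = λ t → case rowOf outline t of λ { (r , e) → r , trans (cong (_+ n) (sym (all r))) e }
    ; endOf = λ {j} {r} e → endOf outline (trans (cong (_+ n) (all r)) e)
    }
    where
    open Initial (initial n ℕₚ.≤-refl)
    open Outlines
    all : ∀ r → ρ r ≡ row (parts lam) r
    all r = ℕₚ.≤-antisym (inside r) (ℕₚ.≮⇒≥ λ l → case cell lam l of λ { (x , xr , xc) →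
      ℕₚ.<-irrefl refl (subst₂ (λ c r → c < ρ r) xc xr (covered (value-< lam T x))) })

-- From a code to a standard tableau

increment : ℕ → List ℕ → List ℕ
increment _       []      = 1 ∷ []
increment zero    (x ∷ l) = suc x ∷ l
increment (suc r) (x ∷ l) = x ∷ increment r l

increment-sum : ∀ r l → sum (increment r l) ≡ suc (sum l)
increment-sum zero    []      = refl
increment-sum (suc r) []      = refl
increment-sum zero    (x ∷ l) = refl
increment-sum (suc r) (x ∷ l) = trans (cong (x +_) (increment-sum r l)) (ℕₚ.+-suc x (sum l))

increment-positive : ∀ r {l} → All (0 <_) l → All (0 <_) (increment r l)
increment-positive zero    []      = s≤s z≤n ∷ []
increment-positive (suc r) []      = s≤s z≤n ∷ []
increment-positive zero    (p ∷ P) = s≤s z≤n ∷ P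
increment-positive (suc r) (p ∷ P) = p ∷ increment-positive r P

increment-row : ∀ {r} l → r ≤ length l → ∀ r′ → row (increment r l) r′ ≡ update r (row l) r′
increment-row {zero}  []      _ zero     = refl
increment-row {zero}  []      _ (suc r′) = refl
increment-row {zero}  (x ∷ l) _ zero     = refl
increment-row {zero}  (x ∷ l) _ (suc r′) = refl
increment-row {suc r} (x ∷ l) (s≤s p) zero = refl
increment-row {suc r} (x ∷ l) (s≤s p) (suc r′) = increment-row l p r′

module ToSYT (n : ℕ) where
  open Maya n
  open Outline n

  -- Entries depend on bare row and column numbers, so that nothing has to be transported along the
  -- change of `Cell` when a row grows.
  record Filling (s : List ℕ) : Set where
    field
      lengths     : List ℕ
      lengths⁺  : All (0 <_) lengths
      total     : sum lengths ≡ length s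
      dec       : Decreasing (row lengths)
      outline   : Outlines (row lengths) (shape s)
      entry     : ℕ → ℕ → ℕ
      placed    : ∀ {r c} → c < row lengths r → ∃ λ a → At s (entry r c) a × c + n ≡ a + r
      rows      : ∀ {r c c′} → c < c′ → c′ < row lengths r → entry r c < entry r c′
      columns   : ∀ {r r′ c} → r < r′ → c < row lengths r′ → entry r c < entry r′ c
      injective : ∀ {r c r′ c′} → c < row lengths r → c′ < row lengths r′ → entry r c ≡ entry r′ c′ → r ≡ r′ × c ≡ c′
      onto      : ∀ {k} → k < length s → ∃₂ λ r c → c < row lengths r × entry r c ≡ k

    entry-< : ∀ {r c} → c < row lengths r → entry r c < length s
    entry-< p = at-< (proj₁ (proj₂ (placed p)))

  fill : ∀ {s} → Valid s → Filling s
  fill [] = record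
    { lengths = [] ; lengths⁺ = [] ; total = refl ; dec = λ _ → z≤n ; outline = empty-outline λ _ → refl
    ; entry = λ _ _ → 0 ; placed = λ () ; rows = λ _ () ; columns = λ _ () ; injective = λ () ; onto = λ () }
  fill (_∷_ {a} {s} A V) with F ← fill V
    with r₀ , end , corner ← addable⇒corner (Filling.dec F) (Filling.outline F) A = record
    { lengths = increment r₀ lengths
    ; lengths⁺ = increment-positive r₀ lengths⁺
    ; total = trans (increment-sum r₀ lengths) (cong suc total)
    ; dec = dec′
    ; outline = grow-outline dec outline end (trans (rows≡ r₀) (update-same r₀ (row lengths)))
                  λ p → trans (rows≡ _) (update-other (row lengths) p)
    ; entry = entry′
    ; placed = placed′
    ; rows = rows′
    ; columns = columns′
    ; injective = injective′
    ; onto = onto′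
    }
    where
    open Filling F

    c₀ : ℕ
    c₀ = row lengths r₀

    r₀≤ : r₀ ≤ length lengths
    r₀≤ = below r₀ corner
      where
      below : ∀ r → Corner (row lengths) r → r ≤ length lengths
      below zero    _ = z≤n
      below (suc r) k = row-< lengths (k (ℕₚ.n<1+n r))

    ρ′ : ℕ → ℕ
    ρ′ = row (increment r₀ lengths)

    rows≡ : ∀ r → ρ′ r ≡ update r₀ (row lengths) r
    rows≡ = increment-row lengths r₀≤

    entry′ : ℕ → ℕ → ℕ
    entry′ r c = if does (r ≟ r₀) then (if does (c ≟ c₀) then length s else entry r c) else entry r c

    entry-new : entry′ r₀ c₀ ≡ length s
    entry-new rewrite dec-true (r₀ ≟ r₀) refl | dec-true (c₀ ≟ c₀) refl = refl

    entry-old : ∀ {r c} → c < row lengths r → entry′ r c ≡ entry r c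
    entry-old {r} {c} l with r ≟ r₀
    ... | no p rewrite dec-false (r ≟ r₀) p = refl
    ... | yes refl rewrite dec-true (r ≟ r) refl | dec-false (c ≟ c₀) (ℕₚ.<⇒≢ l) = refl

    data View (r c : ℕ) : Set where
      new : r ≡ r₀ → c ≡ c₀ → View r c
      old : c < row lengths r → View r c

    view : ∀ {r c} → c < ρ′ r → View r c
    view {r} {c} l with r ≟ r₀
    ... | no p = old (subst (c <_) (trans (rows≡ r) (update-other (row lengths) p)) l)
    ... | yes refl with c ≟ c₀
    ...   | yes q = new refl q
    ...   | no q = old (ℕₚ.≤∧≢⇒< (ℕₚ.≤-pred (subst (c <_) (trans (rows≡ r) (update-same r (row lengths))) l)) q)

    grows : ∀ r → row lengths r ≤ ρ′ r
    grows r with r ≟ r₀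
    ... | yes refl = subst (row lengths r ≤_) (sym (trans (rows≡ r) (update-same r (row lengths)))) (ℕₚ.n≤1+n _)
    ... | no p = ℕₚ.≤-reflexive (sym (trans (rows≡ r) (update-other (row lengths) p)))

    dec′ : Decreasing ρ′
    dec′ {r} {r′} l with r′ ≟ r₀ | r ≟ r₀
    ... | yes refl | yes refl = ℕₚ.≤-refl
    ... | yes refl | no p = subst₂ _≤_ (sym (trans (rows≡ r′) (update-same r′ (row lengths)))) (sym (trans (rows≡ r) (update-other (row lengths) p)))
                              (corner (ℕₚ.≤∧≢⇒< l p))
    ... | no q | _ = ℕₚ.≤-trans (ℕₚ.≤-reflexive (trans (rows≡ r′) (update-other (row lengths) q))) (ℕₚ.≤-trans (dec l) (grows r))

    placed′ : ∀ {r c} → c < ρ′ r → ∃ λ b → At (a ∷ s) (entry′ r c) b × c + n ≡ b + r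
    placed′ l with view l
    ... | new refl refl = a , subst (λ k → At (a ∷ s) k a) (sym entry-new) here , end
    ... | old p with b , q , e ← placed p = b , subst (λ k → At (a ∷ s) k b) (sym (entry-old p)) (there q) , e

    rows′ : ∀ {r c c′} → c < c′ → c′ < ρ′ r → entry′ r c < entry′ r c′
    rows′ l l′ with view l′
    ... | new refl refl = subst₂ _<_ (sym (entry-old l)) (sym entry-new) (entry-< l)
    ... | old p = subst₂ _<_ (sym (entry-old (ℕₚ.<-trans l p))) (sym (entry-old p)) (rows l p)

    columns′ : ∀ {r r′ c} → r < r′ → c < ρ′ r′ → entry′ r c < entry′ r′ c
    columns′ l l′ with view l′
    ... | new refl refl = subst₂ _<_ (sym (entry-old (corner l))) (sym entry-new) (entry-< (corner l))
    ... | old p with p′ ← ℕₚ.<-≤-trans p (dec (ℕₚ.<⇒≤ l)) =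
      subst₂ _<_ (sym (entry-old p′)) (sym (entry-old p)) (columns l p)

    injective′ : ∀ {r c r′ c′} → c < ρ′ r → c′ < ρ′ r′ → entry′ r c ≡ entry′ r′ c′ → r ≡ r′ × c ≡ c′
    injective′ l l′ e with view l | view l′
    ... | new refl refl | new refl refl = refl , refl
    ... | new refl refl | old p = contradiction (entry-< p) (ℕₚ.<-irrefl (trans (sym (entry-old p)) (trans (sym e) entry-new)))
    ... | old p | new refl refl = contradiction (entry-< p) (ℕₚ.<-irrefl (trans (sym (entry-old p)) (trans e entry-new)))
    ... | old p | old p′ = injective p p′ (trans (sym (entry-old p)) (trans e (entry-old p′)))

    onto′ : ∀ {k} → k < suc (length s) → ∃₂ λ r c → c < ρ′ r × entry′ r c ≡ k
    onto′ {k} l with k ≟ length s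
    ... | yes refl = r₀ , c₀ , subst (c₀ <_) (sym (trans (rows≡ r₀) (update-same r₀ (row lengths)))) ℕₚ.≤-refl , entry-new
    ... | no p with r , c , q , e ← onto (ℕₚ.≤∧≢⇒< (ℕₚ.≤-pred l) p) =
      r , c , ℕₚ.<-≤-trans q (grows r) , trans (entry-old q) e

  tableau : ∀ {s} → length s ≡ n → Valid s →
            ∃ λ (lam : Partition n) → Outlines (row (parts lam)) (shape s) × ∃ (Encodes lam s)
  tableau {s} len V with F ← fill V = lam , outline , T , encodes
    where
    open Filling F

    lam : Partition n
    lam = record { parts = lengths ; decreasing = decreasing⇒linked dec ; positive = lengths⁺ ; size = trans total len }

    R C : Cell lam → ℕ
    R = rowIndex lam
    C = columnIndex lam

    bound : ∀ x → entry (R x) (C x) < n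
    bound x = subst (entry (R x) (C x) <_) len (entry-< (cell-< lam x))

    T : SYT lam
    T = record
      { entry     = λ x → fromℕ< (bound x)
      ; bijective =
        (λ {x} {y} e → let er , ec = injective (cell-< lam x) (cell-< lam y)
                             (trans (sym (Finₚ.toℕ-fromℕ< (bound x))) (trans (cong toℕ e) (Finₚ.toℕ-fromℕ< (bound y))))
                       in cell-≡ lam er ec) ,
        λ k → let r , c , q , e = onto (subst (toℕ k <_) (sym len) (Finₚ.toℕ<n k))
                  x , xr , xc   = cell lam q
              in x , λ { refl → Finₚ.toℕ-injective (trans (Finₚ.toℕ-fromℕ< (bound x)) (trans (cong₂ entry xr xc) e)) }
      ; rows      = λ {r} {c} {c′} l → subst₂ _<_ (sym (Finₚ.toℕ-fromℕ< (bound (r , c)))) (sym (Finₚ.toℕ-fromℕ< (bound (r , c′))))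
                      (rows l (cell-< lam (r , c′)))
      ; columns   = λ {r} {r′} {c} {c′} l e → subst₂ _<_ (sym (Finₚ.toℕ-fromℕ< (bound (r , c)))) (sym (Finₚ.toℕ-fromℕ< (bound (r′ , c′))))
                      (subst (λ c → entry (toℕ r) c < entry (toℕ r′) (toℕ c′)) (sym e) (columns l (cell-< lam (r′ , c′))))
      }

    encodes : Encodes lam s T
    encodes x with a , q , e ← placed (cell-< lam x) =
      subst₂ (At s) (sym (Finₚ.toℕ-fromℕ< (bound x))) (sym (diag-unique lam x e)) q

  -- The cells of k in T and of τ k in U share a diagonal; if they differ, the
  -- letter of the lower one in the other tableau is smaller and already settled.
  module _ {lam : Partition n} {T U : SYT lam} {s s′} (len : length s′ ≡ n)
           (τ : ℕ → ℕ) (τ-inv : ∀ k → τ (τ k) ≡ k)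
           (to : ∀ {k a} → At s k a → At s′ (τ k) a) (from : ∀ {k a} → At s′ k a → At s (τ k) a)
           (mono : ∀ {k k′ a} → k < k′ → At s k a → At s k′ a → τ k < τ k′)
           (ET : Encodes lam s T) (EU : Encodes lam s′ U) where

    private
      VT VU : Cell lam → ℕ
      VT = value lam T
      VU = value lam U

    relabel : ∀ x → VU x ≡ τ (VT x)
    relabel x = <-rec (λ k → ∀ x → VT x ≡ k → VU x ≡ τ k) go (VT x) x refl
      where
      go : ∀ k → (∀ {j} → j < k → ∀ x → VT x ≡ j → VU x ≡ τ j) → ∀ x → VT x ≡ k → VU x ≡ τ k
      go k IH x refl
        with y , e ← cellOf lam U (subst (τ (VT x) <_) len (at-< (to (ET x))))
        with d ← at-unique (to (ET x)) (subst (λ k → At s′ k (diag lam y)) e (EU y))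
        with ℕₚ.<-cmp (rowIndex lam x) (rowIndex lam y)
      ... | tri≈ _ p _ with refl ← diag-row-≡ lam d p = e
      ... | tri> _ _ p with l ← value-diag lam T (sym d) p =
        contradiction (trans (sym (τ-inv _)) (trans (cong τ (trans (sym (IH l y refl)) e)) (τ-inv _))) (ℕₚ.<⇒≢ l)
      -- `VU x` corresponds in `T` to a letter on the same diagonal as `VT x`; by `mono` it cannot
      -- be larger, and if smaller, the induction hypothesis would place it at `x` as well.
      ... | tri< p _ _ with l ← subst (VU x <_) e (value-diag lam U d p)
        with q ← from (EU x) with ℕₚ.<-cmp (τ (VU x)) (VT x)
      ...   | tri≈ _ h _ = contradiction (trans (sym (τ-inv _)) (cong τ h)) (ℕₚ.<⇒≢ l)
      ...   | tri> _ _ h = contradiction (subst (τ (VT x) <_) (τ-inv _) (mono h (ET x) q)) (ℕₚ.<⇒≯ l)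
      ...   | tri< h _ _
        with z , ez ← cellOf lam T (ℕₚ.<-trans h (value-< lam T x))
        with refl ← value-injective lam U (trans (IH h z ez) (τ-inv _)) = contradiction ez (ℕₚ.<⇒≢ h ∘ sym)

  code-unique : ∀ {lam : Partition n} {T U : SYT lam} {s s′} → length s ≡ n → length s′ ≡ n →
                (∀ x → SYT.entry T x ≡ SYT.entry U x) → Encodes lam s T → Encodes lam s′ U → s ≡ s′
  code-unique {lam} {T} {U} {s} {s′} l l′ e ET EU = at-injective (trans l (sym l′)) λ {k} {a} p →
    let x , v = cellOf lam T (subst (k <_) l (at-< p))
    in subst₂ (At s′) (trans (cong toℕ (sym (e x))) v)
         (at-unique (subst (λ k → At s k (diag lam x)) v (ET x)) p) (EU x)

-- Reading words

⊖-injective : ∀ k {m m′} → m ⊖ k ≡ m′ ⊖ k → m ≡ m′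
⊖-injective k {m} {m′} e with ℕₚ.<-cmp m m′
... | tri< l _ _ = contradiction e (ℤₚ.<⇒≢ (ℤₚ.⊖-monoˡ-< k l))
... | tri≈ _ p _ = p
... | tri> _ _ l = contradiction (sym e) (ℤₚ.<⇒≢ (ℤₚ.⊖-monoˡ-< k l))

⊖-≡⇒ : ∀ a b c d → a ⊖ b ≡ c ⊖ d → a + d ≡ c + b
⊖-≡⇒ a b c d e = trans (ℕₚ.+-comm a d) (trans (⊖-injective (d + b)
  (trans (ℤₚ.+-cancelˡ-⊖ d a b) (trans e (trans (sym (ℤₚ.+-cancelˡ-⊖ b c d)) (cong ((b + c) ⊖_) (ℕₚ.+-comm b d))))))
  (ℕₚ.+-comm b c))

⇒⊖-≡ : ∀ a b c d → a + d ≡ c + b → a ⊖ b ≡ c ⊖ d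
⇒⊖-≡ a b c d e = trans (sym (ℤₚ.+-cancelˡ-⊖ d a b))
  (trans (cong₂ _⊖_ (trans (ℕₚ.+-comm d a) (trans e (ℕₚ.+-comm c b))) (ℕₚ.+-comm d b)) (ℤₚ.+-cancelˡ-⊖ b c d))

allPairs-++ : ∀ {A : Set} {R : A → A → Set} xs {ys} → AllPairs R (xs ++ ys) →
              All (λ x → All (R x) ys) xs × AllPairs R ys
allPairs-++ []       p       = [] , p
allPairs-++ (x ∷ xs) (q ∷ p) = let a , b = allPairs-++ xs p in Allₚ.++⁻ʳ xs q ∷ a , b

allPairs-with : ∀ {A : Set} {P : A → Set} {R : A → A → Set} {xs} → All P xs → AllPairs R xs →
                AllPairs (λ x y → P x × P y × R x y) xs
allPairs-with []       []       = []
allPairs-with (p ∷ ps) (r ∷ rs) = All.zipWith (λ (q , s) → p , q , s) (ps , r) ∷ allPairs-with ps rs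

sublist-pair : ∀ {R : ℕ → ℕ → Set} {x y xs} → AllPairs R xs → (x ∷ y ∷ []) ⊆ xs → R x y
sublist-pair (_ ∷ rs) (_ ∷ʳ p)   = sublist-pair rs p
sublist-pair (r ∷ _)  (refl ∷ p) with s ∷ [] ← Sublistₚ.All-resp-⊆ p r = s

module Reading {n} (lam : Partition n) where

  private
    R C : Cell lam → ℕ
    R = rowIndex lam
    C = columnIndex lam
    d : Cell lam → ℕ
    d = diag lam

  -- The part `x ≢ y` says that no cell is listed twice; `exchange-word` uses it to keep the
  -- exchanged letters out of the other segments of the word.
  Before : Cell lam → Cell lam → Set
  Before x y = x ≢ y × d x ≤ d y

  content⇒diag : ∀ {x j} → content lam x ≡ j ⊖ n → d x ≡ j
  content⇒diag {x} {j} e = diag-unique lam x (⊖-≡⇒ (C x) (R x) j n e)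

  diag⇒content : ∀ x → content lam x ≡ d x ⊖ n
  diag⇒content x = ⇒⊖-≡ (C x) (R x) (d x) n (diag-spec lam x)

  cells-unique : AllPairs _≢_ (cells lam)
  cells-unique = AllPairsₚ.concat⁺
    (Allₚ.map⁺ (All.universal (λ r → AllPairsₚ.map⁺ {f = r ,_} (AllPairsₚ.tabulate⁺ {f = id} λ { i≢j refl → i≢j refl })) (allFin _)))
    (AllPairsₚ.map⁺ (AllPairsₚ.tabulate⁺ {f = id} λ r≢r′ →
      Allₚ.map⁺ (All.universal (λ c → Allₚ.map⁺ (All.universal (λ { c′ refl → r≢r′ refl }) _)) _)))

  cells-complete : ∀ x → x ∈ cells lam
  cells-complete (r , c) = ∈-concat⁺′ (∈-map⁺ (r ,_) (∈-allFin c)) (∈-map⁺ _ (∈-allFin r))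

  block : ℤ.ℤ → List (Cell lam)
  block k = filter (λ x → content lam x ℤ.≟ k) (cells lam)

  block-diag : ∀ j {x} → x ∈ block (j ⊖ n) → d x ≡ j
  block-diag j {x} p = content⇒diag {x} (proj₂ (∈-filter⁻ (λ x → content lam x ℤ.≟ (j ⊖ n)) {xs = cells lam} p))

  order : List (Cell lam)
  order = readingOrder lam

  ordered : AllPairs Before order
  ordered = AllPairsₚ.concat⁺
    (Allₚ.map⁺ (Allₚ.map⁺ (All.universal inside (upTo (n + n)))))
    (AllPairsₚ.map⁺ (AllPairsₚ.map⁺ (AllPairsₚ.applyUpTo⁺₁ id (n + n) λ {i} {j} i<j _ →
      All.tabulate λ p → All.tabulate λ q →
        let l = subst₂ _<_ (sym (block-diag i p)) (sym (block-diag j q)) i<j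
        in (λ { refl → ℕₚ.<-irrefl refl l }) , ℕₚ.<⇒≤ l)))
    where
    inside : ∀ j → AllPairs Before (block (j ⊖ n))
    inside j = AllPairs.map (λ (p , q , x≢y) → x≢y , ℕₚ.≤-reflexive (trans p (sym q)))
      (allPairs-with (All.tabulate (block-diag j)) (AllPairsₚ.filter⁺ _ cells-unique))

  complete : ∀ x → x ∈ order
  complete x = ∈-concat⁺′
    (∈-filter⁺ _ (cells-complete x) (diag⇒content x))
    (∈-map⁺ block (∈-map⁺ (_⊖ n) (∈-upTo⁺ (ℕₚ.≤-<-trans (ℕₚ.m∸n≤m _ (R x)) (ℕₚ.+-monoˡ-< n (columnIndex-< lam x))))))

  after : ∀ {xs x} → AllPairs Before xs → x ∈ xs →
          ∃₂ λ ys zs → xs ≡ ys ++ x ∷ zs × AllPairs Before zs × (∀ {y} → y ∈ xs → d x < d y → y ∈ zs)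
  after {x = x} p x∈ with ys , zs , refl ← ∈-∃++ x∈ with q , _ ∷ r ← allPairs-++ ys p =
    ys , zs , refl , r , λ {y} y∈ l → later y l (∈-++⁻ ys y∈) q
    where
    later : ∀ {ys zs} y → d x < d y → y ∈ ys ⊎ y ∈ x ∷ zs → All (λ y → All (Before y) (x ∷ zs)) ys → y ∈ zs
    later y l (inj₁ y∈) q with (_ , l′) ∷ _ ← All.lookup q y∈ = contradiction l (ℕₚ.≤⇒≯ l′)
    later y l (inj₂ (here refl)) q = contradiction l (ℕₚ.<-irrefl refl)
    later y l (inj₂ (there y∈)) q = y∈

  split-pair : ∀ {x y} → d x < d y → ∃₂ λ s t → ∃ λ u → order ≡ s ++ x ∷ t ++ y ∷ u
  split-pair {x} {y} l with s , zs , eq , p , f ← after ordered (complete x)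
    with t , u , refl ← ∈-∃++ (f (complete y) l) = s , t , u , eq

  split-triple : ∀ {x z y} → d x < d z → d z < d y →
                 ∃₂ λ s t → ∃₂ λ u v → order ≡ s ++ x ∷ t ++ z ∷ u ++ y ∷ v
  split-triple {x} {z} {y} l l′ with s , zs , eq , p , f ← after ordered (complete x)
    with t , us , refl , q , g ← after p (f (complete z) l)
    with u , v , refl ← ∈-∃++ (g (f (complete y) (ℕₚ.<-trans l l′)) l′) = s , t , u , v , eq

  module _ (T : SYT lam) where
    open SYT T using (letter)

    descent-sign : ∀ {x y} j → letter x ≡ j → letter y ≡ suc j → d x ≢ d y →
                   descentSign (word T) j ≡ (if (d x <ᵇ d y) then Sign.+ else Sign.-)
    descent-sign {x} {y} j refl ly x≢y with ℕₚ.<-cmp (d x) (d y)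
    ... | tri≈ _ p _ = contradiction p x≢y
    ... | tri< l _ _ with s , t , u , eq ← split-pair l =
      cong (if_then Sign.+ else Sign.-) (trans (dec-true (_ ⊆? word T) sub) (sym (<ᵇ-true l)))
      where
      sub : (j ∷ suc j ∷ []) ⊆ word T
      sub = subst₂ (λ m xs → (j ∷ m ∷ []) ⊆ map letter xs) ly (sym eq)
        (Sublistₚ.map⁺ letter (Sublistₚ.++⁺ˡ s (refl ∷ Sublistₚ.++⁺ˡ t (refl ∷ minimum u))))
    ... | tri> _ _ l = cong (if_then Sign.+ else Sign.-) (trans (dec-false (_ ⊆? word T) none) (sym (<ᵇ-false (ℕₚ.<⇒≤ l))))
      where
      injective : ∀ {u w} → letter u ≡ letter w → u ≡ w
      injective e = value-injective lam T (ℕₚ.suc-injective e)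
      none : ¬ (j ∷ suc j ∷ []) ⊆ word T
      none sub = sublist-pair {R = λ a b → ¬ (a ≡ j × b ≡ suc j)}
        (AllPairsₚ.map⁺ (AllPairs.map (λ { {u} {w} (_ , le) (p , q) →
          ℕₚ.<-irrefl refl (ℕₚ.<-≤-trans l (subst₂ (λ u w → d u ≤ d w) (injective p) (injective (trans q (sym ly))) le)) })
          ordered)) sub (refl , refl)

  exchange-word : ∀ {i} (T U : SYT lam) {x z y s t u v} → order ≡ s ++ x ∷ t ++ z ∷ u ++ y ∷ v →
                  SYT.letter U x ≡ SYT.letter T y → SYT.letter U y ≡ SYT.letter T x →
                  (∀ {c} → c ≢ x → c ≢ y → SYT.letter U c ≡ SYT.letter T c) →
                  (SYT.letter T x ∷ SYT.letter T z ∷ SYT.letter T y ∷ []) ↭ (i ∸ 1 ∷ i ∷ i + 1 ∷ []) →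
                  SYT.letter T z ≢ i → ElementaryDualEquivalence i (word T) (word U)
  exchange-word {i} T U {x} {z} {y} {s} {t} {u} {v} eq ex ey same perm z≢i
    with os , o₁ ∷ p₁ ← allPairs-++ s (subst (AllPairs Before) eq ordered)
    with ot , o₂ ∷ p₂ ← allPairs-++ t p₁
    with ou , o₃ ∷ p₃ ← allPairs-++ u p₂ =
    subst₂ (ElementaryDualEquivalence i) (sym (expand T)) (sym expandU) (switch _ _ _ _ perm z≢i)
    where
    fT fU : Cell lam → ℕ
    fT = SYT.letter T
    fU = SYT.letter U

    expand : ∀ V → word V ≡ map (SYT.letter V) s ++ SYT.letter V x ∷ map (SYT.letter V) t ++
                            SYT.letter V z ∷ map (SYT.letter V) u ++ SYT.letter V y ∷ map (SYT.letter V) v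
    expand V = trans (cong (map f) eq) (trans (Listₚ.map-++ f s _) (cong (λ w → map f s ++ f x ∷ w)
      (trans (Listₚ.map-++ f t _) (cong (λ w → map f t ++ f z ∷ w) (Listₚ.map-++ f u _)))))
      where
      f : Cell lam → ℕ
      f = SYT.letter V

    y∈u : y ∈ u ++ y ∷ v
    y∈u = ∈-++⁺ʳ u (here refl)
    y∈t : y ∈ t ++ z ∷ u ++ y ∷ v
    y∈t = ∈-++⁺ʳ t (there y∈u)

    keep : ∀ {xs} → (∀ {c} → c ∈ xs → c ≢ x × c ≢ y) → map fU xs ≡ map fT xs
    keep {xs} f = Listₚ.map-cong-local (All.tabulate λ c∈ → same (proj₁ (f c∈)) (proj₂ (f c∈)))

    expandU : word U ≡ map fT s ++ fT y ∷ map fT t ++ fT z ∷ map fT u ++ fT x ∷ map fT v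
    expandU = trans (expand U) (cong₂ _++_
      (keep λ c∈ → proj₁ (All.head (All.lookup os c∈)) , proj₁ (All.lookup (All.tail (All.lookup os c∈)) y∈t))
      (cong₂ _∷_ ex (cong₂ _++_
        (keep λ c∈ → proj₁ (All.lookup o₁ (∈-++⁺ˡ c∈)) ∘ sym , proj₁ (All.lookup (All.tail (All.lookup ot c∈)) y∈u))
        (cong₂ _∷_ (same (λ { refl → proj₁ (All.lookup o₁ (∈-++⁺ʳ t (here refl))) refl })
                         (proj₁ (All.lookup o₂ y∈u)))
          (cong₂ _++_
            (keep λ c∈ → proj₁ (All.lookup o₁ (∈-++⁺ʳ t (there (∈-++⁺ˡ c∈)))) ∘ sym ,
                         proj₁ (All.head (All.lookup ou c∈)))
            (cong₂ _∷_ ey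
              (keep λ c∈ → proj₁ (All.lookup o₁ (∈-++⁺ʳ t (there (∈-++⁺ʳ u (there c∈))))) ∘ sym ,
                           proj₁ (All.lookup o₃ c∈) ∘ sym)))))))

  pointwise-map : ∀ {S : ℕ → ℕ → Set} {f g : Cell lam → ℕ} {xs x} → Pointwise S (map f xs) (map g xs) → x ∈ xs → S (f x) (g x)
  pointwise-map {xs = _ ∷ _} (p ∷ _) (here refl) = p
  pointwise-map {xs = _ ∷ _} (_ ∷ p) (there x∈)  = pointwise-map p x∈

  -- An elementary dual equivalence rewrites only letters up to `i + 1`, and `value` counts from 0.
  -- This gives the hypothesis `f-fix` for the labelling induced by an isomorphism.
  large-fixed : ∀ {i} (T U : SYT lam) → ElementaryDualEquivalence i (word T) (word U) →
                ∀ x → i < value lam T x → value lam U x ≡ value lam T x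
  large-fixed {i} T U e x l = conclude (pointwise-map (pointwise e) (complete x))
    where
    small : ∀ {a x y z} → (x ∷ y ∷ z ∷ []) ↭ (i ∸ 1 ∷ i ∷ i + 1 ∷ []) → a ∈ x ∷ y ∷ z ∷ [] → a ≤ suc i
    small p a∈ with ∈-resp-↭ p a∈
    ... | here refl                 = ℕₚ.≤-trans (ℕₚ.m∸n≤m i 1) (ℕₚ.n≤1+n i)
    ... | there (here refl)         = ℕₚ.n≤1+n i
    ... | there (there (here refl)) = ℕₚ.≤-reflexive (ℕₚ.+-comm i 1)

    unchanged : ∀ xs → Pointwise (λ a b → a ≡ b ⊎ a ≤ suc i) xs xs
    unchanged []       = []
    unchanged (x ∷ xs) = inj₁ refl ∷ unchanged xs

    pointwise : ∀ {w w′} → ElementaryDualEquivalence i w w′ → Pointwise (λ a b → a ≡ b ⊎ a ≤ suc i) w w′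
    pointwise (switch s t u v p _) =
      Pointwise.++⁺ (unchanged s) (inj₂ (small p (here refl)) ∷
        Pointwise.++⁺ (unchanged t) (inj₁ refl ∷
          Pointwise.++⁺ (unchanged u) (inj₂ (small p (there (there (here refl)))) ∷ unchanged v)))

    conclude : SYT.letter T x ≡ SYT.letter U x ⊎ SYT.letter T x ≤ suc i → value lam U x ≡ value lam T x
    conclude (inj₁ p) = sym (ℕₚ.suc-injective p)
    conclude (inj₂ p) = contradiction l (ℕₚ.≤⇒≯ (ℕₚ.≤-pred p))

-- Moves of codes as elementary dual equivalences of words

exchange : ℕ → ℕ → ℕ
exchange p k = if does (k ≟ p) then suc p else if does (k ≟ suc p) then p else k

exchange-low : ∀ p → exchange p p ≡ suc p
exchange-low p rewrite dec-true (p ≟ p) refl = refl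

exchange-high : ∀ p → exchange p (suc p) ≡ p
exchange-high p rewrite dec-false (suc p ≟ p) ℕₚ.1+n≢n | dec-true (suc p ≟ suc p) refl = refl

exchange-other : ∀ {p k} → k ≢ p → k ≢ suc p → exchange p k ≡ k
exchange-other {p} {k} a b rewrite dec-false (k ≟ p) a | dec-false (k ≟ suc p) b = refl

exchange-involutive : ∀ p k → exchange p (exchange p k) ≡ k
exchange-involutive p k with k ≟ p
... | yes refl = trans (cong (exchange k) (exchange-low k)) (exchange-high k)
... | no a with k ≟ suc p
...   | yes refl = trans (cong (exchange p) (exchange-high p)) (exchange-low p)
...   | no b = trans (cong (exchange p) (exchange-other a b)) (exchange-other a b)

exchange-mono : ∀ {p k k′} → k < k′ → ¬ (k ≡ p × k′ ≡ suc p) → exchange p k < exchange p k′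
exchange-mono {p} {k} {k′} l ¬pair with k ≟ p | k ≟ suc p | k′ ≟ p | k′ ≟ suc p
... | yes refl | _ | yes refl | _ = contradiction l (ℕₚ.<-irrefl refl)
... | yes refl | _ | no _ | yes refl = contradiction (refl , refl) ¬pair
... | yes refl | _ | no a | no b = subst₂ _<_ (sym (exchange-low k)) (sym (exchange-other a b)) (ℕₚ.≤∧≢⇒< l (b ∘ sym))
... | no _ | yes refl | yes refl | _ = contradiction l (ℕₚ.<⇒≯ (ℕₚ.n<1+n _))
... | no _ | yes refl | no _ | yes refl = contradiction l (ℕₚ.<-irrefl refl)
... | no _ | yes refl | no a | no b =
  subst₂ _<_ (sym (exchange-high p)) (sym (exchange-other a b)) (ℕₚ.<-trans (ℕₚ.n<1+n _) l)
... | no a | no b | yes refl | _ = subst₂ _<_ (sym (exchange-other a b)) (sym (exchange-low k′)) (ℕₚ.<-trans l (ℕₚ.n<1+n _))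
... | no a | no b | no _ | yes refl =
  subst₂ _<_ (sym (exchange-other a b)) (sym (exchange-high p)) (ℕₚ.≤∧≢⇒< (ℕₚ.≤-pred l) a)
... | no a | no b | no a′ | no b′ = subst₂ _<_ (sym (exchange-other a b)) (sym (exchange-other a′ b′)) l

-- Kind i p m : the color i exchanges p and suc p across m, where these letters
-- are numbered from 0.
data Kind : ℕ → ℕ → ℕ → Set where
  low : ∀ {p} → Kind (2 + p) p (2 + p)
  top : ∀ {m} → Kind (2 + m) (suc m) m

module Exchange (n : ℕ) where
  open Maya n
  open Steps n

  at-exchange : ∀ {x y r k a} → At (y ∷ x ∷ r) k a → At (x ∷ y ∷ r) (exchange (length r) k) a
  at-exchange {x} {y} {r} here = subst (λ k → At (x ∷ y ∷ r) k y) (sym (exchange-high (length r))) (there here)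
  at-exchange {x} {y} {r} (there here) = subst (λ k → At (x ∷ y ∷ r) k x) (sym (exchange-low (length r))) here
  at-exchange {x} {y} {r} {a = a} (there (there p)) =
    subst (λ k → At (x ∷ y ∷ r) k a) (sym (exchange-other (ℕₚ.<⇒≢ (at-< p)) (ℕₚ.<⇒≢ (ℕₚ.<-trans (at-< p) (ℕₚ.n<1+n _)))))
      (there (there p))

  at-cons : ∀ {p c s s′} → length s ≡ length s′ → suc p < length s →
            (∀ {k a} → At s k a → At s′ (exchange p k) a) →
            ∀ {k a} → At (c ∷ s) k a → At (c ∷ s′) (exchange p k) a
  at-cons {p} {c} {s} {s′} l lt f here = subst (λ k → At (c ∷ s′) k c)
    (trans (sym l) (sym (exchange-other (ℕₚ.<⇒≢ (ℕₚ.<-trans (ℕₚ.n<1+n p) lt) ∘ sym) (ℕₚ.<⇒≢ lt ∘ sym)))) here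
  at-cons l lt f (there q) = there (f q)

  record Exchanged (i : ℕ) (s s′ : List ℕ) : Set where
    field
      {p m x y z} : ℕ
      kind : Kind i p m
      at-p : At s p x
      at-q : At s (suc p) y
      at-m : At s m z
      mid  : Mid z x y
      to   : ∀ {k a} → At s k a → At s′ (exchange p k) a
      from : ∀ {k a} → At s′ k a → At s (exchange p k) a

  step-exchange : ∀ {i s s′} → Step i s s′ → Exchanged i s s′
  step-exchange (swapLow mid) = record
    { kind = low ; at-p = there (there here) ; at-q = there here ; at-m = here ; mid = mid
    ; to = at-cons refl ℕₚ.≤-refl at-exchange ; from = at-cons refl ℕₚ.≤-refl at-exchange }
  step-exchange (swapTop mid) = record
    { kind = top ; at-p = there here ; at-q = here ; at-m = there (there here) ; mid = mid
    ; to = at-exchange ; from = at-exchange }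
  step-exchange (later st) = record
    { kind = kind ; at-p = there at-p ; at-q = there at-q ; at-m = there at-m ; mid = mid
    ; to = at-cons (step-length st) (at-< at-q) to
    ; from = at-cons (sym (step-length st)) (subst (suc p <_) (step-length st) (at-< at-q)) from }
    where open Exchanged (step-exchange st)

  module _ {i s s′} {lam : Partition n} (T U : SYT lam) (len : length s ≡ n) (len′ : length s′ ≡ n)
           (ET : Encodes lam s T) (EU : Encodes lam s′ U) (ex : Exchanged i s s′) where

    open Exchanged ex

    exchanged⇒elementary : ElementaryDualEquivalence i (word T) (word U)
    exchanged⇒elementary
      with X , vX ← cellOf lam T (subst (p <_) len (at-< at-p))
      with Y , vY ← cellOf lam T (subst (suc p <_) len (at-< at-q))
      with Z , vZ ← cellOf lam T (subst (m <_) len (at-< at-m)) =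
      conclude (subst₂ (λ z x → Mid z x (diag lam Y)) (sym (found Z vZ at-m)) (sym (found X vX at-p))
        (subst (Mid z x) (sym (found Y vY at-q)) mid))
      where
      open Reading lam

      found : ∀ c {k a} → value lam T c ≡ k → At s k a → diag lam c ≡ a
      found c refl = at-unique (ET c)

      relabelled : ∀ c → value lam U c ≡ exchange p (value lam T c)
      relabelled = ToSYT.relabel n {lam} {T} {U} len′ (exchange p) (exchange-involutive p) to from
        (λ l q q′ → exchange-mono l λ { (refl , refl) →
          proj₂ (proj₂ (mid-≢ mid)) (trans (at-unique at-p q) (at-unique q′ at-q)) }) ET EU

      UX : SYT.letter U X ≡ SYT.letter T Y
      UX = cong suc (trans (relabelled X) (trans (cong (exchange p) vX) (trans (exchange-low p) (sym vY))))

      UY : SYT.letter U Y ≡ SYT.letter T X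
      UY = cong suc (trans (relabelled Y) (trans (cong (exchange p) vY) (trans (exchange-high p) (sym vX))))

      same : ∀ {c} → c ≢ X → c ≢ Y → SYT.letter U c ≡ SYT.letter T c
      same {c} c≢X c≢Y = cong suc (trans (relabelled c) (exchange-other
        (λ e → c≢X (value-injective lam T (trans e (sym vX)))) (λ e → c≢Y (value-injective lam T (trans e (sym vY))))))

      Z≢ : SYT.letter T Z ≢ i
      Z≢ e = avoid kind (trans (sym (cong suc vZ)) e)
        where
        avoid : ∀ {i p m} → Kind i p m → suc m ≢ i
        avoid low ()
        avoid top ()

      letters : ∀ {i p m} → Kind i p m → (suc p ∷ suc m ∷ suc (suc p) ∷ []) ↭ (i ∸ 1 ∷ i ∷ i + 1 ∷ [])
      letters (low {p}) rewrite ℕₚ.+-comm p 1 = ↭-prep _ (↭-swap _ _ ↭-refl)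
      letters (top {m}) rewrite ℕₚ.+-comm m 1 = ↭-swap _ _ ↭-refl

      perm : (SYT.letter T X ∷ SYT.letter T Z ∷ SYT.letter T Y ∷ []) ↭ (i ∸ 1 ∷ i ∷ i + 1 ∷ [])
      perm rewrite vX | vY | vZ = letters kind

      flip : ∀ {a b c : ℕ} → (c ∷ b ∷ a ∷ []) ↭ (a ∷ b ∷ c ∷ [])
      flip = ↭-trans (↭-swap _ _ ↭-refl) (↭-trans (↭-prep _ (↭-swap _ _ ↭-refl)) (↭-swap _ _ ↭-refl))

      conclude : Mid (diag lam Z) (diag lam X) (diag lam Y) → ElementaryDualEquivalence i (word T) (word U)
      conclude (inj₁ (l , l′)) with _ , _ , _ , _ , eq ← split-triple l l′ =
        exchange-word T U eq UX UY same perm Z≢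
      conclude (inj₂ (l , l′)) with _ , _ , _ , _ , eq ← split-triple l l′ =
        exchange-word T U eq UY UX (λ a b → same b a) (↭-trans flip perm) Z≢

  step⇒elementary : ∀ {i s s′} {lam : Partition n} (T U : SYT lam) → length s ≡ n → Step i s s′ →
                    Encodes lam s T → Encodes lam s′ U → ElementaryDualEquivalence i (word T) (word U)
  step⇒elementary T U len st ET EU =
    exchanged⇒elementary T U len (trans (sym (step-length st)) len) ET EU (step-exchange st)

-- The isomorphism

-- `Cell` depends on `parts` alone, so the same fields serve for `mu` although the proofs stored in
-- the two partitions may differ.
cast : ∀ {n s} {lam mu : Partition n} → parts lam ≡ parts mu → (T : SYT lam) → Encodes lam s T → ∃ (Encodes mu s)
cast {lam = record { parts = l }} {record { parts = l }} refl T e =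
  record { entry = entry ; bijective = bijective ; rows = rows ; columns = columns } , e
  where open SYT T

at-adjacent : ∀ {s j k a b} → At s j a → At s k b → k ≡ suc j → ∃₂ λ pre r → s ≡ pre ++ b ∷ a ∷ r × length r ≡ j
at-adjacent {s = c ∷ s} (there p) (there q) e with pre , r , eq , l ← at-adjacent p q e = c ∷ pre , r , cong (c ∷_) eq , l
at-adjacent here (there q) refl = contradiction (at-< q) (ℕₚ.<⇒≯ (ℕₚ.n<1+n _))
at-adjacent here here e = contradiction (sym e) ℕₚ.1+n≢n
at-adjacent {s = _ ∷ c ∷ s} (there p) here e with refl ← at-top p (sym (ℕₚ.suc-injective e)) =
  [] , s , refl , ℕₚ.suc-injective e

outlines-≐ : ∀ {n ρ b b′} → Outline.Outlines n ρ b → Outline.Outlines n ρ b′ → b ≐ b′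
outlines-≐ {n} {ρ} {b} {b′} O O′ j with b j in e | b′ j in e′
... | true  | true  = refl
... | false | false = refl
... | true  | false with r , p ← Outline.Outlines.rowOf O e = clash (Outline.Outlines.endOf O′ p) e′
... | false | true  with r , p ← Outline.Outlines.rowOf O′ e′ = clash (Outline.Outlines.endOf O p) e

plus-if : ∀ b → plus (if b then Sign.+ else Sign.-) ≡ b
plus-if true  = refl
plus-if false = refl

pos-< : ∀ {n} (c : Fin (n ∸ 1)) → pos c < n
pos-< {suc n} c = s≤s (Finₚ.toℕ<n c)

module Main (n : ℕ) (𝒢 : SignedColoredGraph n n) (deg : IsDualEquivalenceGraph 𝒢)
            (v : SignedColoredGraph.Vertex 𝒢) where
  open SignedColoredGraph 𝒢
  open Axioms 𝒢 deg
  open Maya n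
  open Steps n
  open Outline n
  open Levels 𝒢 deg
  open Tower 𝒢 deg

  private
    L : Level n
    L = level n ℕₚ.≤-refl

  open Level L
  open Lift L ℕₚ.≤-refl

  private
    module K = SignedColoredGraph (component 𝒢 v)

  reach : (w : K.Vertex) → Reach n v (proj₁ w)
  reach (_ , p) = path-map 𝒢 (λ _ i<n _ → i<n) p

  vertex : ∀ {w} → Reach n v w → K.Vertex
  vertex p = _ , path-map 𝒢 (λ 1<i i<n _ → 1<i , ℕₚ.∸-monoˡ-≤ 1 i<n) p

  private
    signs-at : ∀ {w s j a b} → Signs w s → At s j a → At s (suc j) b → sg (suc j) w ≡ (a <ᵇ b)
    signs-at {w} S p q with pre , r , refl , refl ← at-adjacent p q refl = proj₁ (tail pre S)
      where
      tail : ∀ pre {s} → Signs w (pre ++ s) → Signs w s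
      tail []        S = S
      tail (_ ∷ pre) S = tail pre (signs-tail S)

    descent : ∀ {lam : Partition n} {s j} (T : SYT lam) → Valid s → Encodes lam s T → ∀ {x y} →
              value lam T x ≡ j → value lam T y ≡ suc j →
              plus (descentSign (word T) (suc j)) ≡ (diag lam x <ᵇ diag lam y)
    descent {lam} {s} T V E {x} {y} refl vy = trans
      (cong plus (Reading.descent-sign lam T _ refl (cong suc vy) distinct)) (plus-if _)
      where
      distinct : diag lam x ≢ diag lam y
      distinct with pre , r , refl , _ ← at-adjacent (E x) (subst (λ k → At s k (diag lam y)) vy (E y)) refl
        with A ∷ _ ← valid-tail pre V = addable≢removable A (add-removable (diag lam x) (shape r))

  shape-≐ : (w : K.Vertex) → shape (t v) ≐ shape (t (proj₁ w))
  shape-≐ w = reach-shape (reach w)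

  lam : Partition n
  lam = proj₁ (ToSYT.tableau n (len v) (valid v))

  lam-outline : Outlines (row (parts lam)) (shape (t v))
  lam-outline = proj₁ (proj₂ (ToSYT.tableau n (len v) (valid v)))

  opaque
    tableau : (w : K.Vertex) → ∃ (Encodes lam (t (proj₁ w)))
    tableau w with mu , O , T , e ← ToSYT.tableau n (len (proj₁ w)) (valid (proj₁ w)) =
      cast {mu = lam} (parts-unique {mu} {lam} O lam-outline (sym ∘ shape-≐ w)) T e

  φ : K.Vertex → SYT lam
  φ w = proj₁ (tableau w)

  encodes : ∀ w → Encodes lam (t (proj₁ w)) (φ w)
  encodes w = proj₂ (tableau w)

  same-code : ∀ {T U : SYT lam} {s s′} → length s ≡ n → s ≡ s′ → Encodes lam s T → Encodes lam s′ U →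
              ∀ x → SYT.entry T x ≡ SYT.entry U x
  same-code {T} {U} l refl e e′ x = Finₚ.toℕ-injective (sym
    (ToSYT.relabel n {lam} {T} {U} l id (λ _ → refl) id id (λ k<k′ _ _ → k<k′) e e′ x))

  isomorphic : component 𝒢 v ≅ standard lam
  isomorphic = record
    { morphism = record
      { func = record
        { to   = φ
        ; cong = λ {w} {w′} e → same-code {φ w} {φ w′} (len _) (t-cong e) (encodes w) (encodes w′)
        }
      ; signatures = signature
      ; edges = λ {i} {w} {w′} e → let 1<i , i<n = E-color e in 1<i , i<n ,
          Exchange.step⇒elementary n (φ w) (φ w′) (len _) (t-step e i<n) (encodes w) (encodes w′)
      }
    ; bijective =
      (λ {w} {w′} e → t-inj (path-trans 𝒢 (path-sym 𝒢 (reach w)) (reach w′))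
        (ToSYT.code-unique n {lam} {φ w} {φ w′} (len _) (len _) e (encodes w) (encodes w′))) ,
      onto
    }
    where
    signature : ∀ w c → σ (proj₁ w) c ≡ descentSign (word (φ w)) (pos c)
    signature w c
      with x , vx ← cellOf lam (φ w) (ℕₚ.<-trans (ℕₚ.n<1+n _) (pos-< c))
      with y , vy ← cellOf lam (φ w) (pos-< c) = plus-injective (trans (sym (sg-σ refl (proj₁ w))) (trans
        (signs-at (signs (proj₁ w)) (subst (λ k → At (t (proj₁ w)) k _) vx (encodes w x))
                                    (subst (λ k → At (t (proj₁ w)) k _) vy (encodes w y)))
        (sym (descent (φ w) (valid (proj₁ w)) (encodes w) vx vy))))

    onto : ∀ U → ∃ λ w → ∀ {w′} → w′ K.≈ w → ∀ x → SYT.entry (φ w′) x ≡ SYT.entry U x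
    onto U with w , p , eq ← move [] {v} refl (FromSYT.code-valid lam U)
                 (outlines-≐ lam-outline (FromSYT.code-outline lam U))
                 (trans (len v) (sym (FromSYT.listing-length lam U n))) =
      vertex (reach-≤ (ℕₚ.≤-reflexive (len v)) p) ,
      λ {w′} e → same-code {φ w′} {U} (len _) (trans (t-cong e) eq) (encodes w′) (FromSYT.code-encodes lam U)

  -- The labelling induced by the isomorphism must agree with `t`, so `lam` and `mu` outline the
  -- boundary path of one and the same code.
  unique : ∀ {mu : Partition n} → component 𝒢 v ≅ standard mu → lam ≈ₚ mu
  unique {mu} iso = parts-unique {lam} {mu} lam-outline (code-outline (ψ (vertex {v} (stop V.refl)))) λ j →
    cong (λ s → shape s j) (Uniqueness.unique v f f-valid f-sg f-cong f-fix n ℕₚ.≤-refl (stop V.refl))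
    where
    open _≅_ iso
    open Morphism morphism using (func; signatures; edges) renaming (φ to ψ)
    open FromSYT mu

    f : ∀ w → Reach n v w → ℕ → ℕ
    f w p = position (ψ (vertex p))

    f-valid : ∀ {w} (p : Reach n v w) → Valid (listing (f w p) n)
    f-valid p = code-valid (ψ (vertex p))

    f-sg : ∀ {w} (p : Reach n v w) {k} → suc k < n → sg (suc k) w ≡ (f w p k <ᵇ f w p (suc k))
    f-sg {w} p {k} l
      with c , e ← coordinate< {suc k} (s≤s z≤n) l
      with x , vx ← cellOf mu (ψ (vertex p)) (ℕₚ.<-trans (ℕₚ.n<1+n k) l)
      with y , vy ← cellOf mu (ψ (vertex p)) l =
      trans (sg-σ e w) (trans (cong plus (trans (signatures (vertex p) c) (cong (descentSign (word (ψ (vertex p)))) e)))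
        (trans (descent (ψ (vertex p)) (code-valid (ψ (vertex p))) (code-encodes (ψ (vertex p))) vx vy)
          (sym (cong₂ _<ᵇ_ (position-value _ vx) (position-value _ vy)))))

    position-≡ : ∀ {T U : SYT mu} {k} → (∀ x → value mu T x ≡ k → value mu U x ≡ k) → k < n → position T k ≡ position U k
    position-≡ {T} {U} h l with x , vx ← cellOf mu T l = trans (position-value T vx) (sym (position-value U (h x vx)))

    f-cong : ∀ {w x} (p : Reach n v w) (q : Reach n v x) → w ≈ x → ∀ {k} → k < n → f w p k ≡ f x q k
    f-cong p q e l = position-≡ {ψ (vertex p)} {ψ (vertex q)}
      (λ x h → trans (cong toℕ (sym (Func.cong func {vertex p} {vertex q} e x))) h) l

    f-fix : ∀ {i w x} (p : Reach n v w) (q : Reach n v x) {k} → k < n → i < k → E i w x → f w p k ≡ f x q k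
    f-fix p q l i<k e = position-≡ {ψ (vertex p)} {ψ (vertex q)}
      (λ { x refl → Reading.large-fixed mu (ψ (vertex p)) (ψ (vertex q)) (proj₂ (proj₂ (edges {u = vertex p} {v = vertex q} e))) x i<k }) l

theorem3p9 : (n : ℕ) → 0 < n →
    (𝒢 : SignedColoredGraph n n) → IsDualEquivalenceGraph 𝒢 →
    (v : SignedColoredGraph.Vertex 𝒢) →
    ∃! _≈ₚ_ (λ (lam : Partition n) → component 𝒢 v ≅ standard lam)
theorem3p9 n _ 𝒢 deg v = lam , isomorphic , unique
  where open Main n 𝒢 deg v
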